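{- (1) For every prime $r$, the polynomials $\Psi_{15r}(x)$ and $\Psi_{21r}(x)$ are flat. (2) Let $q\ge 11$ be a prime. Then $\Psi_{3qr}(x)$ is flat for all primes $r\ge 2q-1$; however, there is at least one prime $r$ such that $\Psi_{3qr}(x)$ is not flat. (3) Let $3<q<r$ be primes. Then for all $k\le 16$ the coefficient $c_{3qr}(k)$ of $x^k$ in $\Psi_{3qr}(x)$ satisfies $|c_{3qr}(k)|\le 1$.
   Context: $\Phi_n(x)$ is the $n$-th cyclotomic polynomial and $\Psi_n(x)=(x^n-1)/\Phi_n(x)=\sum_k c_n(k)x^k\in\mathbb Z[x]$ (with $c_n(k)=0$ for $k$ outside $[0,n-\varphi(n)]$). A polynomial in $\mathbb Z[x]$ is flat if the maximum absolute value of its coefficients equals $1$. -}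

module Defs where

open import Data.Nat using (ℕ; zero; suc; _∸_; _≤_; _≟_)
open import Data.Nat.Divisibility using (_∣?_)
open import Data.Integer as ℤ using (ℤ; 0ℤ; 1ℤ; -1ℤ; ∣_∣)
open import Data.List using (List; []; _∷_; map; reverse; length; replicate; filter; upTo; _++_; foldr)
open import Data.Product using (_×_; ∃-syntax)
open import Relation.Nullary using (yes; no)
open import Relation.Binary.PropositionalEquality using (_≡_)

-- Polynomials in ℤ[x] as little-endian coefficient lists:
-- the i-th entry is the coefficient of x^i.
Poly : Set
Poly = List ℤ

coeff : Poly → ℕ → ℤ
coeff []       _       = 0ℤ
coeff (a ∷ p)  zero    = a
coeff (a ∷ p)  (suc k) = coeff p k

addP : Poly → Poly → Poly
addP []       q        = q
addP p        []       = p
addP (a ∷ p)  (b ∷ q)  = (a ℤ.+ b) ∷ addP p q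

mulP : Poly → Poly → Poly
mulP []       q = []
mulP (a ∷ p)  q = addP (map (a ℤ.*_) q) (0ℤ ∷ mulP p q)

prodP : List Poly → Poly
prodP = foldr mulP (1ℤ ∷ [])

xn1 : ℕ → Poly
xn1 zero    = 0ℤ ∷ []
xn1 (suc n) = -1ℤ ∷ (replicate n 0ℤ ++ (1ℤ ∷ []))

-- pointwise difference of big-endian lists aligned at the head
subH : List ℤ → List ℤ → List ℤ
subH (a ∷ as) (b ∷ bs) = (a ℤ.- b) ∷ subH as bs
subH as       []       = as
subH []       bs       = map ℤ.-_ bs

-- long division (big-endian) by a monic divisor 1 ∷ D', producing k quotient coefficients
ldiv : ℕ → List ℤ → List ℤ → List ℤ
ldiv zero    D' P          = []
ldiv (suc k) D' []         = []
ldiv (suc k) D' (c ∷ rest) = c ∷ ldiv k D' (subH rest (map (c ℤ.*_) D'))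

tail' : List ℤ → List ℤ
tail' []       = []
tail' (_ ∷ xs) = xs

-- quotient p / d for a monic divisor d (whose last list entry is its leading coefficient 1);
-- used only for exact divisions of monic polynomials below
divMonic : Poly → Poly → Poly
divMonic p d = reverse (ldiv (suc (length p ∸ length d)) (tail' (reverse d)) (reverse p))

-- proper divisors of m (for m ≥ 1): the d ∈ {0,…,m-1} with d ∣ m (0 never qualifies)
properDivisors : ℕ → List ℕ
properDivisors m = filter (_∣? m) (upTo m)

-- table m d = Φ_d for 1 ≤ d ≤ m, defined via the standard recursion
--   Φ_n = (x^n - 1) / ∏_{d ∣ n, d < n} Φ_d
table : ℕ → ℕ → Poly
table zero    d = []
table (suc m) d with d ≟ suc m
... | yes _ = divMonic (xn1 (suc m)) (prodP (map (table m) (properDivisors (suc m))))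
... | no  _ = table m d

Φ : ℕ → Poly
Φ n = table n n

Ψ : ℕ → Poly
Ψ n = divMonic (xn1 n) (Φ n)

c : ℕ → ℕ → ℤ
c n k = coeff (Ψ n) k

Flat : Poly → Set
Flat p = (∀ k → ∣ coeff p k ∣ ≤ 1) × (∃[ k ] ∣ coeff p k ∣ ≡ 1)

{-# OPTIONS --safe #-}
-- Reversing coefficient lists turns the long divisions that define Φ_n and Ψ_n into divisions of
-- power series. For n = 3qr with (q - 4)(r - 4) ≥ 12 we have deg Ψ_n ≤ deg Φ_n, so up to reversal
-- Ψ_n is the product of Φ_d over the proper divisors d of n, namely
--     Φ_3q (1 + x^r + x^2r) (1 - x^(qr)),
-- where the coefficient of x^k in Φ_3q is χ(k) + χ(k - q) + χ(k - 2q) and χ = 1, -1, 0, 1, -1, 0, …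
-- The coefficients of x^k with k < r meet only one of the three copies of Φ_3q; if r ≥ 2q - 1 the
-- copies are disjoint altogether, which gives flatness. If q < r ≤ 2q - 3 and
-- q ≡ r (mod 3), two copies overlap in equal coefficients ±1 and ±2 appears.
--
-- By the symmetry in q and r it remains to find a prime r ≠ q with r ≡ q (mod 3) lying
-- between (q + 3)/2 and 2q - 3. Put n = ⌊(q - 1)/3⌋ and ε = q mod 6. If there is no such r, then
-- comparing exponents of primes in ∏_{k<n} (6k + ε) and ∏_{k<n} (2k + 1) shows that the quotient,
-- which is about 3^n, is at most 3^(-n/3) times the primorial of 6n/7 times a factor of size
-- exp (O(√n log n)). As 3^(4/3) > 4^(6/7), this fails for large n; the remaining q are covered by
-- two chains of primes with ratios below 2.
module Submission where

open import Defs
open import Algebra.Bundles using (CommutativeRing)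
import Algebra.Properties.AbelianGroup
import Algebra.Solver.Ring
open import Algebra.Solver.Ring.AlmostCommutativeRing using (fromCommutativeRing;
  _-Raw-AlmostCommutative⟶_)
open import Data.Empty using (⊥-elim; ⊥)
open import Data.Fin using (Fin; toℕ; fromℕ<)
import Data.Fin.Properties as Finₚ
open import Data.Integer as ℤ using (ℤ; 0ℤ; 1ℤ; -1ℤ; ∣_∣)
import Data.Integer.Properties as ℤₚ
open import Data.Integer.Tactic.RingSolver using (solve-∀)
open import Data.List using (List; []; _∷_; _∷ʳ_; map; reverse; length; replicate; upTo; _++_; take)
open import Data.List.Membership.Propositional using (_∈_)
open import Data.List.Membership.Propositional.Properties using (∈-upTo⁺; ∈-upTo⁻; ∈-filter⁺;
  ∈-filter⁻)
open import Data.List.Membership.Propositional.Properties.WithK using (unique∧set⇒bag)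
import Data.List.Properties as Listₚ
open import Data.List.Relation.Binary.BagAndSetEquality using (∼bag⇒↭)
open import Data.List.Relation.Binary.Permutation.Propositional as Perm using (_↭_; ↭-sym)
open import Data.List.Relation.Unary.All as All using (All; []; _∷_)
open import Data.List.Relation.Unary.AllPairs using ([]; _∷_)
open import Data.List.Relation.Unary.Any using (here; there)
open import Data.List.Relation.Unary.Unique.Propositional using (Unique)
import Data.List.Relation.Unary.Unique.Propositional.Properties as Uniqueₚ
open import Data.Maybe using (Maybe; just; nothing)
open import Data.Nat using (ℕ; zero; suc; _+_; _*_; _∸_; _^_; _≤_; _<_; z≤n; s≤s; NonZero; _≟_;
  _≤?_; _<?_; _!; nonTrivial⇒n>1; n>1⇒nonTrivial; >-nonZero)
open import Data.Nat.Combinatorics using (k![n∸k]!∣n!)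
open import Data.Nat.Coprimality using (Coprime; coprime-divisor; coprime-Bézout)
open import Data.Nat.DivMod using (_/_; _%_; m≡m%n+[m/n]*n; m%n<n; m%n≤m; %-distribˡ-*;
  [m+kn]%n≡m%n; m/n*n≤m; m∣n⇒o%n%m≡o%m)
open import Data.Nat.Divisibility using (_∣_; _∣?_; divides; ∣⇒≤; ∣-trans; ∣-refl; m∣m*n; n∣m*n;
  *-monoʳ-∣; *-cancelˡ-∣; 1∣_; ∣1⇒≡1; m%n≡0⇒n∣m; m≤n⇒m!∣n!; ∣m+n∣m⇒∣n; hasNonTrivialDivisor)
open import Data.Nat.GCD using (module Bézout)
open import Data.Nat.Induction using (<-rec)
open import Data.Nat.ListAction using (product)
open import Data.Nat.Primality using (Prime; prime⇒irreducible; prime⇒nonZero; prime⇒nonTrivial;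
  prime?; euclidsLemma; prime[2]; rough∧square>⇒prime; productOfPrimes≢0)
open import Data.Nat.Primality.Factorisation using (factorise; PrimeFactorisation)
import Data.Nat.Properties as ℕₚ
import Data.Nat.Tactic.RingSolver as ℕ-Solver
open import Data.Product using (_×_; _,_; proj₁; proj₂; Σ; ∃-syntax)
open import Data.Sum using (_⊎_; inj₁; inj₂)
open import Data.Unit using (⊤; tt)
open import Function.Bundles using (mk⇔)
open import Relation.Binary.PropositionalEquality using (_≡_; _≢_; refl; sym; trans; cong; cong₂;
  subst; module ≡-Reasoning; subst₂)
import Relation.Binary.Reasoning.Setoid
open import Relation.Nullary using (¬_; yes; no; Dec; _→-dec_; _⊎-dec_; _×-dec_; ¬?)
open import Relation.Nullary.Decidable using (from-yes; from-no)

-- Formal power series over ℤ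

-- The long divisions come with no proof of exactness, so a quotient is known only modulo a power of
-- x. The first division yields deg Φ_n + 1 coefficients; if these cover deg Ψ_n, the second
-- division needs no more of them, and Φ_3qr itself never has to be determined. This requirement, 2
-- deg Ψ_n ≤ n, multiplies out to (q - 4)(r - 4) ≥ 12.
--
-- The products ∏ (6k + ε) and ∏ (2k + 1) are compared because a prime above 3 divides their terms
-- almost equally often. A prime p ≥ 2n dividing some 6k + ε < 6n has a cofactor below 3, so p ≡ ε
-- (mod 6), and for n near q/3 the interval from 2n to 6n is the window allowed for r. Below 2n, a
-- prime dividing one term 6k + ε is itself some 2k + 1; a surplus needs two such terms, hence 7p <
-- 6n, which is the origin of the primorial of 6n/7. The gain 3^(n/3) arises because 3 divides a
-- third of the numbers 2k + 1 and no 6k + ε.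

Series : Set
Series = ℕ → ℤ

infix 4 _≈_
-- Wrapped in a record so that unification can recover `f` and `g`, which a bare pointwise equality
-- would not allow.
record _≈_ (f g : Series) : Set where
  constructor ≗⇒≈
  field at : ∀ k → f k ≡ g k
open _≈_ public

tl : Series → Series
tl f k = f (suc k)

cst : ℤ → Series
cst a zero    = a
cst a (suc _) = 0ℤ

infixl 6 _⊕_
infixl 7 _⊛_
infix  8 ⊖_

_⊕_ : Series → Series → Series
(f ⊕ g) k = f k ℤ.+ g k

⊖_ : Series → Series
(⊖ f) k = ℤ.- f k

_·_ : ℤ → Series → Series
(a · f) k = a ℤ.* f k

_⊛_ : Series → Series → Series
(f ⊛ g) zero    = f 0 ℤ.* g 0
(f ⊛ g) (suc k) = f 0 ℤ.* g (suc k) ℤ.+ (tl f ⊛ g) k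

-- Locality makes products compatible with truncation; full agreement gives the congruence law as a
-- special case.
⊛-local : ∀ k {f f′ g g′ : Series} → (∀ i → i ≤ k → f i ≡ f′ i) → (∀ i → i ≤ k → g i ≡ g′ i) →
          (f ⊛ g) k ≡ (f′ ⊛ g′) k
⊛-local zero    p q = cong₂ ℤ._*_ (p 0 z≤n) (q 0 z≤n)
⊛-local (suc k) p q = cong₂ ℤ._+_ (cong₂ ℤ._*_ (p 0 z≤n) (q (suc k) ℕₚ.≤-refl))
  (⊛-local k (λ i i≤k → p (suc i) (s≤s i≤k)) (λ i i≤k → q i (ℕₚ.m≤n⇒m≤1+n i≤k)))

⊛-sucʳ : ∀ f g k → (f ⊛ g) (suc k) ≡ f (suc k) ℤ.* g 0 ℤ.+ (f ⊛ tl g) k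
⊛-sucʳ f g zero    = ℤₚ.+-comm (f 0 ℤ.* g 1) (f 1 ℤ.* g 0)
⊛-sucʳ f g (suc k) rewrite ⊛-sucʳ (tl f) g k =
  swap (f 0 ℤ.* g (suc (suc k))) (f (suc (suc k)) ℤ.* g 0) _
  where
  swap : ∀ a b c → a ℤ.+ (b ℤ.+ c) ≡ b ℤ.+ (a ℤ.+ c)
  swap = solve-∀

⊛-comm′ : ∀ k f g → (f ⊛ g) k ≡ (g ⊛ f) k
⊛-comm′ zero    f g = ℤₚ.*-comm (f 0) (g 0)
⊛-comm′ (suc k) f g = trans (cong₂ ℤ._+_ (ℤₚ.*-comm (f 0) _) (⊛-comm′ k (tl f) g))
  (sym (⊛-sucʳ g f k))

⊛-distribʳ′ : ∀ k h f g → ((f ⊕ g) ⊛ h) k ≡ (f ⊛ h) k ℤ.+ (g ⊛ h) k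
⊛-distribʳ′ zero    h f g = ℤₚ.*-distribʳ-+ (h 0) (f 0) (g 0)
⊛-distribʳ′ (suc k) h f g =
  trans (cong (ℤ._+_ ((f 0 ℤ.+ g 0) ℤ.* h (suc k))) (⊛-distribʳ′ k h (tl f) (tl g)))
        (regroup (f 0) (g 0) (h (suc k)) _ _)
  where
  regroup : ∀ a b c x y → (a ℤ.+ b) ℤ.* c ℤ.+ (x ℤ.+ y) ≡ (a ℤ.* c ℤ.+ x) ℤ.+ (b ℤ.* c ℤ.+ y)
  regroup = solve-∀

·-⊛ : ∀ k a f g → ((a · f) ⊛ g) k ≡ a ℤ.* (f ⊛ g) k
·-⊛ zero    a f g = ℤₚ.*-assoc a (f 0) (g 0)
·-⊛ (suc k) a f g = trans (cong (ℤ._+_ (a ℤ.* f 0 ℤ.* g (suc k))) (·-⊛ k a (tl f) g))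
  (factor a (f 0) (g (suc k)) _)
  where
  factor : ∀ a b c x → a ℤ.* b ℤ.* c ℤ.+ a ℤ.* x ≡ a ℤ.* (b ℤ.* c ℤ.+ x)
  factor = solve-∀

⊛-assoc′ : ∀ k f g h → ((f ⊛ g) ⊛ h) k ≡ (f ⊛ (g ⊛ h)) k
⊛-assoc′ zero    f g h = ℤₚ.*-assoc (f 0) (g 0) (h 0)
⊛-assoc′ (suc k) f g h = begin
  f 0 ℤ.* g 0 ℤ.* h (suc k) ℤ.+ (((f 0 · tl g) ⊕ (tl f ⊛ g)) ⊛ h) k
    ≡⟨ cong (ℤ._+_ (f 0 ℤ.* g 0 ℤ.* h (suc k))) (trans (⊛-distribʳ′ k h (f 0 · tl g) (tl f ⊛ g))
         (cong₂ ℤ._+_ (·-⊛ k (f 0) (tl g) h) (⊛-assoc′ k (tl f) g h))) ⟩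
  f 0 ℤ.* g 0 ℤ.* h (suc k) ℤ.+ (f 0 ℤ.* (tl g ⊛ h) k ℤ.+ (tl f ⊛ (g ⊛ h)) k)
    ≡⟨ regroup (f 0) (g 0) (h (suc k)) _ _ ⟩
  f 0 ℤ.* (g 0 ℤ.* h (suc k) ℤ.+ (tl g ⊛ h) k) ℤ.+ (tl f ⊛ (g ⊛ h)) k ∎
  where
  open ≡-Reasoning
  regroup : ∀ a b c x y → a ℤ.* b ℤ.* c ℤ.+ (a ℤ.* x ℤ.+ y) ≡ a ℤ.* (b ℤ.* c ℤ.+ x) ℤ.+ y
  regroup = solve-∀

cst-⊛ : ∀ k a f → (cst a ⊛ f) k ≡ a ℤ.* f k
cst-⊛ zero    a f = refl
cst-⊛ (suc k) a f = trans (cong (ℤ._+_ (a ℤ.* f (suc k))) (zero-⊛ k)) (ℤₚ.+-identityʳ _)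
  where
  zero-⊛ : ∀ k → (tl (cst a) ⊛ f) k ≡ 0ℤ
  zero-⊛ zero    = refl
  zero-⊛ (suc k) = trans (ℤₚ.+-identityˡ _) (zero-⊛ k)

seriesRing : CommutativeRing _ _
seriesRing = record
  { Carrier = Series ; _≈_ = _≈_ ; _+_ = _⊕_ ; _*_ = _⊛_ ; -_ = ⊖_ ; 0# = cst 0ℤ ; 1# = cst 1ℤ
  ; isCommutativeRing = record
    { isRing = record
      { +-isAbelianGroup = record
        { isGroup = record
          { isMonoid = record
            { isSemigroup = record
              { isMagma = record
                { isEquivalence = record
                  { refl  = ≗⇒≈ λ _ → refl
                  ; sym   = λ p → ≗⇒≈ λ k → sym (at p k)
                  ; trans = λ p q → ≗⇒≈ λ k → trans (at p k) (at q k)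
                  }
                ; ∙-cong = λ p q → ≗⇒≈ λ k → cong₂ ℤ._+_ (at p k) (at q k)
                }
              ; assoc = λ f g h → ≗⇒≈ λ k → ℤₚ.+-assoc (f k) (g k) (h k)
              }
            ; identity = (λ f → ≗⇒≈ (idˡ f)) ,
                         (λ f → ≗⇒≈ λ k → trans (ℤₚ.+-comm (f k) _) (idˡ f k))
            }
          ; inverse = (λ f → ≗⇒≈ λ k → trans (ℤₚ.+-inverseˡ (f k)) (cst0 k)) ,
                      (λ f → ≗⇒≈ λ k → trans (ℤₚ.+-inverseʳ (f k)) (cst0 k))
          ; ⁻¹-cong = λ p → ≗⇒≈ λ k → cong ℤ.-_ (at p k)
          }
        ; comm = λ f g → ≗⇒≈ λ k → ℤₚ.+-comm (f k) (g k)
        }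
      ; *-cong     = λ p q → ≗⇒≈ λ k → ⊛-local k (λ i _ → at p i) (λ i _ → at q i)
      ; *-assoc    = λ f g h → ≗⇒≈ λ k → ⊛-assoc′ k f g h
      ; *-identity = (λ f → ≗⇒≈ (oneˡ f)) ,
                     (λ f → ≗⇒≈ λ k → trans (⊛-comm′ k f _) (oneˡ f k))
      ; distrib    = (λ h f g → ≗⇒≈ λ k → trans (⊛-comm′ k h (f ⊕ g))
                       (trans (⊛-distribʳ′ k h f g) (cong₂ ℤ._+_ (⊛-comm′ k f h) (⊛-comm′ k g h)))) ,
                     (λ h f g → ≗⇒≈ λ k → ⊛-distribʳ′ k h f g)
      }
    ; *-comm = λ f g → ≗⇒≈ λ k → ⊛-comm′ k f g
    }
  }
  where
  cst0 : ∀ k → 0ℤ ≡ cst 0ℤ k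
  cst0 zero    = refl
  cst0 (suc k) = refl
  idˡ : ∀ f k → cst 0ℤ k ℤ.+ f k ≡ f k
  idˡ f zero    = ℤₚ.+-identityˡ _
  idˡ f (suc k) = ℤₚ.+-identityˡ _
  oneˡ : ∀ f k → (cst 1ℤ ⊛ f) k ≡ f k
  oneˡ f k = trans (cst-⊛ k 1ℤ f) (ℤₚ.*-identityˡ (f k))

module 𝕊 = CommutativeRing seriesRing

-- Equality of series is not decidable, so the ring solver computes with integer coefficients,
-- embedded as constant series.
cst-homomorphism : CommutativeRing.rawRing ℤₚ.+-*-commutativeRing -Raw-AlmostCommutative⟶ fromCommutativeRing seriesRing
cst-homomorphism = record
  { ⟦_⟧    = cst
  ; +-homo = λ a b → ≗⇒≈ λ { zero → refl ; (suc k) → refl }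
  ; *-homo = λ a b → ≗⇒≈ λ { zero → refl ; (suc k) → sym (trans (cst-⊛ (suc k) a (cst b)) (ℤₚ.*-zeroʳ a)) }
  ; -‿homo = λ a → ≗⇒≈ λ { zero → refl ; (suc k) → refl }
  ; 0-homo = 𝕊.refl
  ; 1-homo = 𝕊.refl
  }

cst-≟ : ∀ a b → Maybe (cst a ≈ cst b)
cst-≟ a b with a ℤ.≟ b
... | yes refl = just 𝕊.refl
... | no _     = nothing

module SeriesSolver = Algebra.Solver.Ring (CommutativeRing.rawRing ℤₚ.+-*-commutativeRing)
  (fromCommutativeRing seriesRing) cst-homomorphism cst-≟

open SeriesSolver using (solve; _:+_; _:*_; _:-_; _:=_; con) public

module ≈-Reasoning = Relation.Binary.Reasoning.Setoid 𝕊.setoid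

-- Powers of x and geometric sums

X : ℕ → Series
X zero            = cst 1ℤ
X (suc n) zero    = 0ℤ
X (suc n) (suc k) = X n k

X-suc-⊛ : ∀ n f k → (X (suc n) ⊛ f) (suc k) ≡ (X n ⊛ f) k
X-suc-⊛ n f k = ℤₚ.+-identityˡ _

X-⊛-< : ∀ n f k → k < n → (X n ⊛ f) k ≡ 0ℤ
X-⊛-< (suc n) f zero    _         = refl
X-⊛-< (suc n) f (suc k) (s≤s k<n) = trans (X-suc-⊛ n f k) (X-⊛-< n f k k<n)

X-⊛-+ : ∀ n f k → (X n ⊛ f) (n + k) ≡ f k
X-⊛-+ zero    f k = trans (cst-⊛ k 1ℤ f) (ℤₚ.*-identityˡ (f k))
X-⊛-+ (suc n) f k = trans (X-suc-⊛ n f (n + k)) (X-⊛-+ n f k)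

X-+ : ∀ m n → X (m + n) ≈ X m ⊛ X n
X-+ zero    n = 𝕊.sym (𝕊.*-identityˡ (X n))
X-+ (suc m) n = ≗⇒≈ λ { zero → refl ; (suc k) → trans (at (X-+ m n) k) (sym (X-suc-⊛ m (X n) k)) }

-- 1 - x^n, the reversal of x^n - 1.
ω : ℕ → Series
ω n = cst 1ℤ ⊕ ⊖ X n

-- 1 + x^n + ... + x^((m-1)n), with `m` terms.
geo : ℕ → ℕ → Series
geo zero    n = cst 0ℤ
geo (suc m) n = cst 1ℤ ⊕ X n ⊛ geo m n

geo-ω : ∀ m n → geo m n ⊛ ω n ≈ ω (m * n)
geo-ω zero    n = 
  solve 1 (λ x → con 0ℤ :* (con 1ℤ :- x) := con 1ℤ :- con 1ℤ) 𝕊.refl (X n)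
geo-ω (suc m) n = begin
  (cst 1ℤ ⊕ X n ⊛ geo m n) ⊛ ω n
    ≈⟨ solve 3 (λ x g w → (con₁ :+ x :* g) :* w := w :+ x :* (g :* w)) 𝕊.refl (X n) (geo m n) (ω n) ⟩
  ω n ⊕ X n ⊛ (geo m n ⊛ ω n)
    ≈⟨ 𝕊.+-cong (𝕊.refl {ω n}) (𝕊.*-cong (𝕊.refl {X n}) (geo-ω m n)) ⟩
  ω n ⊕ X n ⊛ ω (m * n)
    ≈⟨ solve 2 (λ x y → (con₁ :- x) :+ x :* (con₁ :- y) := con₁ :- x :* y) 𝕊.refl (X n) (X (m * n)) ⟩
  cst 1ℤ ⊕ ⊖ (X n ⊛ X (m * n))
    ≈⟨ 𝕊.+-cong (𝕊.refl {cst 1ℤ}) (𝕊.-‿cong (X-+ n (m * n))) ⟨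
  ω (n + m * n) ∎
  where
  open ≈-Reasoning
  con₁ : ∀ {n} → SeriesSolver.Polynomial n
  con₁ = con 1ℤ

geo1-ω : ∀ n → geo n 1 ⊛ ω 1 ≈ ω n
geo1-ω n = 𝕊.trans (geo-ω n 1) (𝕊.reflexive (cong ω (ℕₚ.*-identityʳ n)))

-- Congruence modulo x^K and degree bounds

Agree : ℕ → Series → Series → Set
Agree K f g = ∀ k → k < K → f k ≡ g k

≈⇒Agree : ∀ {K f g} → f ≈ g → Agree K f g
≈⇒Agree p k _ = at p k

Agree-mono : ∀ {J K f g} → J ≤ K → Agree K f g → Agree J f g
Agree-mono J≤K p k k<J = p k (ℕₚ.≤-trans k<J J≤K)

Agree-sym : ∀ {K f g} → Agree K f g → Agree K g f
Agree-sym p k k<K = sym (p k k<K)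

Agree-trans : ∀ {K f g h} → Agree K f g → Agree K g h → Agree K f h
Agree-trans p q k k<K = trans (p k k<K) (q k k<K)

module ℤ-Group = Algebra.Properties.AbelianGroup ℤₚ.+-0-abelianGroup

-- As `f` has constant term 1, coefficient k of the product is `g k` plus terms in lower
-- coefficients of `g`, which the induction has already identified.
Agree-cancelˡ : ∀ K f {g h} → f 0 ≡ 1ℤ → Agree K (f ⊛ g) (f ⊛ h) → Agree K g h
Agree-cancelˡ (suc K) f {g} {h} f0 p k (s≤s k≤K) with ℕₚ.m≤n⇒m<n∨m≡n k≤K
... | inj₁ k<K  = Agree-cancelˡ K f f0 (Agree-mono (ℕₚ.n≤1+n K) p) k k<K
... | inj₂ refl = trans (sym (ℤₚ.*-identityˡ (g k)))
    (trans (cancel k below (p k ℕₚ.≤-refl)) (ℤₚ.*-identityˡ (h k)))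
  where
  below : Agree k g h
  below = Agree-cancelˡ k f f0 (Agree-mono (ℕₚ.n≤1+n k) p)
  cancel : ∀ k → Agree k g h → (f ⊛ g) k ≡ (f ⊛ h) k → 1ℤ ℤ.* g k ≡ 1ℤ ℤ.* h k
  cancel zero    _ e rewrite f0 = e
  cancel (suc k) b e rewrite f0 | ⊛-local k {tl f} {tl f} {g} {h} (λ _ _ → refl)
      (λ i i≤k → b i (s≤s i≤k)) =
    ℤ-Group.∙-cancelʳ _ _ _ e

⊛-cancelˡ : ∀ f {g h} → f 0 ≡ 1ℤ → f ⊛ g ≈ f ⊛ h → g ≈ h
⊛-cancelˡ f f0 p = ≗⇒≈ λ k → Agree-cancelˡ (suc k) f f0 (≈⇒Agree p) k ℕₚ.≤-refl

Deg≤ : ℕ → Series → Set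
Deg≤ d f = ∀ k → d < k → f k ≡ 0ℤ

Deg≤-cst : ∀ a → Deg≤ 0 (cst a)
Deg≤-cst a (suc k) _ = refl

Deg≤-mono : ∀ {d e f} → d ≤ e → Deg≤ d f → Deg≤ e f
Deg≤-mono d≤e p k e<k = p k (ℕₚ.≤-<-trans d≤e e<k)

Deg≤-⊕ : ∀ {d f g} → Deg≤ d f → Deg≤ d g → Deg≤ d (f ⊕ g)
Deg≤-⊕ p q k d<k rewrite p k d<k | q k d<k = refl

Deg≤-⊖ : ∀ {d f} → Deg≤ d f → Deg≤ d (⊖ f)
Deg≤-⊖ p k d<k rewrite p k d<k = refl

Deg≤-⊛ : ∀ d e f g → Deg≤ d f → Deg≤ e g → Deg≤ (d + e) (f ⊛ g)
Deg≤-⊛ zero e f g p q (suc k) e<k rewrite q (suc k) e<k | ℤₚ.*-zeroʳ (f 0) =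
  trans (ℤₚ.+-identityˡ _)
        (trans (⊛-local k {tl f} {cst 0ℤ} {g} {g} (λ { zero _ → p 1 (s≤s z≤n) ; (suc i) _ → p (suc (suc i)) (s≤s z≤n) }) (λ _ _ → refl))
               (trans (cst-⊛ k 0ℤ g) refl))
Deg≤-⊛ (suc d) e f g p q (suc k) (s≤s d+e<k)
  rewrite q (suc k) (s≤s (ℕₚ.≤-trans (ℕₚ.m≤n+m e d) (ℕₚ.<⇒≤ d+e<k))) | ℤₚ.*-zeroʳ (f 0) =
  trans (ℤₚ.+-identityˡ _) (Deg≤-⊛ d e (tl f) g (λ i d<i → p (suc i) (s≤s d<i)) q k d+e<k)

Deg≤-X : ∀ n → Deg≤ n (X n)
Deg≤-X zero    = Deg≤-cst 1ℤ
Deg≤-X (suc n) (suc k) (s≤s n<k) = Deg≤-X n k n<k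

Deg≤-geo : ∀ m n → Deg≤ (m * n) (geo (suc m) n)
Deg≤-geo zero    n = Deg≤-⊕ (Deg≤-cst 1ℤ) λ k _ → trans (⊛-comm′ k (X n) (cst 0ℤ)) (cst-⊛ k 0ℤ (X n))
Deg≤-geo (suc m) n = Deg≤-⊕ (Deg≤-mono z≤n (Deg≤-cst 1ℤ))
    (Deg≤-⊛ n (m * n) (X n) (geo (suc m) n) (Deg≤-X n) (Deg≤-geo m n))

-- Reversed polynomials

-- The definitions divide from the leading coefficient downwards, so ρ p, the coefficients of p
-- read from the top, is the series in which division is ordinary division of power series.
ρ : Poly → Series
ρ p = coeff (reverse p)

coeff-map : ∀ a p k → coeff (map (a ℤ.*_) p) k ≡ a ℤ.* coeff p k
coeff-map a []      k       = sym (ℤₚ.*-zeroʳ a)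
coeff-map a (b ∷ p) zero    = refl
coeff-map a (b ∷ p) (suc k) = coeff-map a p k

coeff-overflow : ∀ p k → length p ≤ k → coeff p k ≡ 0ℤ
coeff-overflow []      k       _         = refl
coeff-overflow (a ∷ p) (suc k) (s≤s p≤k) = coeff-overflow p k p≤k

coeff-∷ʳ : ∀ p a → coeff (p ∷ʳ a) ≈ coeff p ⊕ cst a ⊛ X (length p)
coeff-∷ʳ p a = ≗⇒≈ λ k → trans (pointwise p k)
    (cong (ℤ._+_ (coeff p k)) (sym (cst-⊛ k a (X (length p)))))
  where
  pointwise : ∀ p k → coeff (p ∷ʳ a) k ≡ coeff p k ℤ.+ a ℤ.* X (length p) k
  pointwise []      zero    = trans (sym (ℤₚ.*-identityʳ a)) (sym (ℤₚ.+-identityˡ _))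
  pointwise []      (suc k) = trans (sym (ℤₚ.*-zeroʳ a)) (sym (ℤₚ.+-identityˡ _))
  pointwise (b ∷ p) zero    = sym (trans (cong (ℤ._+_ b) (ℤₚ.*-zeroʳ a)) (ℤₚ.+-identityʳ b))
  pointwise (b ∷ p) (suc k) = pointwise p k

coeff-∷ʳ-last : ∀ p a → coeff (p ∷ʳ a) (length p) ≡ a
coeff-∷ʳ-last []      a = refl
coeff-∷ʳ-last (b ∷ p) a = coeff-∷ʳ-last p a

coeff-∷ʳ-init : ∀ p a k → k < length p → coeff (p ∷ʳ a) k ≡ coeff p k
coeff-∷ʳ-init (b ∷ p) a zero    _         = refl
coeff-∷ʳ-init (b ∷ p) a (suc k) (s≤s k<p) = coeff-∷ʳ-init p a k k<p

coeff-ρ : ∀ p i k → i + suc k ≡ length p → coeff p k ≡ ρ p i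
coeff-ρ []      i       k e with () ← trans (sym (ℕₚ.+-suc i k)) e
coeff-ρ (a ∷ p) i       zero e rewrite Listₚ.unfold-reverse a p = sym
    (trans (cong (coeff (reverse p ∷ʳ a)) i≡) (coeff-∷ʳ-last (reverse p) a))
  where
  i≡ : i ≡ length (reverse p)
  i≡ = trans (ℕₚ.suc-injective (trans (ℕₚ.+-comm 1 i) e)) (sym (Listₚ.length-reverse p))
coeff-ρ (a ∷ p) i (suc k) e rewrite Listₚ.unfold-reverse a p =
  trans (coeff-ρ p i k e′) (sym (coeff-∷ʳ-init (reverse p) a i i<))
  where
  e′ : i + suc k ≡ length p
  e′ = ℕₚ.suc-injective (trans (sym (ℕₚ.+-suc i (suc k))) e)
  i< : i < length (reverse p)
  i< = subst (i <_) (trans e′ (sym (Listₚ.length-reverse p)))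
         (subst (suc i ≤_) (sym (ℕₚ.+-suc i k)) (s≤s (ℕₚ.m≤m+n i k)))

ρ-∷ : ∀ a p → ρ (a ∷ p) ≈ ρ p ⊕ cst a ⊛ X (length p)
ρ-∷ a p = subst (λ n → ρ (a ∷ p) ≈ ρ p ⊕ cst a ⊛ X n) (Listₚ.length-reverse p)
  (subst (λ l → coeff l ≈ ρ p ⊕ cst a ⊛ X (length (reverse p))) (sym (Listₚ.unfold-reverse a p))
         (coeff-∷ʳ (reverse p) a))

addP-[]ʳ : ∀ p → addP p [] ≡ p
addP-[]ʳ []      = refl
addP-[]ʳ (a ∷ p) = refl

length-addP : ∀ d u v → d + length u ≡ length v → length (addP u v) ≡ length v
length-addP d []      v       e = refl
length-addP d (a ∷ u) []      e with () ← trans (sym (ℕₚ.+-suc d _)) e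
length-addP d (a ∷ u) (b ∷ v) e = cong suc (length-addP d u v
    (ℕₚ.suc-injective (trans (sym (ℕₚ.+-suc d _)) e)))

-- `addP` aligns constant terms while `ρ` aligns leading ones, so the summand shorter by `d` is
-- shifted by x^d.
ρ-addP : ∀ d u v → d + length u ≡ length v → ρ (addP u v) ≈ X d ⊛ ρ u ⊕ ρ v
ρ-addP d []      v       e = 𝕊.trans (solve 2 (λ x y → y := x :* con 0ℤ :+ y) 𝕊.refl (X d) (ρ v))
  (𝕊.+-cong (𝕊.*-cong (𝕊.refl {X d}) (≗⇒≈ λ { zero → refl ; (suc _) → refl })) 𝕊.refl)
ρ-addP d (a ∷ u) []      e with () ← trans (sym (ℕₚ.+-suc d _)) e
ρ-addP d (a ∷ u) (b ∷ v) e = begin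
  ρ ((a ℤ.+ b) ∷ addP u v)
    ≈⟨ ρ-∷ (a ℤ.+ b) (addP u v) ⟩
  ρ (addP u v) ⊕ cst (a ℤ.+ b) ⊛ X (length (addP u v))
    ≈⟨ 𝕊.+-cong (ρ-addP d u v e′) (𝕊.*-cong (≗⇒≈ λ { zero → refl ; (suc _) → refl }) (𝕊.reflexive (cong X (length-addP d u v e′)))) ⟩
  (X d ⊛ ρ u ⊕ ρ v) ⊕ (cst a ⊕ cst b) ⊛ X (length v)
    ≈⟨ solve 5 (λ p q r s t → (p :+ q) :+ (r :+ s) :* t := (p :+ r :* t) :+ (q :+ s :* t)) 𝕊.refl
        (X d ⊛ ρ u) (ρ v) (cst a) (cst b) (X (length v)) ⟩
  (X d ⊛ ρ u ⊕ cst a ⊛ X (length v)) ⊕ (ρ v ⊕ cst b ⊛ X (length v))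
    ≈⟨ 𝕊.+-cong (𝕊.+-cong (𝕊.refl {X d ⊛ ρ u})
        (𝕊.*-cong (𝕊.refl {cst a}) (𝕊.trans (𝕊.reflexive (cong X (sym e′))) (X-+ d (length u)))))
        (𝕊.sym (ρ-∷ b v)) ⟩
  (X d ⊛ ρ u ⊕ cst a ⊛ (X d ⊛ X (length u))) ⊕ ρ (b ∷ v)
    ≈⟨ 𝕊.+-cong (solve 4 (λ x p c y → x :* p :+ c :* (x :* y) := x :* (p :+ c :* y)) 𝕊.refl (X d)
        (ρ u) (cst a) (X (length u))) 𝕊.refl ⟩
  X d ⊛ (ρ u ⊕ cst a ⊛ X (length u)) ⊕ ρ (b ∷ v)
    ≈⟨ 𝕊.+-cong (𝕊.*-cong (𝕊.refl {X d}) (𝕊.sym (ρ-∷ a u))) 𝕊.refl ⟩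
  X d ⊛ ρ (a ∷ u) ⊕ ρ (b ∷ v) ∎
  where
  open ≈-Reasoning
  e′ : d + length u ≡ length v
  e′ = ℕₚ.suc-injective (trans (sym (ℕₚ.+-suc d _)) e)

ρ-map : ∀ a q → ρ (map (a ℤ.*_) q) ≈ cst a ⊛ ρ q
ρ-map a q = 𝕊.trans (𝕊.reflexive (cong coeff (sym (Listₚ.reverse-map (a ℤ.*_) q))))
  (≗⇒≈ λ k → trans (coeff-map a (reverse q) k) (sym (cst-⊛ k a (ρ q))))

mulP-[-] : ∀ a b q → mulP (a ∷ []) (b ∷ q) ≡ map (a ℤ.*_) (b ∷ q)
mulP-[-] a b q = cong₂ _∷_ (ℤₚ.+-identityʳ _) (addP-[]ʳ _)

length-mulP : ∀ a p b q → length (mulP (a ∷ p) (b ∷ q)) ≡ length p + suc (length q)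
length-mulP a []       b q = trans (cong length (mulP-[-] a b q)) (Listₚ.length-map _ (b ∷ q))
length-mulP a (a′ ∷ p) b q =
  trans (length-addP (suc (length p)) (map (a ℤ.*_) (b ∷ q)) (0ℤ ∷ mulP (a′ ∷ p) (b ∷ q))
          (trans (cong (λ n → suc (length p) + suc n) (Listₚ.length-map _ q))
              (cong suc (sym (length-mulP a′ p b q)))))
        (cong suc (length-mulP a′ p b q))

-- Reversal, x^d p(1/x), is multiplicative when the formal degree d is the list length minus one.
-- This is why both factors are nonempty; leading zeros do no harm.
ρ-mulP : ∀ a p b q → ρ (mulP (a ∷ p) (b ∷ q)) ≈ ρ (a ∷ p) ⊛ ρ (b ∷ q)
ρ-mulP a []       b q = 𝕊.trans (𝕊.reflexive (cong ρ (mulP-[-] a b q))) (𝕊.trans (ρ-map a (b ∷ q)) (𝕊.*-cong (≗⇒≈ λ { zero → refl ; (suc _) → refl }) 𝕊.refl))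
ρ-mulP a (a′ ∷ p) b q = begin
  ρ (addP aq (0ℤ ∷ pq))
    ≈⟨ ρ-addP n aq (0ℤ ∷ pq) (trans (cong (λ m → n + suc m) (Listₚ.length-map _ q))
        (cong suc (sym (length-mulP a′ p b q)))) ⟩
  X n ⊛ ρ aq ⊕ ρ (0ℤ ∷ pq)
    ≈⟨ 𝕊.+-cong (𝕊.*-cong (𝕊.refl {X n}) (ρ-map a (b ∷ q))) (ρ-∷ 0ℤ pq) ⟩
  X n ⊛ (cst a ⊛ ρ (b ∷ q)) ⊕ (ρ pq ⊕ cst 0ℤ ⊛ X (length pq))
    ≈⟨ 𝕊.+-cong (𝕊.refl {X n ⊛ (cst a ⊛ ρ (b ∷ q))}) (𝕊.+-cong (ρ-mulP a′ p b q) 𝕊.refl) ⟩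
  X n ⊛ (cst a ⊛ ρ (b ∷ q)) ⊕ (ρ (a′ ∷ p) ⊛ ρ (b ∷ q) ⊕ cst 0ℤ ⊛ X (length pq))
    ≈⟨ solve 5 (λ x c Q P y → x :* (c :* Q) :+ (P :* Q :+ con 0ℤ :* y) := (P :+ c :* x) :* Q) 𝕊.refl
         (X n) (cst a) (ρ (b ∷ q)) (ρ (a′ ∷ p)) (X (length pq)) ⟩
  (ρ (a′ ∷ p) ⊕ cst a ⊛ X n) ⊛ ρ (b ∷ q)
    ≈⟨ 𝕊.*-cong (𝕊.sym (ρ-∷ a (a′ ∷ p))) 𝕊.refl ⟩
  ρ (a ∷ a′ ∷ p) ⊛ ρ (b ∷ q) ∎
  where
  open ≈-Reasoning
  n = suc (length p)
  aq = map (a ℤ.*_) (b ∷ q)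
  pq = mulP (a′ ∷ p) (b ∷ q)

-- Long division

coeff-subH : ∀ p q k → coeff (subH p q) k ≡ coeff p k ℤ.- coeff q k
coeff-subH []      []      k       = refl
coeff-subH []      (b ∷ q) k       = trans (coeff-neg (b ∷ q) k) (sym (ℤₚ.+-identityˡ _))
  where
  coeff-neg : ∀ q k → coeff (map ℤ.-_ q) k ≡ ℤ.- coeff q k
  coeff-neg []      k       = refl
  coeff-neg (b ∷ q) zero    = refl
  coeff-neg (b ∷ q) (suc k) = coeff-neg q k
coeff-subH (a ∷ p) []      k       = sym (ℤₚ.+-identityʳ _)
coeff-subH (a ∷ p) (b ∷ q) zero    = refl
coeff-subH (a ∷ p) (b ∷ q) (suc k) = coeff-subH p q k

length-subH : ∀ p q → length p ≤ length (subH p q)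
length-subH []      q       = z≤n
length-subH (a ∷ p) []      = ℕₚ.≤-refl
length-subH (a ∷ p) (b ∷ q) = s≤s (length-subH p q)

length-ldiv : ∀ k D P → k ≤ length P → length (ldiv k D P) ≡ k
length-ldiv zero    D P       _         = refl
length-ldiv (suc k) D (a ∷ P) (s≤s k≤P) = cong suc
    (length-ldiv k D _ (ℕₚ.≤-trans k≤P (length-subH P _)))

-- The divisor begins with 1, so the head of the current remainder is the next quotient coefficient,
-- and subtracting its multiple of the divisor leaves the same problem one place further on.
-- Agreement is claimed only up to the `K` computed coefficients.
ldiv-correct : ∀ K D P → Agree K (coeff (1ℤ ∷ D) ⊛ coeff (ldiv K D P)) (coeff P)
ldiv-correct (suc K) D []      k k<K = trans (⊛-comm′ k _ (λ _ → 0ℤ)) (trans (⊛-local k {λ _ → 0ℤ} {cst 0ℤ} {coeff (1ℤ ∷ D)} {coeff (1ℤ ∷ D)} (λ { zero _ → refl ; (suc _) _ → refl}) (λ _ _ → refl)) (cst-⊛ k 0ℤ (coeff (1ℤ ∷ D))))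
ldiv-correct (suc K) D (a ∷ P) zero    _         = ℤₚ.*-identityˡ a
ldiv-correct (suc K) D (a ∷ P) (suc k) (s≤s k<K) = begin
  (coeff (1ℤ ∷ D) ⊛ coeff (a ∷ Q)) (suc k)
    ≡⟨ ⊛-sucʳ (coeff (1ℤ ∷ D)) (coeff (a ∷ Q)) k ⟩
  coeff D k ℤ.* a ℤ.+ (coeff (1ℤ ∷ D) ⊛ coeff Q) k
    ≡⟨ cong (ℤ._+_ (coeff D k ℤ.* a)) (trans (ldiv-correct K D _ k k<K)
        (coeff-subH P (map (a ℤ.*_) D) k)) ⟩
  coeff D k ℤ.* a ℤ.+ (coeff P k ℤ.- coeff (map (a ℤ.*_) D) k)
    ≡⟨ cong (λ z → coeff D k ℤ.* a ℤ.+ (coeff P k ℤ.- z)) (coeff-map a D k) ⟩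
  coeff D k ℤ.* a ℤ.+ (coeff P k ℤ.- a ℤ.* coeff D k)
    ≡⟨ cancel (coeff D k) a (coeff P k) ⟩
  coeff P k ∎
  where
  open ≡-Reasoning
  Q = ldiv K D (subH P (map (a ℤ.*_) D))
  cancel : ∀ d a p → d ℤ.* a ℤ.+ (p ℤ.- a ℤ.* d) ≡ p
  cancel = solve-∀

Monic : Poly → Set
Monic d = ρ d 0 ≡ 1ℤ

length-divMonic : ∀ P d → Monic d → length d ≤ length P → length (divMonic P d) ≡ suc
    (length P ∸ length d)
length-divMonic P d m d≤P = trans (Listₚ.length-reverse (ldiv K (tail' (reverse d)) (reverse P)))
  (length-ldiv K (tail' (reverse d)) (reverse P)
      (subst (K ≤_) (sym (Listₚ.length-reverse P)) (bound d m d≤P)))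
  where
  K = suc (length P ∸ length d)
  bound : ∀ d → Monic d → length d ≤ length P → suc (length P ∸ length d) ≤ length P
  bound (a ∷ d) _ d<P = ℕₚ.≤-trans (s≤s (ℕₚ.∸-monoʳ-≤ (length P) (s≤s z≤n)))
      (ℕₚ.≤-reflexive (ℕₚ.m+[n∸m]≡n (ℕₚ.≤-trans (s≤s z≤n) d<P)))

divMonic-correct : ∀ P d → Monic d → Agree (suc (length P ∸ length d)) (ρ d ⊛ ρ (divMonic P d)) (ρ P)
divMonic-correct P d m = Agree-trans
  (≈⇒Agree (𝕊.*-cong (𝕊.reflexive (cong coeff (head-tail (reverse d) m)))
      (𝕊.reflexive (cong coeff (Listₚ.reverse-involutive
      (ldiv (suc (length P ∸ length d)) (tail' (reverse d)) (reverse P)))))))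
  (ldiv-correct _ (tail' (reverse d)) (reverse P))
  where
  head-tail : ∀ l → coeff l 0 ≡ 1ℤ → l ≡ 1ℤ ∷ tail' l
  head-tail (a ∷ l) e = cong (_∷ l) e

-- Cyclotomic polynomials

table-stable : ∀ m d → d ≤ m → table m d ≡ Φ d
table-stable zero    .zero z≤n = refl
table-stable (suc m) d d≤ with d ≟ suc m
... | yes refl = table-top m
  where
  table-top : ∀ m → divMonic (xn1 (suc m)) (prodP (map (table m) (properDivisors (suc m)))) ≡ Φ (suc m)
  table-top m with suc m ≟ suc m
  ... | yes _ = refl
  ... | no ≢ = ⊥-elim (≢ refl)
... | no  d≢   = table-stable m d (ℕₚ.≤-pred (ℕₚ.≤∧≢⇒< d≤ d≢))

properDivisors⁻ : ∀ {n d} → d ∈ properDivisors n → d < n × d ∣ n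
properDivisors⁻ {n} d∈ = let d∈upTo , d∣n = ∈-filter⁻ (_∣? n) {xs = upTo n} d∈ in ∈-upTo⁻ d∈upTo , d∣n

Φ-rec : ∀ m → Φ (suc m) ≡ divMonic (xn1 (suc m)) (prodP (map Φ (properDivisors (suc m))))
Φ-rec m with suc m ≟ suc m
... | yes _ = cong (λ ps → divMonic (xn1 (suc m)) (prodP ps))
  (Listₚ.map-cong-local (All.tabulate λ d∈ → table-stable m _ (ℕₚ.≤-pred (proj₁ (properDivisors⁻ d∈)))))
... | no ≢ = ⊥-elim (≢ refl)

-- The increasing order of the divisors of pqr depends on the sizes of the primes, but the product
-- of their Φ_d does not, so a list up to permutation is enough.
properDivisors-↭ : ∀ {n ds} → Unique ds → (∀ {d} → d ∈ ds → d < n × d ∣ n) →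
                   (∀ {d} → d < n → d ∣ n → d ∈ ds) → properDivisors n ↭ ds
properDivisors-↭ {n} u sound complete = ∼bag⇒↭ (unique∧set⇒bag
  (Uniqueₚ.filter⁺ (_∣? n) (Uniqueₚ.upTo⁺ n)) u
  (mk⇔ (λ d∈ → let d<n , d∣n = properDivisors⁻ d∈ in complete d<n d∣n)
       (λ d∈ → let d<n , d∣n = sound d∈ in ∈-filter⁺ (_∣? n) (∈-upTo⁺ d<n) d∣n)))

length-xn1 : ∀ n → length (xn1 n) ≡ suc n
length-xn1 zero    = refl
length-xn1 (suc n) = cong suc (trans (Listₚ.length-++-sucʳ (replicate n 0ℤ) 1ℤ []) (cong suc
  (trans (cong length (Listₚ.++-identityʳ (replicate n 0ℤ))) (Listₚ.length-replicate n))))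

ρ-xn1 : ∀ n → ρ (xn1 (suc n)) ≈ ω (suc n)
ρ-xn1 n = begin
  ρ (xn1 (suc n))
    ≈⟨ ρ-∷ -1ℤ (replicate n 0ℤ ++ (1ℤ ∷ [])) ⟩
  ρ (replicate n 0ℤ ++ (1ℤ ∷ [])) ⊕ cst -1ℤ ⊛ X (length (replicate n 0ℤ ++ (1ℤ ∷ [])))
    ≈⟨ 𝕊.+-cong (leading n) (𝕊.*-cong (𝕊.refl {cst -1ℤ})
        (𝕊.reflexive (cong X (ℕₚ.suc-injective (length-xn1 (suc n)))))) ⟩
  cst 1ℤ ⊕ cst -1ℤ ⊛ X (suc n)
    ≈⟨ solve 1 (λ x → con 1ℤ :+ con -1ℤ :* x := con 1ℤ :- x) 𝕊.refl (X (suc n)) ⟩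
  ω (suc n) ∎
  where
  open ≈-Reasoning
  leading : ∀ n → ρ (replicate n 0ℤ ++ (1ℤ ∷ [])) ≈ cst 1ℤ
  leading zero    = ≗⇒≈ λ { zero → refl ; (suc _) → refl }
  leading (suc n) = 𝕊.trans (ρ-∷ 0ℤ (replicate n 0ℤ ++ (1ℤ ∷ []))) (𝕊.trans
    (solve 2 (λ x y → x :+ con 0ℤ :* y := x) 𝕊.refl (ρ (replicate n 0ℤ ++ (1ℤ ∷ [])))
        (X (length (replicate n 0ℤ ++ (1ℤ ∷ [])))))
    (leading n))

-- `ℓ` is the degree of Φ_n and `F` its reversal.
record Known (n : ℕ) (F : Series) (ℓ : ℕ) : Set where
  field
    len  : length (Φ n) ≡ suc ℓ
    ser  : ρ (Φ n) ≈ F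
    lead : F 0 ≡ 1ℤ
open Known

data KnownProd : List ℕ → Series → ℕ → Set where
  []  : KnownProd [] (cst 1ℤ) 0
  _∷_ : ∀ {d ds F G ℓ s} → Known d F ℓ → KnownProd ds G s → KnownProd (d ∷ ds) (F ⊛ G) (ℓ + s)

KnownProd-↭ : ∀ {ds es G s} → ds ↭ es → KnownProd ds G s →
              Σ Series λ G′ → KnownProd es G′ s × G ≈ G′
KnownProd-↭ Perm.refl ks = _ , ks , 𝕊.refl
KnownProd-↭ (Perm.prep d p) (_∷_ {F = F} k ks) = let G′ , ks′ , e = KnownProd-↭ p ks in _ , (k ∷ ks′) , 𝕊.*-cong (𝕊.refl {F}) e
KnownProd-↭ (Perm.swap d e p) (_∷_ {F = F} {ℓ = i} k
    (_∷_ {F = F′} {G} {j} {s} k′ ks)) with KnownProd-↭ p ks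
... | G′ , ks′ , G≈ = _ , subst (KnownProd _ _) (exchange j i s) (k′ ∷ (k ∷ ks′)) ,
  𝕊.trans (𝕊.*-cong (𝕊.refl {F}) (𝕊.*-cong (𝕊.refl {F′}) G≈))
      (solve 3 (λ x y z → x :* (y :* z) := y :* (x :* z)) 𝕊.refl F F′ G′)
  where
  exchange : ∀ a b c → a + (b + c) ≡ b + (a + c)
  exchange = ℕ-Solver.solve-∀
KnownProd-↭ (Perm.trans p q) ks with KnownProd-↭ p ks
... | G′ , ks′ , G≈ with KnownProd-↭ q ks′
... | G″ , ks″ , G′≈ = G″ , ks″ , 𝕊.trans G≈ G′≈

KnownProd-lead : ∀ {ds G s} → KnownProd ds G s → G 0 ≡ 1ℤ
KnownProd-lead []       = refl
KnownProd-lead (k ∷ ks) = cong₂ ℤ._*_ (lead k) (KnownProd-lead ks)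

length-prodP : ∀ {ds G s} → KnownProd ds G s → length (prodP (map Φ ds)) ≡ suc s
length-prodP [] = refl
length-prodP (_∷_ {d} {ds} k ks) with Φ d | len k | prodP (map Φ ds) | length-prodP ks
... | a ∷ p | e | b ∷ q | e′ = trans (length-mulP a p b q)
  (trans (cong₂ _+_ (ℕₚ.suc-injective e) e′) (ℕₚ.+-suc _ _))

ρ-prodP : ∀ {ds G s} → KnownProd ds G s → ρ (prodP (map Φ ds)) ≈ G
ρ-prodP [] = ≗⇒≈ λ { zero → refl ; (suc _) → refl }
ρ-prodP (_∷_ {d} {ds} k ks) with Φ d | len k | ser k | prodP (map Φ ds) | length-prodP ks | ρ-prodP ks
... | a ∷ p | _ | e | b ∷ q | _ | e′ = 𝕊.trans (ρ-mulP a p b q) (𝕊.*-cong e e′)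

module _ {m ds G s} (ds↭ : properDivisors (suc m) ↭ ds) (ks : KnownProd ds G s) (s≤ : s ≤ suc m) where
  private
    n = suc m
    D = prodP (map Φ (properDivisors n))
    ks′ = proj₁ (proj₂ (KnownProd-↭ (↭-sym ds↭) ks))
    ρD≈ : ρ D ≈ G
    ρD≈ = 𝕊.trans (ρ-prodP ks′) (𝕊.sym (proj₂ (proj₂ (KnownProd-↭ (↭-sym ds↭) ks))))
    monicD : Monic D
    monicD = trans (at ρD≈ 0) (KnownProd-lead ks)
    lenD : length D ≡ suc s
    lenD = length-prodP ks′
    quotient-length : suc (length (xn1 n) ∸ length D) ≡ suc (n ∸ s)
    quotient-length = cong suc (cong₂ _∸_ (length-xn1 n) lenD)

  length-Φ : length (Φ n) ≡ suc (n ∸ s)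
  length-Φ = trans (cong length (Φ-rec m)) (trans
    (length-divMonic (xn1 n) D monicD (subst (_≤ length (xn1 n)) (sym lenD)
        (subst (suc s ≤_) (sym (length-xn1 n)) (s≤s s≤))))
    quotient-length)

  -- `G` is the reversed product of the Φ_d over the proper divisors and `s` its degree, so n - s +
  -- 1 is the number of quotient coefficients that the division computes.
  Φ-approx : Agree (suc (n ∸ s)) (G ⊛ ρ (Φ n)) (ω n)
  Φ-approx = subst (λ K → Agree K (G ⊛ ρ (Φ n)) (ω n)) quotient-length
    (Agree-trans (≈⇒Agree (𝕊.*-cong (𝕊.sym ρD≈) (𝕊.reflexive (cong ρ (Φ-rec m)))))
    (Agree-trans (divMonic-correct (xn1 n) D monicD) (≈⇒Agree (ρ-xn1 m))))

  monic-Φ : Monic (Φ n)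
  monic-Φ = trans (sym (ℤₚ.*-identityˡ _)) (trans (cong (ℤ._* ρ (Φ n) 0) (sym (KnownProd-lead ks)))
      (Φ-approx 0 (s≤s z≤n)))

  -- The division fixes the coefficients up to degree n - s = ℓ, where cancelling `G` identifies
  -- them with those of `F`; beyond ℓ both sides vanish.
  Φ-exact : ∀ {F ℓ} → G ⊛ F ≈ ω n → s + ℓ ≡ n → Deg≤ ℓ F → Known n F ℓ
  Φ-exact {F} {ℓ} GF≈ s+ℓ≡n degF = record { len = len′ ; ser = ser′ ; lead = trans
      (sym (at ser′ 0)) monic-Φ }
    where
    n∸s≡ℓ : n ∸ s ≡ ℓ
    n∸s≡ℓ = trans (cong (_∸ s) (sym s+ℓ≡n)) (ℕₚ.m+n∸m≡n s ℓ)
    len′ : length (Φ n) ≡ suc ℓ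
    len′ = trans length-Φ (cong suc n∸s≡ℓ)
    below : Agree (suc ℓ) (ρ (Φ n)) F
    below = Agree-cancelˡ (suc ℓ) G (KnownProd-lead ks)
      (Agree-trans (subst (λ i → Agree (suc i) (G ⊛ ρ (Φ n)) (ω n)) n∸s≡ℓ Φ-approx)
          (≈⇒Agree (𝕊.sym GF≈)))
    ser′ : ρ (Φ n) ≈ F
    ser′ = ≗⇒≈ λ k → case k
      where
      case : ∀ k → ρ (Φ n) k ≡ F k
      case k with ℕₚ.≤-<-connex k ℓ
      ... | inj₁ k≤ℓ = below k (s≤s k≤ℓ)
      ... | inj₂ ℓ<k = trans (coeff-overflow (reverse (Φ n)) k
          (subst (_≤ k) (sym (trans (Listₚ.length-reverse (Φ n)) len′)) ℓ<k)) (sym (degF k ℓ<k))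

  -- Φ_n is ω n / G to the precision n ∸ s, so dividing ω n by it gives back G to the same precision.
  module _ (2s≤n : s + s ≤ n) where
    private
      s≤n∸s : s ≤ n ∸ s
      s≤n∸s = subst (_≤ n ∸ s) (ℕₚ.m+n∸m≡n s s) (ℕₚ.∸-monoˡ-≤ s 2s≤n)
      ψ-length : suc (length (xn1 n) ∸ length (Φ n)) ≡ suc s
      ψ-length = cong suc (trans (cong₂ _∸_ (length-xn1 n) length-Φ) (ℕₚ.m∸[m∸n]≡n s≤))

    length-Ψ : length (Ψ n) ≡ suc s
    length-Ψ = trans (length-divMonic (xn1 n) (Φ n) monic-Φ
      (subst (_≤ length (xn1 n)) (sym length-Φ)
          (subst (suc (n ∸ s) ≤_) (sym (length-xn1 n)) (s≤s (ℕₚ.m∸n≤m n s))))) ψ-length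

    Ψ-approx : Agree (suc s) (ρ (Ψ n)) G
    Ψ-approx = Agree-cancelˡ (suc s) (ρ (Φ n)) monic-Φ
      (Agree-trans (subst (λ K → Agree K (ρ (Φ n) ⊛ ρ (Ψ n)) (ρ (xn1 n))) ψ-length
          (divMonic-correct (xn1 n) (Φ n) monic-Φ))
      (Agree-trans (≈⇒Agree (ρ-xn1 m))
      (Agree-trans (Agree-sym (Agree-mono (s≤s s≤n∸s) Φ-approx))
                   (≈⇒Agree (𝕊.*-comm G (ρ (Φ n)))))))

-- Divisors of products of primes

1<prime : ∀ {p} → Prime p → 1 < p
1<prime {suc (suc p)} pp = s≤s (s≤s z≤n)
1<prime {zero} pp with () ← prime⇒nonZero pp
1<prime {suc zero} pp with () ← prime⇒nonTrivial pp

∣prime : ∀ {p d} → Prime p → d ∣ p → d ≡ 1 ⊎ d ≡ p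
∣prime pp = prime⇒irreducible pp

prime∣prime : ∀ {p q} → Prime p → Prime q → p ∣ q → p ≡ q
prime∣prime pp qp p∣q with ∣prime qp p∣q
... | inj₁ refl with s≤s () ← 1<prime pp
... | inj₂ p≡q  = p≡q

∤⇒coprime : ∀ {p d} → Prime p → ¬ p ∣ d → Coprime d p
∤⇒coprime pp p∤d (i∣d , i∣p) with ∣prime pp i∣p
... | inj₁ i≡1  = i≡1
... | inj₂ refl = ⊥-elim (p∤d i∣d)

∣prime* : ∀ {p d} m → Prime p → d ∣ p * m → d ∣ m ⊎ (∃[ e ] d ≡ p * e × e ∣ m)
∣prime* {p} {d} m pp d∣pm with p ∣? d
... | yes (divides e refl) = inj₂ (e , ℕₚ.*-comm e p , *-cancelˡ-∣ p ⦃ prime⇒nonZero pp ⦄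
    (subst (_∣ p * m) (ℕₚ.*-comm e p) d∣pm))
... | no p∤d = inj₁ (coprime-divisor (∤⇒coprime pp p∤d) d∣pm)

distinct⇒coprime : ∀ {p q} → Prime p → Prime q → p ≢ q → Coprime p q
distinct⇒coprime pp qp p≢q = ∤⇒coprime qp λ q∣p → p≢q (sym (prime∣prime qp pp q∣p))

-- The data of the Lam-Leung formula for Φ_pq: (p - 1)(q - 1) = ap + a′q, together with the
-- complementary lengths b = q - 1 - a and b′ = p - 1 - a′.
record Witness (p q : ℕ) : Set where
  field
    a b a′ b′ : ℕ
    a+b≡   : suc (a + b) ≡ q
    a′+b′≡ : suc (a′ + b′) ≡ p
    bézout : suc a * p + suc a′ * q ≡ suc (p * q)

Witness-sym : ∀ {p q} → Witness p q → Witness q p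
Witness-sym {p} {q} w = record { a = a′ ; b = b′ ; a′ = a ; b′ = b ; a+b≡ = a′+b′≡ ; a′+b′≡ = a+b≡
  ; bézout = trans (ℕₚ.+-comm (suc a′ * q) (suc a * p)) (trans bézout (cong suc (ℕₚ.*-comm p q))) }
  where open Witness w

-- In xp = yq + 1 subtract kpq from both sides, with k = x / q. The remaining coefficient x % q
-- cannot be 0, as it would give 0 = y′q + 1, and y′ = y - kp stays below p; then a + 1 = x % q and
-- a′ + 1 = p - y′. The case y < kp would make the right side too large, since q > 1.
identity⇒witness : ∀ p q x y → 1 < q → suc (y * q) ≡ x * p → Witness p q
identity⇒witness p q@(suc q′) x y 1<q e with ℕₚ.m≤n⇒∃[o]m+o≡n (ℕₚ.≮⇒≥ y≮kp)
  where
  k = x / q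
  e′ : suc (y * q) ≡ (x % q) * p + k * p * q
  e′ = trans e (trans (cong (_* p) (m≡m%n+[m/n]*n x q)) (expand (x % q) k q p))
    where
    expand : ∀ r k q p → (r + k * q) * p ≡ r * p + k * p * q
    expand = ℕ-Solver.solve-∀
  y≮kp : ¬ y < k * p
  y≮kp y<kp = ℕₚ.<-irrefl e′ (begin-strict
    suc (y * q)               <⟨ ℕₚ.+-monoˡ-< (y * q) 1<q ⟩
    suc y * q                 ≤⟨ ℕₚ.*-monoˡ-≤ q y<kp ⟩
    k * p * q                 ≤⟨ ℕₚ.m≤n+m _ _ ⟩
    (x % q) * p + k * p * q   ∎)
    where open ℕₚ.≤-Reasoning
... | y′ , refl = result (x % q) (m%n<n x q) (ℕₚ.+-cancelˡ-≡ (k * p * q) _ _ (begin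
    k * p * q + suc (y′ * q)        ≡⟨ expand₁ (k * p) y′ q ⟩
    suc ((k * p + y′) * q)          ≡⟨ e ⟩
    x * p                           ≡⟨ cong (_* p) (m≡m%n+[m/n]*n x q) ⟩
    (x % q + k * q) * p             ≡⟨ expand₂ (x % q) k q p ⟩
    k * p * q + (x % q) * p         ∎))
  where
  open ≡-Reasoning
  k = x / q
  expand₁ : ∀ a y q → a * q + suc (y * q) ≡ suc ((a + y) * q)
  expand₁ = ℕ-Solver.solve-∀
  expand₂ : ∀ r k q p → (r + k * q) * p ≡ k * p * q + r * p
  expand₂ = ℕ-Solver.solve-∀
  result : ∀ r → r < q → suc (y′ * q) ≡ r * p → Witness p q
  result zero    r<q ()
  result (suc a) r<q f = record
    { a = a ; b = q ∸ suc a ; a′ = p ∸ suc y′ ; b′ = y′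
    ; a+b≡ = ℕₚ.m+[n∸m]≡n (ℕₚ.<⇒≤ r<q)
    ; a′+b′≡ = a′+b′≡
    ; bézout = trans (cong (_+ suc (p ∸ suc y′) * q) (sym f))
              (trans (regroup y′ q (p ∸ suc y′)) (cong (λ z → suc (z * q)) a′+b′≡))
    }
    where
    y′<p : y′ < p
    y′<p = ℕₚ.*-cancelʳ-< q y′ p (ℕₚ.≤-trans (ℕₚ.≤-reflexive f)
        (ℕₚ.≤-trans (ℕₚ.*-monoˡ-≤ p (ℕₚ.<⇒≤ r<q)) (ℕₚ.≤-reflexive (ℕₚ.*-comm q p))))
    a′+b′≡ : suc (p ∸ suc y′ + y′) ≡ p
    a′+b′≡ = trans (sym (ℕₚ.+-suc (p ∸ suc y′) y′)) (ℕₚ.m∸n+n≡m y′<p)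
    regroup : ∀ y q c → suc (y * q) + suc c * q ≡ suc (suc (c + y) * q)
    regroup = ℕ-Solver.solve-∀

witness : ∀ {p q} → Prime p → Prime q → p ≢ q → Witness p q
witness {p} {q} pp qp p≢q with coprime-Bézout (distinct⇒coprime pp qp p≢q)
... | Bézout.+- x y e = identity⇒witness p q x y (1<prime qp) e
... | Bézout.-+ x y e = Witness-sym (identity⇒witness q p y x (1<prime pp) e)

-- Φ_n for n = 1, p and pq

Φ-1 : Known 1 (ω 1) 1
Φ-1 = Φ-exact {m = 0} Perm.refl [] z≤n (𝕊.*-identityˡ (ω 1)) refl
  (Deg≤-⊕ (Deg≤-mono z≤n (Deg≤-cst 1ℤ)) (Deg≤-⊖ (Deg≤-X 1)))

Φ-prime : ∀ {p} → Prime (suc p) → Known (suc p) (geo (suc p) 1) p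
Φ-prime {p} pp = Φ-exact {m = p} divisors (Φ-1 ∷ []) (s≤s z≤n)
  (𝕊.trans (solve 2 (λ g w → (w :* con 1ℤ) :* g := g :* w) 𝕊.refl (geo (suc p) 1) (ω 1))
    (geo1-ω (suc p)))
  refl (Deg≤-mono (ℕₚ.≤-reflexive (ℕₚ.*-identityʳ p)) (Deg≤-geo p 1))
  where
  divisors : properDivisors (suc p) ↭ 1 ∷ []
  divisors = properDivisors-↭ ([] ∷ []) (λ { (here refl) → 1<prime pp , 1∣ suc p }) complete
    where
    complete : ∀ {d} → d < suc p → d ∣ suc p → d ∈ 1 ∷ []
    complete d<p d∣p with ∣prime pp d∣p
    ... | inj₁ d≡1  = here d≡1
    ... | inj₂ refl = ⊥-elim (ℕₚ.<-irrefl refl d<p)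

-- `degree` says ℓ = (p - 1)(q - 1) without truncated subtraction. `F-ω-ω` is Φ_pq = (1 - x)(1 -
-- x^(pq)) / ((1 - x^p)(1 - x^q)) with denominators cleared.
record Φ-Semiprime (p q : ℕ) : Set where
  field
    F      : Series
    ℓ      : ℕ
    known  : Known (p * q) F ℓ
    degree : p + q + ℓ ≡ suc (p * q)
    F-ω-ω  : F ⊛ ω p ⊛ ω q ≈ ω 1 ⊛ ω (p * q)
    F-Deg≤ : Deg≤ ℓ F

-- With u = x^(bp) and v = x^(b′q), the witness gives x^((a+1)p) = x v, x^((a′+1)q) = x u and
-- x^(pq) = x u v, so F (1 - x^p) (1 - x^q) = (1 - x v) (1 - x u) - x (1 - u) (1 - v) = (1 - x) (1 - x^(pq)).
module _ {p q : ℕ} (w : Witness p q) where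
  open Witness w

  semiprimeSeries : Series
  semiprimeSeries = geo (suc a) p ⊛ geo (suc a′) q ⊕ ⊖ (X 1 ⊛ geo b p ⊛ geo b′ q)

  private
    e₁ : suc (b * p) ≡ suc a′ * q
    e₁ = ℕₚ.+-cancelˡ-≡ (suc a * p) _ _ (trans (regroup a b p) (trans (cong (λ z → suc (z * p)) a+b≡)
           (trans (cong suc (ℕₚ.*-comm q p)) (sym bézout))))
      where
      regroup : ∀ a b p → suc a * p + suc (b * p) ≡ suc (suc (a + b) * p)
      regroup = ℕ-Solver.solve-∀
    e₂ : suc (b′ * q) ≡ suc a * p
    e₂ = ℕₚ.+-cancelʳ-≡ (suc a′ * q) _ _ (trans (regroup a′ b′ q)
        (trans (cong (λ z → suc (z * q)) a′+b′≡) (sym bézout)))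
      where
      regroup : ∀ a b p → suc (b * p) + suc a * p ≡ suc (suc (a + b) * p)
      regroup = ℕ-Solver.solve-∀
    e₃ : suc (b * p + b′ * q) ≡ p * q
    e₃ = ℕₚ.suc-injective (trans (regroup (b * p) (b′ * q)) (trans (cong₂ _+_ e₂ e₁) bézout))
      where
      regroup : ∀ x y → suc (suc (x + y)) ≡ suc y + suc x
      regroup = ℕ-Solver.solve-∀
    degree≡ : p + q + (a * p + a′ * q) ≡ suc (p * q)
    degree≡ = trans (regroup p q (a * p) (a′ * q)) bézout
      where
      regroup : ∀ p q x y → p + q + (x + y) ≡ (p + x) + (q + y)
      regroup = ℕ-Solver.solve-∀

    X-suc : ∀ n → X (suc n) ≈ X 1 ⊛ X n
    X-suc = X-+ 1

  semiprimeSeries-ω : semiprimeSeries ⊛ ω p ⊛ ω q ≈ ω 1 ⊛ ω (p * q)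
  semiprimeSeries-ω = begin
    semiprimeSeries ⊛ ω p ⊛ ω q
      ≈⟨ solve 7 (λ g h x k l y z → (g :* h :- x :* k :* l) :* y :* z := (g :* y) :*
          (h :* z) :- x :* (k :* y) :* (l :* z)) 𝕊.refl
           (geo (suc a) p) (geo (suc a′) q) (X 1) (geo b p) (geo b′ q) (ω p) (ω q) ⟩
    (geo (suc a) p ⊛ ω p) ⊛ (geo (suc a′) q ⊛ ω q) ⊕ ⊖ (X 1 ⊛ (geo b p ⊛ ω p) ⊛ (geo b′ q ⊛ ω q))
      ≈⟨ 𝕊.+-cong (𝕊.*-cong (geo-ω (suc a) p) (geo-ω (suc a′) q))
           (𝕊.-‿cong (𝕊.*-cong (𝕊.*-cong (𝕊.refl {X 1}) (geo-ω b p)) (geo-ω b′ q))) ⟩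
    ω (suc a * p) ⊛ ω (suc a′ * q) ⊕ ⊖ (X 1 ⊛ ω (b * p) ⊛ ω (b′ * q))
      ≈⟨ 𝕊.+-cong (𝕊.*-cong (ω-cong {suc a * p}
          (𝕊.trans (𝕊.reflexive (cong X (sym e₂))) (X-suc (b′ * q))))
                            (ω-cong {suc a′ * q}
                                (𝕊.trans (𝕊.reflexive (cong X (sym e₁))) (X-suc (b * p)))))
                  (𝕊.refl {⊖ (X 1 ⊛ ω (b * p) ⊛ ω (b′ * q))}) ⟩
    (cst 1ℤ ⊕ ⊖ (X 1 ⊛ v)) ⊛ (cst 1ℤ ⊕ ⊖ (X 1 ⊛ u)) ⊕ ⊖ (X 1 ⊛ ω (b * p) ⊛ ω (b′ * q))
      ≈⟨ solve 3 (λ x u v → (con 1ℤ :- x :* v) :* (con 1ℤ :- x :* u) :- x :* (con 1ℤ :- u) :*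
          (con 1ℤ :- v)
                          := (con 1ℤ :- x) :* (con 1ℤ :- x :* (u :* v))) 𝕊.refl (X 1) u v ⟩
    ω 1 ⊛ (cst 1ℤ ⊕ ⊖ (X 1 ⊛ (u ⊛ v)))
      ≈⟨ 𝕊.*-cong (𝕊.refl {ω 1}) (𝕊.sym (ω-cong {p * q} (𝕊.trans (𝕊.reflexive (cong X (sym e₃)))
           (𝕊.trans (X-suc (b * p + b′ * q)) (𝕊.*-cong (𝕊.refl {X 1}) (X-+ (b * p) (b′ * q))))))) ⟩
    ω 1 ⊛ ω (p * q) ∎
    where
    open ≈-Reasoning
    u v : Series
    u = X (b * p)
    v = X (b′ * q)
    ω-cong : ∀ {n f} → X n ≈ f → ω n ≈ cst 1ℤ ⊕ ⊖ f
    ω-cong e = 𝕊.+-cong (𝕊.refl {cst 1ℤ}) (𝕊.-‿cong e)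

  semiprimeSeries-Deg≤ : Deg≤ (a * p + a′ * q) semiprimeSeries
  semiprimeSeries-Deg≤ = Deg≤-⊕ (Deg≤-⊛ _ _ (geo (suc a) p) (geo (suc a′) q) (Deg≤-geo a p)
      (Deg≤-geo a′ q))
    (Deg≤-⊖ (second b b′ refl refl))
    where
    Deg≤-≈ : ∀ {d f g} → f ≈ g → Deg≤ d g → Deg≤ d f
    Deg≤-≈ e p k d<k = trans (at e k) (p k d<k)
    second : ∀ i j → i ≡ b → j ≡ b′ → Deg≤ (a * p + a′ * q) (X 1 ⊛ geo i p ⊛ geo j q)
    second zero    j       _ _ = Deg≤-mono z≤n
        (Deg≤-≈ (solve 2 (λ x y → x :* con 0ℤ :* y := con 0ℤ) 𝕊.refl (X 1) (geo j q)) (Deg≤-cst 0ℤ))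
    second (suc i) zero    _ _ = Deg≤-mono z≤n
        (Deg≤-≈ (solve 2 (λ x y → x :* y :* con 0ℤ := con 0ℤ) 𝕊.refl (X 1) (geo (suc i) p))
        (Deg≤-cst 0ℤ))
    second (suc i) (suc j) refl refl = Deg≤-mono bound
      (Deg≤-⊛ (1 + i * p) (j * q) (X 1 ⊛ geo (suc i) p) (geo (suc j) q)
        (Deg≤-⊛ 1 (i * p) (X 1) (geo (suc i) p) (Deg≤-X 1) (Deg≤-geo i p)) (Deg≤-geo j q))
      where
      -- From 1 + bp + b′q = pq the left side is pq - p - q, one less than (p - 1)(q - 1) = ap +
      -- a′q.
      bound : 1 + i * p + j * q ≤ a * p + a′ * q
      bound = ℕₚ.<⇒≤ (ℕₚ.≤-reflexive (ℕₚ.+-cancelˡ-≡ (p + q) _ _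
        (trans (regroup p q (i * p) (j * q)) (trans (cong suc e₃) (sym degree≡)))))
        where
        regroup : ∀ p q x y → p + q + suc (1 + x + y) ≡ suc (suc ((p + x) + (q + y)))
        regroup = ℕ-Solver.solve-∀

-- Abstract, since unfolding the Bézout witness makes conversion checking explode.
abstract
  Φ-semiprime : ∀ {p q} → Prime p → Prime q → p ≢ q → Φ-Semiprime p q
  Φ-semiprime {suc p} {suc q} pp qp p≢q = record
    { F = F ; ℓ = ℓ ; known = known ; degree = degree ; F-ω-ω = semiprimeSeries-ω w ; F-Deg≤ = semiprimeSeries-Deg≤ w }
    where
    P Q : ℕ
    P = suc p
    Q = suc q
    w : Witness P Q
    w = witness pp qp p≢q
    open Witness w
    F : Series
    F = semiprimeSeries w
    ℓ : ℕ
    ℓ = a * P + a′ * Q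
    degree : P + Q + ℓ ≡ suc (P * Q)
    degree = trans (regroup P Q (a * P) (a′ * Q)) bézout
      where
      regroup : ∀ p q x y → p + q + (x + y) ≡ (p + x) + (q + y)
      regroup = ℕ-Solver.solve-∀
    P<PQ : P < P * Q
    P<PQ = subst (_< P * Q) (ℕₚ.*-identityʳ P) (ℕₚ.*-monoʳ-< P (1<prime qp))
    Q<PQ : Q < P * Q
    Q<PQ = subst (_< P * Q) (ℕₚ.*-identityˡ Q) (ℕₚ.*-monoˡ-< Q (1<prime pp))
    divisors : properDivisors (P * Q) ↭ 1 ∷ P ∷ Q ∷ []
    divisors = properDivisors-↭
      ((ℕₚ.<⇒≢ (1<prime pp) ∷ ℕₚ.<⇒≢ (1<prime qp) ∷ []) ∷ (p≢q ∷ []) ∷ [] ∷ [])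
      (λ { (here refl) → ℕₚ.<-trans (1<prime pp) P<PQ , 1∣ _
         ; (there (here refl)) → P<PQ , m∣m*n Q
         ; (there (there (here refl))) → Q<PQ , n∣m*n P }) complete
      where
      complete : ∀ {d} → d < P * Q → d ∣ P * Q → d ∈ 1 ∷ P ∷ Q ∷ []
      complete d< d∣ with ∣prime* Q pp d∣
      ... | inj₁ d∣Q with ∣prime qp d∣Q
      ...   | inj₁ refl = here refl
      ...   | inj₂ refl = there (there (here refl))
      complete d< d∣ | inj₂ (e , refl , e∣Q) with ∣prime qp e∣Q
      ...   | inj₁ refl = there (here (ℕₚ.*-identityʳ P))
      ...   | inj₂ refl = ⊥-elim (ℕₚ.<-irrefl refl d<)
    sum≡ : (1 + (p + (q + 0))) + ℓ ≡ P * Q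
    sum≡ = ℕₚ.suc-injective (trans (regroup p q ℓ) degree)
      where
      regroup : ∀ p q l → suc ((1 + (p + (q + 0))) + l) ≡ suc p + suc q + l
      regroup = ℕ-Solver.solve-∀
    product≈ : (ω 1 ⊛ (geo P 1 ⊛ (geo Q 1 ⊛ cst 1ℤ))) ⊛ F ≈ ω (P * Q)
    product≈ = ⊛-cancelˡ (ω 1) refl (begin
      ω 1 ⊛ ((ω 1 ⊛ (geo P 1 ⊛ (geo Q 1 ⊛ cst 1ℤ))) ⊛ F)
        ≈⟨ solve 4 (λ w g h f → w :* ((w :* (g :* (h :* con 1ℤ))) :* f) := f :* (g :* w) :*
            (h :* w)) 𝕊.refl (ω 1) (geo P 1) (geo Q 1) F ⟩
      F ⊛ (geo P 1 ⊛ ω 1) ⊛ (geo Q 1 ⊛ ω 1)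
        ≈⟨ 𝕊.*-cong (𝕊.*-cong (𝕊.refl {F}) (geo1-ω P)) (geo1-ω Q) ⟩
      F ⊛ ω P ⊛ ω Q
        ≈⟨ semiprimeSeries-ω w ⟩
      ω 1 ⊛ ω (P * Q) ∎)
      where
      open ≈-Reasoning
    known : Known (P * Q) F ℓ
    known = Φ-exact {m = q + p * Q} divisors (Φ-1 ∷ Φ-prime pp ∷ Φ-prime qp ∷ [])
      (subst (1 + (p + (q + 0)) ≤_) sum≡ (ℕₚ.m≤m+n _ ℓ)) product≈ sum≡ (semiprimeSeries-Deg≤ w)
  Φ-semiprime {zero} pp qp p≢q with () ← prime⇒nonZero pp
  Φ-semiprime {suc p} {zero} pp qp p≢q with () ← prime⇒nonZero qp

-- Ψ_n for n = pqr

module _ {p q r : ℕ} (pp : Prime (suc p)) (qp : Prime (suc q)) (rp : Prime (suc r))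
         (p≢q : suc p ≢ suc q) (p≢r : suc p ≢ suc r) (q≢r : suc q ≢ suc r) where
  private
    P = suc p
    Q = suc q
    R = suc r
    n = P * Q * R
    prime≢product : ∀ {x y z} → Prime x → Prime y → Prime z → z ≢ x * y
    prime≢product {x} {y} xp yp zp refl with ∣prime zp (m∣m*n {x} y)
    ... | inj₁ refl with s≤s () ← 1<prime xp
    ... | inj₂ x≡xy = ℕₚ.<⇒≢ (subst (_< x * y) (ℕₚ.*-identityʳ x)
        (ℕₚ.*-monoʳ-< x ⦃ prime⇒nonZero xp ⦄ (1<prime yp))) x≡xy
    1≢product : ∀ {x y} → Prime x → Prime y → 1 ≢ x * y
    1≢product {x} xp yp e = ℕₚ.<⇒≢ (ℕₚ.<-≤-trans (1<prime xp) (ℕₚ.m≤m*n x _ ⦃ prime⇒nonZero yp ⦄)) e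
    ds : List ℕ
    ds = 1 ∷ P ∷ Q ∷ R ∷ P * Q ∷ P * R ∷ Q * R ∷ []
    unique : Unique ds
    unique = (ℕₚ.<⇒≢ (1<prime pp) ∷ ℕₚ.<⇒≢ (1<prime qp) ∷ ℕₚ.<⇒≢
        (1<prime rp) ∷ 1≢product pp qp ∷ 1≢product pp rp ∷ 1≢product qp rp ∷ [])
      ∷ (p≢q ∷ p≢r ∷ prime≢product pp qp pp ∷ prime≢product pp rp pp ∷ prime≢product qp rp pp ∷ [])
      ∷ (q≢r ∷ prime≢product pp qp qp ∷ prime≢product pp rp qp ∷ prime≢product qp rp qp ∷ [])
      ∷ (prime≢product pp qp rp ∷ prime≢product pp rp rp ∷ prime≢product qp rp rp ∷ [])
      ∷ ((λ e → q≢r (ℕₚ.*-cancelˡ-≡ Q R P e)) ∷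
          (λ e → p≢r (ℕₚ.*-cancelˡ-≡ P R Q (trans (ℕₚ.*-comm Q P) e))) ∷ [])
      ∷ ((λ e → p≢q (ℕₚ.*-cancelʳ-≡ P Q R e)) ∷ [])
      ∷ [] ∷ []
    PQ<n : P * Q < n
    PQ<n = subst (_< n) (ℕₚ.*-identityʳ (P * Q)) (ℕₚ.*-monoʳ-< (P * Q) (1<prime rp))
    PR<n : P * R < n
    PR<n = ℕₚ.*-monoˡ-< R (subst (_< P * Q) (ℕₚ.*-identityʳ P) (ℕₚ.*-monoʳ-< P (1<prime qp)))
    QR<n : Q * R < n
    QR<n = ℕₚ.*-monoˡ-< R (subst (_< P * Q) (ℕₚ.*-identityˡ Q) (ℕₚ.*-monoˡ-< Q (1<prime pp)))
    R<n : R < n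
    R<n = ℕₚ.≤-<-trans (ℕₚ.m≤n*m R Q) QR<n
    sound : ∀ {d} → d ∈ ds → d < n × d ∣ n
    sound (here refl) = ℕₚ.<-trans (1<prime rp) R<n , 1∣ n
    sound (there (here refl)) = ℕₚ.≤-<-trans (ℕₚ.m≤m*n P Q) PQ<n , ∣-trans (m∣m*n Q) (m∣m*n R)
    sound (there (there (here refl))) = ℕₚ.≤-<-trans (ℕₚ.m≤n*m Q P) PQ<n , ∣-trans (n∣m*n P) (m∣m*n R)
    sound (there (there (there (here refl)))) = R<n , n∣m*n (P * Q)
    sound (there (there (there (there (here refl))))) = PQ<n , m∣m*n R
    sound (there (there (there (there (there (here refl)))))) = PR<n , divides Q
        (trans (cong (_* R) (ℕₚ.*-comm P Q)) (ℕₚ.*-assoc Q P R))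
    sound (there (there (there (there (there (there (here refl))))))) = QR<n , divides P
        (ℕₚ.*-assoc P Q R)
    complete : ∀ {d} → d < n → d ∣ n → d ∈ ds
    complete {d} d<n d∣n with ∣prime* (Q * R) pp (subst (d ∣_) (ℕₚ.*-assoc P Q R) d∣n)
    ... | inj₁ d∣QR with ∣prime* R qp d∣QR
    ...   | inj₁ d∣R with ∣prime rp d∣R
    ...     | inj₁ refl = here refl
    ...     | inj₂ refl = there (there (there (here refl)))
    complete d<n d∣n | inj₁ d∣QR | inj₂ (e , refl , e∣R) with ∣prime rp e∣R
    ...     | inj₁ refl = there (there (here (ℕₚ.*-identityʳ Q)))
    ...     | inj₂ refl = there (there (there (there (there (there (here refl))))))
    complete d<n d∣n | inj₂ (e , refl , e∣QR) with ∣prime* R qp e∣QR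
    ...   | inj₁ e∣R with ∣prime rp e∣R
    ...     | inj₁ refl = there (here (ℕₚ.*-identityʳ P))
    ...     | inj₂ refl = there (there (there (there (there (here refl)))))
    complete d<n d∣n | inj₂ (e , refl , e∣QR) | inj₂ (e′ , refl , e′∣R) with ∣prime rp e′∣R
    ...     | inj₁ refl = there (there (there (there (here (cong (P *_) (ℕₚ.*-identityʳ Q))))))
    ...     | inj₂ refl = ⊥-elim (ℕₚ.<-irrefl (sym (ℕₚ.*-assoc P Q R)) d<n)

    module PQ = Φ-Semiprime (Φ-semiprime pp qp p≢q)
    module PR = Φ-Semiprime (Φ-semiprime pp rp p≢r)
    module QR = Φ-Semiprime (Φ-semiprime qp rp q≢r)

    s : ℕ
    s = 1 + (p + (q + (r + (PQ.ℓ + (PR.ℓ + (QR.ℓ + 0))))))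
    G : Series
    G = ω 1 ⊛ (geo P 1 ⊛ (geo Q 1 ⊛ (geo R 1 ⊛ (PQ.F ⊛ (PR.F ⊛ (QR.F ⊛ cst 1ℤ))))))
    ks : KnownProd ds G s
    ks = Φ-1 ∷ Φ-prime pp ∷ Φ-prime qp ∷ Φ-prime rp ∷ PQ.known ∷ PR.known ∷ QR.known ∷ []

    s+R≡ : s + R ≡ PQ.ℓ + P * R + Q * R
    s+R≡ = sym (ℕₚ.suc-injective (ℕₚ.suc-injective (trans (regroup₁ PQ.ℓ (P * R) (Q * R))
      (trans (cong₂ (λ x y → PQ.ℓ + x + y) (sym PR.degree) (sym QR.degree))
             (regroup₂ p q r PQ.ℓ PR.ℓ QR.ℓ)))))
      where
      regroup₁ : ∀ x y z → suc (suc (x + y + z)) ≡ x + suc y + suc z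
      regroup₁ = ℕ-Solver.solve-∀
      regroup₂ : ∀ p q r x y z → x + (suc p + suc r + y) + (suc q + suc r + z)
               ≡ suc (suc (1 + (p + (q + (r + (x + (y + (z + 0)))))) + suc r))
      regroup₂ = ℕ-Solver.solve-∀

    -- Up to reversal Φ_1 Φ_q Φ_r Φ_qr = 1 - x^(qr) and Φ_p Φ_pr = Φ_p(x^r). The factor (1 - x)(1 -
    -- x^r), cancelled at the end, clears the denominators in both.
    G≈ : G ≈ PQ.F ⊛ geo P R ⊛ ω (Q * R)
    G≈ = ⊛-cancelˡ (ω 1 ⊛ ω R) refl (begin
      ω 1 ⊛ ω R ⊛ G
        ≈⟨ solve 8 (λ w wr gp gq gr x y z → w :* wr :*
            (w :* (gp :* (gq :* (gr :* (x :* (y :* (z :* con 1ℤ)))))))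
                    := x :* (y :* (gp :* w) :* wr) :* (z :* gq :* w :* gr)) 𝕊.refl
             (ω 1) (ω R) (geo P 1) (geo Q 1) (geo R 1) PQ.F PR.F QR.F ⟩
      PQ.F ⊛ (PR.F ⊛ (geo P 1 ⊛ ω 1) ⊛ ω R) ⊛ (QR.F ⊛ geo Q 1 ⊛ ω 1 ⊛ geo R 1)
        ≈⟨ 𝕊.*-cong (𝕊.*-cong (𝕊.refl {PQ.F}) (𝕊.trans
            (𝕊.*-cong (𝕊.*-cong (𝕊.refl {PR.F}) (geo1-ω P)) (𝕊.refl {ω R})) PR.F-ω-ω)) (QR-product) ⟩
      PQ.F ⊛ (ω 1 ⊛ ω (P * R)) ⊛ ω (Q * R)
        ≈⟨ 𝕊.*-cong (𝕊.*-cong (𝕊.refl {PQ.F}) (𝕊.*-cong (𝕊.refl {ω 1}) (𝕊.sym (geo-ω P R))))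
            (𝕊.refl {ω (Q * R)}) ⟩
      PQ.F ⊛ (ω 1 ⊛ (geo P R ⊛ ω R)) ⊛ ω (Q * R)
        ≈⟨ solve 5 (λ f w g v u → f :* (w :* (g :* v)) :* u := w :* v :* (f :* g :* u)) 𝕊.refl PQ.F
            (ω 1) (geo P R) (ω R) (ω (Q * R)) ⟩
      ω 1 ⊛ ω R ⊛ (PQ.F ⊛ geo P R ⊛ ω (Q * R)) ∎)
      where
      open ≈-Reasoning
      QR-product : QR.F ⊛ geo Q 1 ⊛ ω 1 ⊛ geo R 1 ≈ ω (Q * R)
      QR-product = ⊛-cancelˡ (ω 1) refl (begin
        ω 1 ⊛ (QR.F ⊛ geo Q 1 ⊛ ω 1 ⊛ geo R 1)
          ≈⟨ solve 4 (λ w f g h → w :* (f :* g :* w :* h) := f :* (g :* w) :* (h :* w)) 𝕊.refl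
              (ω 1) QR.F (geo Q 1) (geo R 1) ⟩
        QR.F ⊛ (geo Q 1 ⊛ ω 1) ⊛ (geo R 1 ⊛ ω 1)
          ≈⟨ 𝕊.*-cong (𝕊.*-cong (𝕊.refl {QR.F}) (geo1-ω Q)) (geo1-ω R) ⟩
        QR.F ⊛ ω Q ⊛ ω R
          ≈⟨ QR.F-ω-ω ⟩
        ω 1 ⊛ ω (Q * R) ∎)

  Ψ-ternary : ∀ {t} → t + R ≡ PQ.ℓ + P * R + Q * R → t + t ≤ n →
              length (Ψ n) ≡ suc t × Agree (suc t) (ρ (Ψ n)) (PQ.F ⊛ geo P R ⊛ ω (Q * R))
  Ψ-ternary {t} t+R≡ = subst Goal (sym (ℕₚ.+-cancelʳ-≡ R t s (trans t+R≡ (sym s+R≡)))) λ 2s≤n →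
    let s≤n = ℕₚ.≤-trans (ℕₚ.m≤m+n s s) 2s≤n in
    length-Ψ {m = r + (q + p * Q) * R} ds↭ ks s≤n 2s≤n ,
    Agree-trans (Ψ-approx {m = r + (q + p * Q) * R} ds↭ ks s≤n 2s≤n) (≈⇒Agree G≈)
    where
    Goal : ℕ → Set
    Goal t = t + t ≤ n → length (Ψ n) ≡ suc t × Agree (suc t) (ρ (Ψ n)) (PQ.F ⊛ geo P R ⊛ ω (Q * R))
    ds↭ = properDivisors-↭ unique sound complete

-- Coefficients of Ψ_3qr

-- The expansion of 1/(1 + x + x^2) = (1 - x)/(1 - x^3).
χ : Series
χ 0 = 1ℤ
χ 1 = -1ℤ
χ 2 = 0ℤ
χ (suc (suc (suc k))) = χ k

χ-periodic : ∀ m k → χ (m * 3 + k) ≡ χ k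
χ-periodic zero    k = refl
χ-periodic (suc m) k = χ-periodic m k

χ-bound : ∀ k → ∣ χ k ∣ ≤ 1
χ-bound 0 = s≤s z≤n
χ-bound 1 = s≤s z≤n
χ-bound 2 = z≤n
χ-bound (suc (suc (suc k))) = χ-bound k

-- The indices j and n + j lie in different classes modulo 3, so two distinct values among 1, -1 and
-- 0 are added.
χ-pair-bound : ∀ n j → ¬ 3 ∣ n → ∣ χ (n + j) ℤ.+ χ j ∣ ≤ 1
χ-pair-bound 0 j 3∤n = ⊥-elim (3∤n (divides 0 refl))
χ-pair-bound 1 0 _ = z≤n
χ-pair-bound 1 1 _ = s≤s z≤n
χ-pair-bound 1 2 _ = s≤s z≤n
χ-pair-bound 1 (suc (suc (suc j))) 3∤n = χ-pair-bound 1 j 3∤n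
χ-pair-bound 2 0 _ = s≤s z≤n
χ-pair-bound 2 1 _ = z≤n
χ-pair-bound 2 2 _ = s≤s z≤n
χ-pair-bound 2 (suc (suc (suc j))) 3∤n = χ-pair-bound 2 j 3∤n
χ-pair-bound (suc (suc (suc n))) j 3∤n = χ-pair-bound n j λ { (divides e eq) → 3∤n (divides (suc e) (cong (3 +_) eq)) }

shift-cases : ∀ n f k → (k < n × (X n ⊛ f) k ≡ 0ℤ) ⊎ (∃[ j ] n + j ≡ k × (X n ⊛ f) k ≡ f j)
shift-cases n f k with ℕₚ.<-≤-connex k n
... | inj₁ k<n = inj₁ (k<n , X-⊛-< n f k k<n)
... | inj₂ n≤k with ℕₚ.m≤n⇒∃[o]m+o≡n n≤k
...   | j , refl = inj₂ (j , refl , X-⊛-+ n f j)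

χ-ω : χ ⊛ ω 3 ≈ ω 1
χ-ω = 𝕊.trans (solve 2 (λ c x → c :* (con 1ℤ :- x) := c :- x :* c) 𝕊.refl χ (X 3)) (≗⇒≈ pointwise)
  where
  pointwise : ∀ k → χ k ℤ.- (X 3 ⊛ χ) k ≡ ω 1 k
  pointwise 0 = refl
  pointwise 1 = refl
  pointwise 2 = refl
  pointwise (suc (suc (suc k))) = trans (cong (λ z → χ k ℤ.- z) (X-⊛-+ 3 χ k))
      (trans (ℤₚ.+-inverseʳ (χ k)) refl)

geo3-⊛ : ∀ n f → f ⊛ geo 3 n ≈ f ⊕ X n ⊛ (f ⊕ X n ⊛ f)
geo3-⊛ n f = solve 2 (λ f x → f :* (con 1ℤ :+ x :*
    (con 1ℤ :+ x :* (con 1ℤ :+ x :* con 0ℤ))) := f :+ x :* (f :+ x :* f)) 𝕊.refl f (X n)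

module _ {n F} (F-ω-ω : F ⊛ ω 3 ⊛ ω n ≈ ω 1 ⊛ ω (3 * n)) (n≥1 : 1 ≤ n) where

  F≈ : F ≈ χ ⊕ X n ⊛ (χ ⊕ X n ⊛ χ)
  F≈ = 𝕊.trans (⊛-cancelˡ (ω 3 ⊛ ω n) (unit n n≥1) (begin
      ω 3 ⊛ ω n ⊛ F
        ≈⟨ solve 3 (λ a b f → a :* b :* f := f :* a :* b) 𝕊.refl (ω 3) (ω n) F ⟩
      F ⊛ ω 3 ⊛ ω n
        ≈⟨ F-ω-ω ⟩
      ω 1 ⊛ ω (3 * n)
        ≈⟨ 𝕊.*-cong (𝕊.sym χ-ω) (𝕊.sym (geo-ω 3 n)) ⟩
      (χ ⊛ ω 3) ⊛ (geo 3 n ⊛ ω n)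
        ≈⟨ solve 4 (λ c a g b → (c :* a) :* (g :* b) := a :* b :* (c :* g)) 𝕊.refl χ (ω 3) (geo 3 n)
            (ω n) ⟩
      ω 3 ⊛ ω n ⊛ (χ ⊛ geo 3 n) ∎)) (geo3-⊛ n χ)
    where
    open ≈-Reasoning
    unit : ∀ n → 1 ≤ n → (ω 3 ⊛ ω n) 0 ≡ 1ℤ
    unit (suc n) _ = refl

  F-low : ∀ {k} → k < n → F k ≡ χ k
  F-low {k} k<n = trans (at F≈ k) (trans (cong (ℤ._+_ (χ k)) (X-⊛-< n _ k k<n)) (ℤₚ.+-identityʳ (χ k)))

  F-mid : ∀ {j} → j < n → F (n + j) ≡ χ (n + j) ℤ.+ χ j
  F-mid {j} j<n = trans (at F≈ (n + j)) (cong (ℤ._+_ (χ (n + j)))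
    (trans (X-⊛-+ n _ j) (trans (cong (ℤ._+_ (χ j)) (X-⊛-< n χ j j<n)) (ℤₚ.+-identityʳ (χ j)))))

  module _ {ℓ} (F-Deg≤ : Deg≤ ℓ F) (ℓ<2n : ℓ < n + n) where

    -- The third copy of χ starts at 2n, past the degree ℓ, so only two copies can contribute to a
    -- nonzero coefficient.
    F-bound : ¬ 3 ∣ n → ∀ k → ∣ F k ∣ ≤ 1
    F-bound 3∤n k with ℕₚ.<-≤-connex k n
    ... | inj₁ k<n = subst (λ z → ∣ z ∣ ≤ 1) (sym (F-low k<n)) (χ-bound k)
    ... | inj₂ n≤k with ℕₚ.m≤n⇒∃[o]m+o≡n n≤k
    ...   | j , refl with ℕₚ.<-≤-connex j n
    ...     | inj₁ j<n = subst (λ z → ∣ z ∣ ≤ 1) (sym (F-mid j<n)) (χ-pair-bound n j 3∤n)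
    ...     | inj₂ n≤j = subst (λ z → ∣ z ∣ ≤ 1)
        (sym (F-Deg≤ (n + j) (ℕₚ.<-≤-trans ℓ<2n (ℕₚ.+-monoʳ-≤ n n≤j)))) z≤n

module _ {F ℓ} (F-Deg≤ : Deg≤ ℓ F) (F-bound : ∀ k → ∣ F k ∣ ≤ 1) (r : ℕ) where
  private
    H = F ⊛ geo 3 r
    bound-≡ : ∀ {a b} → a ≡ b → ∣ b ∣ ≤ 1 → ∣ a ∣ ≤ 1
    bound-≡ refl b≤1 = b≤1
    drop-0 : ∀ {a b} → a ≡ 0ℤ → a ℤ.+ b ≡ b
    drop-0 refl = ℤₚ.+-identityˡ _

  tail-bound : ∀ k → ℓ < k → ∣ (F ⊕ X r ⊛ F) k ∣ ≤ 1
  tail-bound k ℓ<k with shift-cases r F k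
  ... | inj₁ (_ , e)        = bound-≡ (trans (drop-0 (F-Deg≤ k ℓ<k)) e) z≤n
  ... | inj₂ (j , refl , e) = bound-≡ (trans (drop-0 (F-Deg≤ k ℓ<k)) e) (F-bound j)

  -- Past ℓ + r the first two of the three copies of `F` have ended.
  H-bound-high : ∀ k → ℓ + r < k → ∣ H k ∣ ≤ 1
  H-bound-high k ℓ+r<k with shift-cases r (F ⊕ X r ⊛ F) k
  ... | inj₁ (_ , e)        = bound-≡ (trans (at (geo3-⊛ r F) k)
      (trans (drop-0 (F-Deg≤ k (ℕₚ.≤-<-trans (ℕₚ.m≤m+n ℓ r) ℓ+r<k))) e)) z≤n
  ... | inj₂ (j , refl , e) = bound-≡ (trans (at (geo3-⊛ r F) k)
      (trans (drop-0 (F-Deg≤ k (ℕₚ.≤-<-trans (ℕₚ.m≤m+n ℓ r) ℓ+r<k))) e))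
      (tail-bound j (ℕₚ.+-cancelˡ-< r ℓ j (subst (_< r + j) (ℕₚ.+-comm ℓ r) ℓ+r<k)))

  H-bound : ℓ < r → ∀ k → ∣ H k ∣ ≤ 1
  H-bound ℓ<r k with shift-cases r (F ⊕ X r ⊛ F) k
  ... | inj₁ (_ , e) = bound-≡ (trans (at (geo3-⊛ r F) k)
      (trans (cong (ℤ._+_ (F k)) e) (ℤₚ.+-identityʳ (F k)))) (F-bound k)
  ... | inj₂ (j , refl , e) = bound-≡ (trans (at (geo3-⊛ r F) k)
      (trans (drop-0 (F-Deg≤ k (ℕₚ.<-≤-trans ℓ<r (ℕₚ.m≤m+n r j)))) e)) (inner j)
    where
    inner : ∀ j → ∣ (F ⊕ X r ⊛ F) j ∣ ≤ 1
    inner j with shift-cases r F j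
    ... | inj₁ (_ , e)        = bound-≡ (trans (cong (ℤ._+_ (F j)) e) (ℤₚ.+-identityʳ (F j)))
        (F-bound j)
    ... | inj₂ (i , refl , e) = bound-≡ (trans
        (drop-0 (F-Deg≤ j (ℕₚ.<-≤-trans ℓ<r (ℕₚ.m≤m+n r i)))) e) (F-bound i)

⊛-ω : ∀ m f → f ⊛ ω m ≈ f ⊕ ⊖ (X m ⊛ f)
⊛-ω m f = solve 2 (λ f x → f :* (con 1ℤ :- x) := f :- x :* f) 𝕊.refl f (X m)

⊛-ω-low : ∀ {m f k} → k < m → (f ⊛ ω m) k ≡ f k
⊛-ω-low {m} {f} {k} k<m = trans (at (⊛-ω m f) k)
    (trans (cong (λ z → f k ℤ.- z) (X-⊛-< m f k k<m)) (ℤₚ.+-identityʳ (f k)))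

⊛-ω-high : ∀ {d m f} → Deg≤ d f → d < m → ∀ k → (f ⊛ ω m) (m + k) ≡ ℤ.- f k
⊛-ω-high {d} {m} {f} deg d<m k = trans (at (⊛-ω m f) (m + k))
  (trans (cong₂ (λ y z → y ℤ.- z) (deg (m + k) (ℕₚ.<-≤-trans d<m (ℕₚ.m≤m+n m k))) (X-⊛-+ m f k))
      (ℤₚ.+-identityˡ _))

-- The case n = 3qr

prime[3] : Prime 3
prime[3] = from-yes (prime? 3)

-- No order between q and r is imposed, because the non-flat case is applied with either prime as
-- the larger one.
record LargePair (q r : ℕ) : Set where
  field
    q-prime : Prime q
    r-prime : Prime r
    3<q     : 3 < q
    3<r     : 3 < r
    q≢r     : q ≢ r
    large   : 12 ≤ (q ∸ 4) * (r ∸ 4)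

prime⇒3∤ : ∀ {q} → Prime q → 3 < q → ¬ 3 ∣ q
prime⇒3∤ qp 3<q 3∣q = ℕₚ.<⇒≢ 3<q (prime∣prime prime[3] qp 3∣q)

module Ternary {q′ r′ : ℕ} (pair : LargePair (suc q′) (suc r′)) where
  open LargePair pair
  q = suc q′
  r = suc r′

  module Φ-3q = Φ-Semiprime (Φ-semiprime prime[3] q-prime (ℕₚ.<⇒≢ 3<q))
  open Φ-3q using (F; ℓ) public

  ℓ≡ : suc (suc ℓ) ≡ q + q
  ℓ≡ = ℕₚ.+-cancelˡ-≡ (suc q) _ _ (trans (regroup₁ q ℓ) (trans Φ-3q.degree (regroup₂ q)))
    where
    regroup₁ : ∀ q l → suc q + suc (suc l) ≡ 3 + q + l
    regroup₁ = ℕ-Solver.solve-∀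
    regroup₂ : ∀ q → suc (3 * q) ≡ suc q + (q + q)
    regroup₂ = ℕ-Solver.solve-∀

  F-bounded : ∀ k → ∣ F k ∣ ≤ 1
  F-bounded = F-bound {q} Φ-3q.F-ω-ω (s≤s z≤n) Φ-3q.F-Deg≤
      (ℕₚ.≤-trans (ℕₚ.n≤1+n _) (ℕₚ.≤-reflexive ℓ≡)) (prime⇒3∤ q-prime 3<q)

  t : ℕ
  t = ℓ + (r + r) + q * r

  n : ℕ
  n = 3 * q * r

  H G : Series
  H = F ⊛ geo 3 r
  G = H ⊛ ω (q * r)

  -- Both inequalities are (q - 4)(r - 4) ≥ 12 after substituting ℓ = 2q - 2.
  4q+4r≤qr+4 : (q + q + (r + r)) + (q + q + (r + r)) ≤ q * r + 4
  4q+4r≤qr+4 = subst₂ (λ q r → (q + q + (r + r)) + (q + q + (r + r)) ≤ q * r + 4)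
    (ℕₚ.m+[n∸m]≡n 3<q) (ℕₚ.m+[n∸m]≡n 3<r) (expand (q ∸ 4) (r ∸ 4) large)
    where
    expand : ∀ a b → 12 ≤ a * b → ((4 + a) + (4 + a) + ((4 + b) + (4 + b))) +
        ((4 + a) + (4 + a) + ((4 + b) + (4 + b))) ≤ (4 + a) * (4 + b) + 4
    expand a b h = subst₂ _≤_ (lhs a b) (rhs a b) (ℕₚ.+-monoʳ-≤ (20 + 4 * a + 4 * b) h)
      where
      lhs : ∀ a b → 20 + 4 * a + 4 * b + 12 ≡ ((4 + a) + (4 + a) + ((4 + b) + (4 + b))) +
          ((4 + a) + (4 + a) + ((4 + b) + (4 + b)))
      lhs = ℕ-Solver.solve-∀
      rhs : ∀ a b → 20 + 4 * a + 4 * b + a * b ≡ (4 + a) * (4 + b) + 4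
      rhs = ℕ-Solver.solve-∀

  2[ℓ+2r]≤qr : (ℓ + (r + r)) + (ℓ + (r + r)) ≤ q * r
  2[ℓ+2r]≤qr = ℕₚ.+-cancelʳ-≤ 4 _ _ (subst (_≤ q * r + 4)
      (trans (cong (λ z → (z + (r + r)) + (z + (r + r))) (sym ℓ≡)) (regroup ℓ (r + r))) 4q+4r≤qr+4)
    where
    regroup : ∀ l x → (suc (suc l) + x) + (suc (suc l) + x) ≡ (l + x) + (l + x) + 4
    regroup = ℕ-Solver.solve-∀

  ℓ+2r<qr : ℓ + (r + r) < q * r
  ℓ+2r<qr = ℕₚ.<-≤-trans (ℕₚ.m<m+n _ (ℕₚ.<-≤-trans (s≤s z≤n) (ℕₚ.m≤n+m (r + r) ℓ))) 2[ℓ+2r]≤qr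

  2t≤n : t + t ≤ n
  2t≤n = ℕₚ.≤-trans (ℕₚ.≤-reflexive (regroup₁ (ℓ + (r + r)) (q * r)))
      (ℕₚ.≤-trans (ℕₚ.+-monoˡ-≤ (q * r + q * r) 2[ℓ+2r]≤qr) (ℕₚ.≤-reflexive (regroup₂ q r)))
    where
    regroup₁ : ∀ x y → x + y + (x + y) ≡ x + x + (y + y)
    regroup₁ = ℕ-Solver.solve-∀
    regroup₂ : ∀ q r → q * r + (q * r + q * r) ≡ 3 * q * r
    regroup₂ = ℕ-Solver.solve-∀

  H-Deg≤ : Deg≤ (ℓ + (r + r)) H
  H-Deg≤ = subst (λ d → Deg≤ (ℓ + d) H) (regroup r)
      (Deg≤-⊛ ℓ (2 * r) F (geo 3 r) Φ-3q.F-Deg≤ (Deg≤-geo 2 r))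
    where
    regroup : ∀ r → 2 * r ≡ r + r
    regroup = ℕ-Solver.solve-∀

  G-low : ∀ {k} → k < q * r → G k ≡ H k
  G-low = ⊛-ω-low

  -- Since deg H < qr, the factor 1 - x^(qr) places -H behind H without overlap.
  G-high : ∀ k → G (q * r + k) ≡ ℤ.- H k
  G-high = ⊛-ω-high H-Deg≤ ℓ+2r<qr

  Ψ-spec : length (Ψ n) ≡ suc t × Agree (suc t) (ρ (Ψ n)) G
  Ψ-spec = Ψ-ternary prime[3] q-prime r-prime (ℕₚ.<⇒≢ 3<q) (ℕₚ.<⇒≢ 3<r) q≢r (regroup ℓ r (q * r)) 2t≤n
    where
    regroup : ∀ l r x → l + (r + r) + x + r ≡ l + 3 * r + x
    regroup = ℕ-Solver.solve-∀

  -- Stated for an arbitrary P so that Ψ n is not unfolded during type checking.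
  module _ (P : Poly) (spec : length P ≡ suc t × Agree (suc t) (ρ P) G) where
    P-coeff : ∀ {i k} → i + k ≡ t → coeff P k ≡ G i
    P-coeff {i} {k} i+k≡t = trans (coeff-ρ P i k
        (trans (ℕₚ.+-suc i k) (trans (cong suc i+k≡t) (sym (proj₁ spec)))))
      (proj₂ spec i (s≤s (subst (i ≤_) i+k≡t (ℕₚ.m≤m+n i k))))

    P-overflow : ∀ {k} → t < k → coeff P k ≡ 0ℤ
    P-overflow {k} t<k = coeff-overflow P k (subst (_≤ k) (sym (proj₁ spec)) t<k)

    flat : ℓ < r → Flat P
    -- The value 1 is attained by the coefficient at `t`, the top degree, which is `G 0`.
    flat ℓ<r = bounded , t , trans (cong ∣_∣ (P-coeff {0} refl))
        (cong (λ z → ∣ z ℤ.* 1ℤ ℤ.* 1ℤ ∣) (Known.lead Φ-3q.known))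
      where
      G-bound : ∀ k → ∣ G k ∣ ≤ 1
      G-bound k with ℕₚ.<-≤-connex k (q * r)
      ... | inj₁ k<qr = subst (λ z → ∣ z ∣ ≤ 1) (sym (G-low k<qr))
          (H-bound Φ-3q.F-Deg≤ F-bounded r ℓ<r k)
      ... | inj₂ qr≤k with ℕₚ.m≤n⇒∃[o]m+o≡n qr≤k
      ...   | j , refl = subst (_≤ 1) (sym (trans (cong ∣_∣ (G-high j)) (ℤₚ.∣-i∣≡∣i∣ (H j))))
          (H-bound Φ-3q.F-Deg≤ F-bounded r ℓ<r j)
      bounded : ∀ k → ∣ coeff P k ∣ ≤ 1
      bounded k with ℕₚ.≤-<-connex k t
      ... | inj₁ k≤t = subst (λ z → ∣ z ∣ ≤ 1) (sym (P-coeff (ℕₚ.m∸n+n≡m k≤t))) (G-bound (t ∸ k))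
      ... | inj₂ t<k = subst (λ z → ∣ z ∣ ≤ 1) (sym (P-overflow t<k)) z≤n

    -- Reversal sends k to position qr + ℓ + r + (r - k): inside the copy of -H, at an index past ℓ
    -- + r, where a single copy of Φ_3q is left.
    low-coefficients : ∀ k → k < r → ∣ coeff P k ∣ ≤ 1
    low-coefficients k k<r = subst (_≤ 1) (sym
        (trans (cong ∣_∣ (trans (P-coeff i+k≡t) (G-high j))) (ℤₚ.∣-i∣≡∣i∣ (H j))))
      (H-bound-high Φ-3q.F-Deg≤ F-bounded r j ℓ+r<j)
      where
      j = ℓ + r + (r ∸ k)
      ℓ+r<j : ℓ + r < j
      ℓ+r<j = ℕₚ.m<m+n (ℓ + r) (ℕₚ.m<n⇒0<n∸m k<r)
      i+k≡t : q * r + j + k ≡ t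
      i+k≡t = trans (regroup (q * r) (ℓ + r) (r ∸ k) k)
          (trans (cong (λ z → ℓ + r + z + q * r) (ℕₚ.m∸n+n≡m (ℕₚ.<⇒≤ k<r)))
          (cong (_+ q * r) (ℕₚ.+-assoc ℓ r r)))
        where
        regroup : ∀ x y z k → x + (y + z) + k ≡ y + (z + k) + x
        regroup = ℕ-Solver.solve-∀

    not-flat : ∀ {i} → i < q * r → ∣ H i ∣ ≡ 2 → ¬ Flat P
    not-flat {i} i<qr e (bounded , _) = 2≰1 (subst (_≤ 1) (trans (cong ∣_∣ P-at) e) (bounded (t ∸ i)))
      where
      2≰1 : ¬ 2 ≤ 1
      2≰1 (s≤s ())
      i≤t : i ≤ t
      i≤t = ℕₚ.≤-trans (ℕₚ.<⇒≤ i<qr) (ℕₚ.m≤n+m (q * r) (ℓ + (r + r)))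
      P-at : coeff P (t ∸ i) ≡ H i
      P-at = trans (P-coeff {i} (ℕₚ.m+[n∸m]≡n i≤t)) (G-low i<qr)

  H-second : ∀ {j} → j < r → H (r + j) ≡ F (r + j) ℤ.+ F j
  H-second {j} j<r = trans (at (geo3-⊛ r F) (r + j)) (cong (ℤ._+_ (F (r + j)))
    (trans (X-⊛-+ r (F ⊕ X r ⊛ F) j) (trans (cong (ℤ._+_ (F j)) (X-⊛-< r F j j<r))
        (ℤₚ.+-identityʳ (F j)))))

  -- Here Φ_3q has equal coefficients at j and at r + j, and the two add up in Φ_3q (1 + x^r + x^2r):
  -- j = 1 works if q ≡ 1 (mod 3), and j = 0 if q ≡ 2.
  module _ {m} (r≡ : r ≡ q + suc m * 3) (r+3≤2q : r + 3 ≤ q + q) where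
    private
      3m+3≤q : suc m * 3 + 3 ≤ q
      3m+3≤q = ℕₚ.+-cancelˡ-≤ q _ _ (subst (_≤ q + q)
          (trans (cong (_+ 3) r≡) (ℕₚ.+-assoc q _ 3)) r+3≤2q)

    -- `r+3≤2q` keeps r + j below 2q, where two copies of χ make up Φ_3q, and the multiple of 3 in r
    -- - q drops out by periodicity. The last `χ j` is contributed by the copy of Φ_3q shifted by r.
    H-at : ∀ j → j < 3 → H (r + j) ≡ (χ (q + j) ℤ.+ χ j) ℤ.+ χ j
    H-at j j<3 = trans (H-second (ℕₚ.<-trans j<3 3<r))
        (cong₂ ℤ._+_ F-at (F-low {q} Φ-3q.F-ω-ω (s≤s z≤n) (ℕₚ.<-trans j<3 3<q)))
      where
      regroup : ∀ q x j → q + (x + j) ≡ x + (q + j)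
      regroup = ℕ-Solver.solve-∀
      F-at : F (r + j) ≡ χ (q + j) ℤ.+ χ j
      F-at = trans (cong F (trans (cong (_+ j) r≡) (ℕₚ.+-assoc q _ j)))
        (trans (F-mid {q} Φ-3q.F-ω-ω (s≤s z≤n) (ℕₚ.<-≤-trans (ℕₚ.+-monoʳ-< (suc m * 3) j<3) 3m+3≤q))
        (cong₂ ℤ._+_ (trans (cong χ (regroup q (suc m * 3) j)) (χ-periodic (suc m) (q + j)))
            (χ-periodic (suc m) j)))

    H-large : ∃[ j ] (j < 3 × ∣ H (r + j) ∣ ≡ 2)
    H-large = by-residue (q % 3) refl
      where
      χq : ∀ j → χ (q + j) ≡ χ (q % 3 + j)
      χq j = trans (cong (λ z → χ (z + j)) (m≡m%n+[m/n]*n q 3))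
        (trans (cong χ (regroup (q % 3) (q / 3 * 3) j)) (χ-periodic (q / 3) (q % 3 + j)))
        where
        regroup : ∀ x y j → x + y + j ≡ y + (x + j)
        regroup = ℕ-Solver.solve-∀
      at-residue : ∀ j → j < 3 → ∣ H (r + j) ∣ ≡ ∣ (χ (q % 3 + j) ℤ.+ χ j) ℤ.+ χ j ∣
      at-residue j j<3 = cong ∣_∣ (trans (H-at j j<3) (cong (λ z → (z ℤ.+ χ j) ℤ.+ χ j) (χq j)))
      by-residue : ∀ i → q % 3 ≡ i → ∃[ j ] (j < 3 × ∣ H (r + j) ∣ ≡ 2)
      by-residue 0 e = ⊥-elim (prime⇒3∤ q-prime 3<q (m%n≡0⇒n∣m q 3 e))
      by-residue 1 e = 1 , s≤s (s≤s z≤n) , trans (at-residue 1 (s≤s (s≤s z≤n)))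
          (cong (λ i → ∣ (χ (i + 1) ℤ.+ χ 1) ℤ.+ χ 1 ∣) e)
      by-residue 2 e = 0 , s≤s z≤n , trans (at-residue 0 (s≤s z≤n))
          (cong (λ i → ∣ (χ (i + 0) ℤ.+ χ 0) ℤ.+ χ 0 ∣) e)
      by-residue (suc (suc (suc i))) e = ⊥-elim
          (ℕₚ.<⇒≱ (m%n<n q 3) (subst (3 ≤_) (sym e) (s≤s (s≤s (s≤s z≤n)))))

    r+j<qr : ∀ {j} → j < 3 → r + j < q * r
    r+j<qr {j} j<3 = ℕₚ.<-≤-trans (ℕₚ.+-monoʳ-< r (ℕₚ.<-trans j<3 3<r))
      (subst (_≤ q * r) (cong (r +_) (ℕₚ.+-identityʳ r))
          (ℕₚ.*-monoˡ-≤ r {2} {q} (ℕₚ.≤-trans (s≤s (s≤s z≤n)) 3<q)))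

module _ {q r : ℕ} (pair : LargePair q r) where
  Ψ-flat : q + q ≤ suc r → Flat (Ψ (3 * q * r))
  Ψ-flat = go q r pair
    where
    go : ∀ q r → LargePair q r → q + q ≤ suc r → Flat (Ψ (3 * q * r))
    go (suc _) (suc _) pair 2q≤1+r = flat (Ψ n) Ψ-spec
        (ℕₚ.≤-pred (ℕₚ.≤-trans (ℕₚ.≤-reflexive ℓ≡) 2q≤1+r))
      where open Ternary pair using (flat; low-coefficients; not-flat; H-large; r+j<qr; ℓ≡; n; Ψ-spec)
    go zero    _       pair _ with () ← LargePair.3<q pair
    go (suc q) zero    pair _ with () ← LargePair.3<r pair

  Ψ-low-coefficients : ∀ k → k < r → ∣ c (3 * q * r) k ∣ ≤ 1
  Ψ-low-coefficients = go q r pair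
    where
    go : ∀ q r → LargePair q r → ∀ k → k < r → ∣ c (3 * q * r) k ∣ ≤ 1
    go (suc _) (suc _) pair = low-coefficients (Ψ n) Ψ-spec
      where open Ternary pair using (flat; low-coefficients; not-flat; H-large; r+j<qr; ℓ≡; n; Ψ-spec)
    go zero    _       pair with () ← LargePair.3<q pair
    go (suc q) zero    pair with () ← LargePair.3<r pair

  Ψ-not-flat : ∀ m → r ≡ q + suc m * 3 → r + 3 ≤ q + q → ¬ Flat (Ψ (3 * q * r))
  Ψ-not-flat = go q r pair
    where
    go : ∀ q r → LargePair q r → ∀ m → r ≡ q + suc m * 3 → r + 3 ≤ q + q → ¬ Flat (Ψ (3 * q * r))
    go (suc _) (suc _) pair m r≡ r+3≤2q = let j , j<3 , e = H-large {m} r≡ r+3≤2q in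
      not-flat (Ψ n) Ψ-spec (r+j<qr {m} r≡ r+3≤2q j<3) e
      where open Ternary pair using (flat; low-coefficients; not-flat; H-large; r+j<qr; ℓ≡; n; Ψ-spec)
    go zero    _       pair with () ← LargePair.3<q pair
    go (suc q) zero    pair with () ← LargePair.3<r pair

-- Products over primes

⟦_⟧ : ∀ {a} {A : Set a} → Dec A → ℕ
⟦ yes _ ⟧ = 1
⟦ no  _ ⟧ = 0

⟦⟧-true : ∀ {a} {A : Set a} (d : Dec A) → A → ⟦ d ⟧ ≡ 1
⟦⟧-true (yes _) _ = refl
⟦⟧-true (no ¬a) a = ⊥-elim (¬a a)

⟦⟧-false : ∀ {a} {A : Set a} (d : Dec A) → ¬ A → ⟦ d ⟧ ≡ 0
⟦⟧-false (yes a) ¬a = ⊥-elim (¬a a)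
⟦⟧-false (no _)  _  = refl

⟦⟧-mono : ∀ {a b} {A : Set a} {B : Set b} (d : Dec A) (e : Dec B) → (A → B) → ⟦ d ⟧ ≤ ⟦ e ⟧
⟦⟧-mono (yes a) e f = ℕₚ.≤-reflexive (sym (⟦⟧-true e (f a)))
⟦⟧-mono (no _)  e f = z≤n

Σ< : ℕ → (ℕ → ℕ) → ℕ
Σ< zero    f = 0
Σ< (suc n) f = Σ< n f + f n

Π< : ℕ → (ℕ → ℕ) → ℕ
Π< zero    f = 1
Π< (suc n) f = Π< n f * f n

Σ<-cong : ∀ n {f g} → (∀ k → k < n → f k ≡ g k) → Σ< n f ≡ Σ< n g
Σ<-cong zero    e = refl
Σ<-cong (suc n) e = cong₂ _+_ (Σ<-cong n λ k k<n → e k (ℕₚ.m<n⇒m<1+n k<n)) (e n ℕₚ.≤-refl)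

Σ<-mono : ∀ n {f g} → (∀ k → k < n → f k ≤ g k) → Σ< n f ≤ Σ< n g
Σ<-mono zero    e = z≤n
Σ<-mono (suc n) e = ℕₚ.+-mono-≤ (Σ<-mono n λ k k<n → e k (ℕₚ.m<n⇒m<1+n k<n)) (e n ℕₚ.≤-refl)

Σ<-0 : ∀ n → Σ< n (λ _ → 0) ≡ 0
Σ<-0 zero    = refl
Σ<-0 (suc n) = trans (ℕₚ.+-identityʳ _) (Σ<-0 n)

Σ<-zero : ∀ n {f} → (∀ k → k < n → f k ≡ 0) → Σ< n f ≡ 0
Σ<-zero n e = trans (Σ<-cong n e) (Σ<-0 n)

Σ<-+ : ∀ n f g → Σ< n (λ k → f k + g k) ≡ Σ< n f + Σ< n g
Σ<-+ zero    f g = refl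
Σ<-+ (suc n) f g = trans (cong (_+ (f n + g n)) (Σ<-+ n f g)) (regroup (Σ< n f) (Σ< n g) (f n) (g n))
  where
  regroup : ∀ a b c d → a + b + (c + d) ≡ a + c + (b + d)
  regroup = ℕ-Solver.solve-∀

Σ<-swap : ∀ m n (f : ℕ → ℕ → ℕ) → Σ< m (λ i → Σ< n (f i)) ≡ Σ< n (λ j → Σ< m (λ i → f i j))
Σ<-swap zero    n f = sym (Σ<-0 n)
Σ<-swap (suc m) n f = trans (cong (_+ Σ< n (f m)) (Σ<-swap m n f)) (sym (Σ<-+ n _ _))

Σ<-head : ∀ n f → Σ< (suc n) f ≡ f 0 + Σ< n (λ k → f (suc k))
Σ<-head zero    f = sym (ℕₚ.+-identityʳ (f 0))
Σ<-head (suc n) f = trans (cong (_+ f (suc n)) (Σ<-head n f)) (ℕₚ.+-assoc (f 0) _ _)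

Π<-mono : ∀ n {f g} → (∀ k → k < n → f k ≤ g k) → Π< n f ≤ Π< n g
Π<-mono zero    e = ℕₚ.≤-refl
Π<-mono (suc n) e = ℕₚ.*-mono-≤ (Π<-mono n λ k k<n → e k (ℕₚ.m<n⇒m<1+n k<n)) (e n ℕₚ.≤-refl)

Π<-const : ∀ n a → Π< n (λ _ → a) ≡ a ^ n
Π<-const zero    a = refl
Π<-const (suc n) a = trans (cong (_* a) (Π<-const n a)) (ℕₚ.*-comm _ a)

-- Primality sits in the exponent, so products over the primes below `M` are plain indexed products
-- and multiply by adding exponents.
primePowers : ℕ → (ℕ → ℕ) → ℕ
primePowers M e = Π< M λ p → p ^ (⟦ prime? p ⟧ * e p)

prime-exponent-mono : ∀ p {a b} → (Prime p → a ≤ b) → p ^ (⟦ prime? p ⟧ * a) ≤ p ^ (⟦ prime? p ⟧ * b)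
prime-exponent-mono p a≤b with prime? p
... | yes pp = ℕₚ.^-monoʳ-≤ p ⦃ prime⇒nonZero pp ⦄ (ℕₚ.+-monoˡ-≤ 0 (a≤b pp))
... | no _   = ℕₚ.≤-refl

primePowers-mono : ∀ M {e f} → (∀ p → p < M → Prime p → e p ≤ f p) → primePowers M e ≤ primePowers M f
primePowers-mono M e≤f = Π<-mono M λ p p<M → prime-exponent-mono p (e≤f p p<M)

primePowers-cong : ∀ M {e f} → (∀ p → p < M → Prime p → e p ≡ f p) → primePowers M e ≡ primePowers M f
primePowers-cong M e≡f = ℕₚ.≤-antisym (primePowers-mono M λ p p<M pp → ℕₚ.≤-reflexive (e≡f p p<M pp))
                                      (primePowers-mono M λ p p<M pp → ℕₚ.≤-reflexive
                                          (sym (e≡f p p<M pp)))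

primePowers-+ : ∀ M e f → primePowers M (λ p → e p + f p) ≡ primePowers M e * primePowers M f
primePowers-+ zero    e f = refl
primePowers-+ (suc M) e f = trans (cong₂ _*_ (primePowers-+ M e f)
  (trans (cong (M ^_) (ℕₚ.*-distribˡ-+ ⟦ prime? M ⟧ (e M) (f M)))
      (ℕₚ.^-distribˡ-+-* M (⟦ prime? M ⟧ * e M) _)))
  (regroup (primePowers M e) (primePowers M f) _ _)
  where
  regroup : ∀ a b c d → a * b * (c * d) ≡ a * c * (b * d)
  regroup = ℕ-Solver.solve-∀

primePowers-0 : ∀ M {e} → (∀ p → p < M → Prime p → e p ≡ 0) → primePowers M e ≡ 1
primePowers-0 M e≡0 = trans (primePowers-cong M e≡0) (all-ones M)
  where
  all-ones : ∀ M → primePowers M (λ _ → 0) ≡ 1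
  all-ones zero    = refl
  all-ones (suc M) = cong₂ _*_ (all-ones M) (cong (M ^_) (ℕₚ.*-zeroʳ ⟦ prime? M ⟧))

primePowers-single : ∀ M q t → Prime q → q < M → primePowers M (λ p → ⟦ p ≟ q ⟧ * t) ≡ q ^ t
primePowers-single (suc M) q t qp q<1+M with ℕₚ.m≤n⇒m<n∨m≡n (ℕₚ.≤-pred q<1+M)
... | inj₁ q<M  = trans (cong₂ _*_ (primePowers-single M q t qp q<M)
  (cong (M ^_) (trans (cong (λ z → ⟦ prime? M ⟧ * (z * t)) (⟦⟧-false (M ≟ q) λ { refl → ℕₚ.<-irrefl refl q<M })) (ℕₚ.*-zeroʳ ⟦ prime? M ⟧))))
  (ℕₚ.*-identityʳ _)
... | inj₂ refl = trans (cong₂ _*_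
  (primePowers-0 q λ p p<q _ → cong (_* t) (⟦⟧-false (p ≟ q) λ { refl → ℕₚ.<-irrefl refl p<q }))
  (cong (q ^_) (trans (cong₂ (λ x y → x * (y * t)) (⟦⟧-true (prime? q) qp) (⟦⟧-true (q ≟ q) refl))
      (trans (ℕₚ.+-identityʳ _) (ℕₚ.+-identityʳ t)))))
  (ℕₚ.*-identityˡ _)

primePowers-restrict : ∀ M Y e → Y ≤ M → primePowers M (λ p → ⟦ p <? Y ⟧ * e p) ≤ primePowers Y e
primePowers-restrict M Y e Y≤M with ℕₚ.m≤n⇒m<n∨m≡n Y≤M
... | inj₂ refl = primePowers-mono Y λ p p<Y _ → ℕₚ.≤-reflexive
    (trans (cong (_* e p) (⟦⟧-true (p <? Y) p<Y)) (ℕₚ.+-identityʳ (e p)))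
primePowers-restrict (suc M) Y e _ | inj₁ (s≤s Y≤M) = ℕₚ.≤-trans
  (ℕₚ.≤-reflexive (trans (cong (primePowers M (λ p → ⟦ p <? Y ⟧ * e p) *_)
    (cong (M ^_) (trans (cong (λ z → ⟦ prime? M ⟧ * (z * e M)) (⟦⟧-false (M <? Y) (ℕₚ.≤⇒≯ Y≤M)))
        (ℕₚ.*-zeroʳ ⟦ prime? M ⟧)))) (ℕₚ.*-identityʳ _)))
  (primePowers-restrict M Y e Y≤M)

-- A crude bound: a factor `W` for every p < Y, prime or not. It is applied only with `Y` of order
-- √W.
primePowers-bound : ∀ Y e W → 1 ≤ W → (∀ p → Prime p → p ^ e p ≤ W) → primePowers Y e ≤ W ^ Y
primePowers-bound Y e W 1≤W bound = ℕₚ.≤-trans (Π<-mono Y λ p _ → factor p)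
    (ℕₚ.≤-reflexive (Π<-const Y W))
  where
  factor : ∀ p → p ^ (⟦ prime? p ⟧ * e p) ≤ W
  factor p with prime? p
  ... | yes pp = subst (λ z → p ^ z ≤ W) (sym (ℕₚ.+-identityʳ (e p))) (bound p pp)
  ... | no _   = 1≤W

-- Valuations

-- Correct only when the cutoff J exceeds the true exponent.
valuation : ℕ → ℕ → ℕ → ℕ
valuation J p a = Σ< J λ j → ⟦ p ^ suc j ∣? a ⟧

valuation-1 : ∀ J {p} → Prime p → valuation J p 1 ≡ 0
valuation-1 J {p} pp = Σ<-zero J λ j _ → ⟦⟧-false (p ^ suc j ∣? 1) λ d →
  ℕₚ.<⇒≢ (1<prime pp) (sym (∣1⇒≡1 (∣-trans (m∣m*n (p ^ j)) d)))

⟦⟧-cong : ∀ {a b} {A : Set a} {B : Set b} (d : Dec A) (e : Dec B) → (A → B) → (B → A) → ⟦ d ⟧ ≡ ⟦ e ⟧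
⟦⟧-cong d e f g = ℕₚ.≤-antisym (⟦⟧-mono d e f) (⟦⟧-mono e d g)

coprime-^ : ∀ {p q} → Prime p → Prime q → p ≢ q → ∀ j → Coprime (p ^ j) q
coprime-^ pp qp p≢q j = ∤⇒coprime qp (λ d → p≢q (sym (prime∣prime qp pp (descend j d))))
  where
  descend : ∀ j → _ ∣ _ ^ j → _ ∣ _
  descend zero    d with refl ← ∣1⇒≡1 d with s≤s () ← 1<prime qp
  descend (suc j) d with euclidsLemma _ _ qp d
  ... | inj₁ q∣p  = q∣p
  ... | inj₂ q∣pʲ = descend j q∣pʲ

valuation-≢ : ∀ J {p q} b → Prime p → Prime q → p ≢ q → valuation J p (q * b) ≡ valuation J p b
valuation-≢ J {p} {q} b pp qp p≢q = Σ<-cong J λ j _ → ⟦⟧-cong (p ^ suc j ∣? q * b) (p ^ suc j ∣? b)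
  (coprime-divisor (coprime-^ pp qp p≢q (suc j))) (λ d → ∣-trans d (n∣m*n q))

valuation-≡ : ∀ J {p} b → Prime p → .⦃ NonZero b ⦄ → b < p ^ J → valuation J p (p * b) ≡ suc
    (valuation J p b)
valuation-≡ zero    (suc zero) pp (s≤s ())
valuation-≡ zero    (suc (suc b)) pp (s≤s ())
valuation-≡ (suc J) {p} b pp b< = begin
  valuation (suc J) p (p * b)
    ≡⟨ Σ<-head J _ ⟩
  ⟦ p ^ 1 ∣? p * b ⟧ + Σ< J (λ j → ⟦ p ^ suc (suc j) ∣? p * b ⟧)
    ≡⟨ cong₂ _+_ (⟦⟧-true (p ^ 1 ∣? p * b) (subst (_∣ p * b) (sym (ℕₚ.*-identityʳ p)) (m∣m*n b)))
         (Σ<-cong J λ j _ → ⟦⟧-cong (p ^ suc (suc j) ∣? p * b) (p ^ suc j ∣? b)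
             (*-cancelˡ-∣ p ⦃ prime⇒nonZero pp ⦄) (*-monoʳ-∣ p)) ⟩
  suc (valuation J p b)
    ≡⟨ cong suc (sym (trans (cong (valuation J p b +_)
        (⟦⟧-false (p ^ suc J ∣? b) λ d → ℕₚ.<⇒≱ b< (∣⇒≤ d))) (ℕₚ.+-identityʳ _))) ⟩
  suc (valuation (suc J) p b) ∎
  where open ≡-Reasoning

-- Induction along a prime factorisation: each prime factor q raises the valuation at q by one and
-- changes no other. a < M brings every prime factor into range, and a < 2^J keeps the exponents
-- below the cutoff.
primePowers-valuation : ∀ J M a → .⦃ NonZero a ⦄ → a < M → a < 2 ^ J → primePowers M
    (λ p → valuation J p a) ≡ a
primePowers-valuation J M a a<M a<2^J = subst (λ a → primePowers M (λ p → valuation J p a) ≡ a)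
    (sym isFactorisation)
  (go factors factorsPrime (subst (_< M) isFactorisation a<M) (subst (_< 2 ^ J) isFactorisation a<2^J))
  where
  open PrimeFactorisation (factorise a)
  go : ∀ qs → All Prime qs → product qs < M → product qs < 2 ^ J → primePowers M
      (λ p → valuation J p (product qs)) ≡ product qs
  go []       []         _  _   = primePowers-0 M λ p _ pp → valuation-1 J pp
  go (q ∷ qs) (qp ∷ qsp) <M <2^J = begin
    primePowers M (λ p → valuation J p (q * b))
      ≡⟨ primePowers-cong M (λ p _ pp → step p pp) ⟩
    primePowers M (λ p → ⟦ p ≟ q ⟧ * 1 + valuation J p b)
      ≡⟨ primePowers-+ M _ _ ⟩
    primePowers M (λ p → ⟦ p ≟ q ⟧ * 1) * primePowers M (λ p → valuation J p b)
      ≡⟨ cong₂ _*_ (trans (primePowers-single M q 1 qp (ℕₚ.≤-<-trans (ℕₚ.m≤m*n q b) <M))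
          (ℕₚ.^-identityʳ q))
                   (go qs qsp (ℕₚ.≤-<-trans b≤ <M) (ℕₚ.≤-<-trans b≤ <2^J)) ⟩
    q * b ∎
    where
    open ≡-Reasoning
    b = product qs
    instance
      b≢0 : NonZero b
      b≢0 = productOfPrimes≢0 qsp
    b≤ : b ≤ q * b
    b≤ = ℕₚ.m≤n*m b q ⦃ prime⇒nonZero qp ⦄
    step : ∀ p → Prime p → valuation J p (q * b) ≡ ⟦ p ≟ q ⟧ * 1 + valuation J p b
    step p pp with p ≟ q
    ... | yes refl = valuation-≡ J b pp (ℕₚ.<-≤-trans (ℕₚ.≤-<-trans b≤ <2^J)
        (ℕₚ.^-monoˡ-≤ J (1<prime pp)))
    ... | no p≢q   = valuation-≢ J b pp qp p≢q

hits : (ℕ → ℕ) → ℕ → ℕ → ℕ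
hits f d n = Σ< n λ k → ⟦ d ∣? f k ⟧

-- Legendre's count: exchanging sums, the exponent of p is the sum over j of the number of factors
-- divisible by p^j.
Π<-primePowers : ∀ J M f n → (∀ k → k < n → 1 ≤ f k × f k < M × f k < 2 ^ J) →
                 Π< n f ≡ primePowers M (λ p → Σ< J λ j → hits f (p ^ suc j) n)
Π<-primePowers J M f n bounds = trans (go n bounds) (primePowers-cong M λ p _ _ → Σ<-swap n J _)
  where
  go : ∀ n → (∀ k → k < n → 1 ≤ f k × f k < M × f k < 2 ^ J) → Π< n f ≡ primePowers M
      (λ p → Σ< n λ k → valuation J p (f k))
  go zero    _      = sym (primePowers-0 M λ _ _ _ → refl)
  go (suc n) bounds = let 1≤ , <M , <2^J = bounds n ℕₚ.≤-refl in
    trans (cong₂ _*_ (go n λ k k<n → bounds k (ℕₚ.m<n⇒m<1+n k<n))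
        (sym (primePowers-valuation J M (f n) ⦃ >-nonZero 1≤ ⦄ <M <2^J)))
          (sym (primePowers-+ M _ _))

-- The Chebyshev bound

prime∤! : ∀ {p} → Prime p → ∀ k → k < p → ¬ p ∣ k !
prime∤! pp zero    _   d with refl ← ∣1⇒≡1 d with s≤s () ← 1<prime pp
prime∤! pp (suc k) k<p d with euclidsLemma (suc k) (k !) pp d
... | inj₁ p∣1+k = ℕₚ.<⇒≱ k<p (∣⇒≤ p∣1+k)
... | inj₂ p∣k!  = prime∤! pp k (ℕₚ.<⇒≤ k<p) p∣k!

prime∣! : ∀ {p} → Prime p → ∀ {n} → p ≤ n → p ∣ n !
prime∣! {suc p} pp p≤n = ∣-trans (m∣m*n (p !)) (m≤n⇒m!∣n! p≤n)
prime∣! {zero}  pp _ with () ← prime⇒nonZero pp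

-- The bound 4^m for the binomial coefficient of m in 2m + 1, without division. One step multiplies
-- that coefficient by 2(2m + 3)/(m + 2), which is at most 4.
central-bound : ∀ m → (m + suc m) ! ≤ 4 ^ m * (m ! * suc m !)
central-bound zero    = ℕₚ.≤-refl
central-bound (suc m) = begin
  (suc m + suc (suc m)) !
    ≡⟨ cong _! (index m) ⟩
  suc (suc (m + suc m)) * (suc (m + suc m) * (m + suc m) !)
    ≤⟨ ℕₚ.*-monoʳ-≤ (suc (suc (m + suc m))) (ℕₚ.*-monoʳ-≤ (suc (m + suc m)) (central-bound m)) ⟩
  suc (suc (m + suc m)) * (suc (m + suc m) * (4 ^ m * (m ! * suc m !)))
    ≡⟨ regroup₁ m (4 ^ m * (m ! * suc m !)) ⟩
  (2 * m + 3) * (m + 1) * (2 * (4 ^ m * (m ! * suc m !)))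
    ≤⟨ ℕₚ.*-monoˡ-≤ (2 * (4 ^ m * (m ! * suc m !)))
        (ℕₚ.*-monoˡ-≤ (m + 1) (ℕₚ.≤-trans (ℕₚ.+-monoʳ-≤ (2 * m) (ℕₚ.n≤1+n 3))
        (ℕₚ.≤-reflexive (double m)))) ⟩
  (2 * (m + 2)) * (m + 1) * (2 * (4 ^ m * (m ! * suc m !)))
    ≡⟨ regroup₂ m (4 ^ m) (m !) (suc m !) ⟩
  4 ^ suc m * (suc m ! * suc (suc m) !) ∎
  where
  open ℕₚ.≤-Reasoning
  index : ∀ m → suc m + suc (suc m) ≡ suc (suc (m + suc m))
  index = ℕ-Solver.solve-∀
  double : ∀ m → 2 * m + 4 ≡ 2 * (m + 2)
  double = ℕ-Solver.solve-∀
  regroup₁ : ∀ m x → suc (suc (m + suc m)) * (suc (m + suc m) * x) ≡ (2 * m + 3) * (m + 1) * (2 * x)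
  regroup₁ = ℕ-Solver.solve-∀
  regroup₂ : ∀ m a f g → (2 * (m + 2)) * (m + 1) * (2 * (a * (f * g))) ≡ (4 * a) *
      ((suc m * f) * (suc (suc m) * g))
  regroup₂ = ℕ-Solver.solve-∀

-- The primes in (m + 1, 2m + 1] divide the binomial coefficient C, which is at most 4^m.
module _ (m : ℕ) where
  private
    N = m + suc m
    upper : ℕ → ℕ
    upper p = ⟦ m + 2 ≤? p ⟧
    D : ℕ → ℕ
    D M = primePowers M upper

  prime∤upper : ∀ M q → Prime q → M ≤ q → ¬ q ∣ D M
  prime∤upper zero    q qp _   d with refl ← ∣1⇒≡1 d with s≤s () ← 1<prime qp
  prime∤upper (suc M) q qp M<q d with euclidsLemma (D M) (M ^ (⟦ prime? M ⟧ * upper M)) qp d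
  ... | inj₁ q∣D = prime∤upper M q qp (ℕₚ.<⇒≤ M<q) q∣D
  ... | inj₂ q∣M with prime? M | m + 2 ≤? M | q∣M
  ...   | no _   | _     | d′ = ℕₚ.<⇒≢ (1<prime qp) (sym (∣1⇒≡1 d′))
  ...   | yes _  | no _  | d′ = ℕₚ.<⇒≢ (1<prime qp) (sym (∣1⇒≡1 d′))
  ...   | yes Mp | yes _ | d′ = ℕₚ.<⇒≢ M<q (sym
      (prime∣prime qp Mp (subst (q ∣_) (ℕₚ.*-identityʳ M) d′)))

  -- A new prime `M` in the range divides N! but neither m! nor (m + 1)!, hence divides C. Writing C
  -- = x D, it does not divide D, a product of smaller primes, so it divides x and can be moved into
  -- the product.
  upper∣ : ∀ C → C * (m ! * suc m !) ≡ N ! → ∀ M → M ≤ suc N → D M ∣ C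
  upper∣ C e zero    _ = 1∣ C
  upper∣ C e (suc M) (s≤s M≤N) with upper∣ C e M (ℕₚ.m≤n⇒m≤1+n M≤N) | prime? M | m + 2 ≤? M
  ... | D∣C | no _  | _     = subst (_∣ C) (sym (ℕₚ.*-identityʳ (D M))) D∣C
  ... | D∣C | yes _ | no _  = subst (_∣ C) (sym (ℕₚ.*-identityʳ (D M))) D∣C
  ... | divides x refl | yes Mp | yes m+2≤M = subst (D M * (M ^ 1) ∣_) (ℕₚ.*-comm (D M) x)
      (*-monoʳ-∣ (D M) (subst (_∣ x) (sym (ℕₚ.*-identityʳ M)) M∣x))
    where
    m+1<M : suc m < M
    m+1<M = subst (_≤ M) (ℕₚ.+-comm m 2) m+2≤M
    M∣C : M ∣ x * D M
    M∣C with euclidsLemma (x * D M) (m ! * suc m !) Mp (subst (M ∣_) (sym e) (prime∣! Mp M≤N))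
    ... | inj₁ d = d
    ... | inj₂ d with euclidsLemma (m !) (suc m !) Mp d
    ...   | inj₁ d′ = ⊥-elim (prime∤! Mp m (ℕₚ.<⇒≤ m+1<M) d′)
    ...   | inj₂ d′ = ⊥-elim (prime∤! Mp (suc m) m+1<M d′)
    M∣x : M ∣ x
    M∣x with euclidsLemma x (D M) Mp M∣C
    ... | inj₁ d = d
    ... | inj₂ d = ⊥-elim (prime∤upper M M Mp ℕₚ.≤-refl d)

  upper-bound : D (suc N) ≤ 4 ^ m
  upper-bound with k![n∸k]!∣n! {N} {m} (ℕₚ.m≤m+n m (suc m))
  ... | divides C e = ℕₚ.≤-trans (∣⇒≤ ⦃ C≢0 ⦄ (upper∣ C e′ (suc N) ℕₚ.≤-refl)) C≤
    where
    e′ : C * (m ! * suc m !) ≡ N !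
    e′ = sym (trans e (cong (λ k → C * (m ! * k !)) (ℕₚ.m+n∸m≡n m (suc m))))
    nz : NonZero (m ! * suc m !)
    nz = m ℕₚ.!* suc m !≢0
    C≤ : C ≤ 4 ^ m
    C≤ = ℕₚ.*-cancelʳ-≤ C (4 ^ m) (m ! * suc m !) ⦃ nz ⦄
        (subst (_≤ 4 ^ m * (m ! * suc m !)) (sym e′) (central-bound m))
    C≢0 : NonZero C
    C≢0 = ℕₚ.m*n≢0⇒m≢0 C {m ! * suc m !} ⦃ subst NonZero (sym e′) (N ℕₚ.!≢0) ⦄

  primorial-odd : primePowers (suc N) (λ _ → 1) ≤ primePowers (suc (suc m)) (λ _ → 1) * 4 ^ m
  primorial-odd = begin
    primePowers (suc N) (λ _ → 1)
      ≤⟨ primePowers-mono (suc N) (λ p _ _ → split p) ⟩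
    primePowers (suc N) (λ p → ⟦ p <? suc (suc m) ⟧ * 1 + upper p)
      ≡⟨ primePowers-+ (suc N) _ _ ⟩
    primePowers (suc N) (λ p → ⟦ p <? suc (suc m) ⟧ * 1) * D (suc N)
      ≤⟨ ℕₚ.*-mono-≤ (primePowers-restrict (suc N) (suc (suc m)) (λ _ → 1)
          (s≤s (ℕₚ.m≤n+m (suc m) m))) upper-bound ⟩
    primePowers (suc (suc m)) (λ _ → 1) * 4 ^ m ∎
    where
    open ℕₚ.≤-Reasoning
    split : ∀ p → 1 ≤ ⟦ p <? suc (suc m) ⟧ * 1 + upper p
    split p with p <? suc (suc m)
    ... | yes _   = s≤s z≤n
    ... | no p≮ = ℕₚ.≤-reflexive (sym (⟦⟧-true (m + 2 ≤? p) (subst (_≤ p) (ℕₚ.+-comm 2 m) (ℕₚ.≮⇒≥ p≮))))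

even-or-odd : ∀ n → (∃[ m ] n ≡ m + m) ⊎ (∃[ m ] n ≡ m + suc m)
even-or-odd zero    = inj₁ (0 , refl)
even-or-odd (suc n) with even-or-odd n
... | inj₁ (m , refl) = inj₂ (m , sym (ℕₚ.+-suc m m))
... | inj₂ (m , refl) = inj₁ (suc m , refl)

-- Erdős's induction: an even N > 2 is not prime and adds nothing, while N = 2m + 1 reduces to m + 1
-- at the cost of 4^m.
primorial-bound : ∀ N → primePowers (suc N) (λ _ → 1) ≤ 4 ^ N
primorial-bound = <-rec _ step
  where
  step : ∀ N → (∀ {K} → K < N → primePowers (suc K) (λ _ → 1) ≤ 4 ^ K) → primePowers (suc N)
      (λ _ → 1) ≤ 4 ^ N
  step N rec with even-or-odd N
  ... | inj₁ (zero , refl)        = s≤s z≤n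
  ... | inj₁ (suc zero , refl)    = s≤s (s≤s z≤n)
  ... | inj₁ (suc (suc m) , refl) = begin
    primePowers (suc N) (λ _ → 1)
      ≡⟨ trans (cong (λ z → primePowers N (λ _ → 1) * N ^ (z * 1))
          (⟦⟧-false (prime? N) N-composite)) (ℕₚ.*-identityʳ _) ⟩
    primePowers N (λ _ → 1)
      ≤⟨ rec ℕₚ.≤-refl ⟩
    4 ^ (suc m + suc (suc m))
      ≤⟨ ℕₚ.^-monoʳ-≤ 4 (ℕₚ.n≤1+n (suc m + suc (suc m))) ⟩
    4 ^ N ∎
    where
    open ℕₚ.≤-Reasoning
    N-composite : ¬ Prime N
    N-composite Np with ∣prime Np (divides {2} (2 + m) (regroup m))
      where
      regroup : ∀ m → suc (suc m) + suc (suc m) ≡ (2 + m) * 2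
      regroup = ℕ-Solver.solve-∀
    ... | inj₁ ()
    ... | inj₂ 2≡N = ℕₚ.<⇒≢ (s≤s (s≤s (ℕₚ.m≤n⇒m≤o+n m (s≤s z≤n)))) 2≡N
  ... | inj₂ (zero , refl)  = s≤s z≤n
  ... | inj₂ (suc m , refl) = begin
    primePowers (suc N) (λ _ → 1)                     ≤⟨ primorial-odd (suc m) ⟩
    primePowers (3 + m) (λ _ → 1) * 4 ^ suc m         ≤⟨ ℕₚ.*-monoˡ-≤ (4 ^ suc m)
        (rec (ℕₚ.m<n+m (2 + m) {suc m} (s≤s z≤n))) ⟩
    4 ^ (2 + m) * 4 ^ suc m                           ≡⟨ ℕₚ.^-distribˡ-+-* 4 (2 + m) (suc m) ⟨
    4 ^ (2 + m + suc m)                               ≡⟨ cong (4 ^_) (ℕₚ.+-comm (2 + m) (suc m)) ⟩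
    4 ^ N ∎
    where open ℕₚ.≤-Reasoning

-- Comparison of ∏ (6k + ε) with ∏ (2k + 1)

oddProgression : ℕ → ℕ
oddProgression k = 2 * k + 1

progression : ℕ → ℕ → ℕ
progression ε k = 6 * k + ε

hits-mono : ∀ f d {m n} → m ≤ n → hits f d m ≤ hits f d n
hits-mono f d {n = zero}  z≤n = z≤n
hits-mono f d {m} {suc n} m≤1+n with ℕₚ.m≤n⇒m<n∨m≡n m≤1+n
... | inj₁ m≤n  = ℕₚ.≤-trans (hits-mono f d (ℕₚ.≤-pred m≤n)) (ℕₚ.m≤m+n _ _)
... | inj₂ refl = ℕₚ.≤-refl

-- The solutions of d ∣ 2k + 1 with d = 2m + 1 are k = m + d i.
odd-hits-lower : ∀ {d m} → d ≡ m + suc m → ∀ N {n} → m + d * N < n → suc N ≤ hits oddProgression d n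
odd-hits-lower {d} {m} d≡ N lt = ℕₚ.≤-trans (go N) (hits-mono oddProgression d lt)
  where
  is-hit : ∀ N → d ∣ oddProgression (m + d * N)
  is-hit N = divides (1 + 2 * N) (trans (regroup₁ m d N)
      (trans (cong (_+ d * (2 * N)) (sym d≡)) (regroup₂ d N)))
    where
    regroup₁ : ∀ m d N → 2 * (m + d * N) + 1 ≡ m + suc m + d * (2 * N)
    regroup₁ = ℕ-Solver.solve-∀
    regroup₂ : ∀ d N → d + d * (2 * N) ≡ (1 + 2 * N) * d
    regroup₂ = ℕ-Solver.solve-∀
  d≥1 : 1 ≤ d
  d≥1 = subst (1 ≤_) (sym d≡) (ℕₚ.≤-trans (s≤s z≤n) (ℕₚ.m≤n+m (suc m) m))
  last : ∀ N → hits oddProgression d (suc (m + d * N)) ≡ suc (hits oddProgression d (m + d * N))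
  last N = trans (cong (hits oddProgression d (m + d * N) +_)
      (⟦⟧-true (d ∣? oddProgression (m + d * N)) (is-hit N))) (ℕₚ.+-comm _ 1)
  go : ∀ N → suc N ≤ hits oddProgression d (suc (m + d * N))
  go zero    = ℕₚ.≤-trans (s≤s z≤n) (ℕₚ.≤-reflexive (sym (last zero)))
  go (suc N) = ℕₚ.≤-trans (s≤s (ℕₚ.≤-trans (go N) (hits-mono oddProgression d next)))
      (ℕₚ.≤-reflexive (sym (last (suc N))))
    where
    next : m + d * N < m + d * suc N
    next = ℕₚ.+-monoʳ-< m (ℕₚ.<-≤-trans (ℕₚ.m<n+m (d * N) d≥1) (ℕₚ.≤-reflexive (sym (ℕₚ.*-suc d N))))

module _ {ε d} (ε≥1 : 1 ≤ ε) (cancel6 : ∀ x → d ∣ 6 * x → d ∣ x) where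

  -- The first term divisible by d is at least d, and later ones follow at distances of at least 6d,
  -- as d is coprime to 6. So the last of N + 1 such terms is at least d(6N + 1); the induction
  -- carries that last term along.
  progression-hits : ∀ n → hits (progression ε) d n ≡ 0 ⊎
    (∃[ k ] ∃[ N ] k < n × d ∣ progression ε k × hits (progression ε) d n ≡ suc N × d * (6 * N + 1)
        ≤ progression ε k)
  progression-hits zero    = inj₁ refl
  progression-hits (suc n) with d ∣? progression ε n | progression-hits n
  ... | no _  | inj₁ e = inj₁ (trans (ℕₚ.+-identityʳ _) e)
  ... | no _  | inj₂ (k , N , k<n , hit , e , le) = inj₂
      (k , N , ℕₚ.m<n⇒m<1+n k<n , hit , trans (ℕₚ.+-identityʳ _) e , le)
  ... | yes hit | inj₁ e = inj₂ (n , 0 , ℕₚ.≤-refl , hit , cong (_+ 1) e ,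
        subst (_≤ progression ε n) (sym (ℕₚ.*-identityʳ d))
            (∣⇒≤ ⦃ >-nonZero (ℕₚ.≤-trans ε≥1 (ℕₚ.m≤n+m ε (6 * n))) ⦄ hit))
  ... | yes hit | inj₂ (k , N , k<n , hit′ , e , le) = inj₂
      (n , suc N , ℕₚ.≤-refl , hit , trans (cong (_+ 1) e) (ℕₚ.+-comm (suc N) 1) , spaced)
    where
    gap = n ∸ k
    n≡ : progression ε n ≡ progression ε k + 6 * gap
    n≡ = trans (cong (progression ε) (sym (ℕₚ.m+[n∸m]≡n (ℕₚ.<⇒≤ k<n)))) (regroup k gap ε)
      where
      regroup : ∀ k g e → 6 * (k + g) + e ≡ 6 * k + e + 6 * g
      regroup = ℕ-Solver.solve-∀
    d≤gap : d ≤ gap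
    d≤gap = ∣⇒≤ ⦃ >-nonZero (ℕₚ.m<n⇒0<n∸m k<n) ⦄ (cancel6 gap (∣m+n∣m⇒∣n (subst (d ∣_) n≡ hit) hit′))
    spaced : d * (6 * suc N + 1) ≤ progression ε n
    spaced = begin
      d * (6 * suc N + 1)        ≡⟨ regroup d N ⟩
      d * (6 * N + 1) + 6 * d    ≤⟨ ℕₚ.+-mono-≤ le (ℕₚ.*-monoʳ-≤ 6 d≤gap) ⟩
      progression ε k + 6 * gap  ≡⟨ n≡ ⟨
      progression ε n            ∎
      where
      open ℕₚ.≤-Reasoning
      regroup : ∀ d N → d * (6 * suc N + 1) ≡ d * (6 * N + 1) + 6 * d
      regroup = ℕ-Solver.solve-∀

module PrimePower {p} (pp : Prime p) (p≢2 : p ≢ 2) (p≢3 : p ≢ 3) (j : ℕ) where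

  cancel6 : ∀ x → p ^ j ∣ 6 * x → p ^ j ∣ x
  cancel6 x d = coprime-divisor (coprime-^ pp prime[3] p≢3 j)
    (coprime-divisor (coprime-^ pp prime[2] p≢2 j) (subst (p ^ j ∣_) (ℕₚ.*-assoc 2 3 x) d))

  odd : ∃[ m ] p ^ j ≡ m + suc m
  odd with even-or-odd (p ^ j)
  ... | inj₂ o = o
  ... | inj₁ (m , e) with () ← coprime-^ pp prime[2] p≢2 j
      (divides {2} m (trans e (trans (cong (m +_) (sym (ℕₚ.+-identityʳ m))) (ℕₚ.*-comm 2 m))) , ∣-refl)

-- `ε` is 1 or 5. If a prime p and its cofactor c satisfy pc ≡ ε (mod 6), `split` leaves p ≡ ε or c
-- ≡ 5, and in the second case c is too large when p ≥ 2n.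
record Residue (ε : ℕ) : Set where
  field
    small : 1 ≤ ε × ε ≤ 5
    2∤    : ¬ 2 ∣ ε
    3∤    : ¬ 3 ∣ ε
    split : ∀ (i j : Fin 6) → (toℕ i * toℕ j) % 6 ≡ ε → toℕ i ≡ ε ⊎ toℕ j ≡ 5

  ε≥1 = proj₁ small
  ε≤5 = proj₂ small

split? : ∀ ε → Dec (∀ (i j : Fin 6) → (toℕ i * toℕ j) % 6 ≡ ε → toℕ i ≡ ε ⊎ toℕ j ≡ 5)
split? ε = Finₚ.all? λ i → Finₚ.all? λ j → (((toℕ i * toℕ j) % 6) ≟ ε) →-dec
    ((toℕ i ≟ ε) ⊎-dec (toℕ j ≟ 5))

residue-1 : Residue 1
residue-1 = record { small = s≤s z≤n , s≤s z≤n ; 2∤ = λ d → ℕₚ.<⇒≱ (s≤s (s≤s z≤n))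
    (∣⇒≤ d) ; 3∤ = λ d → ℕₚ.<⇒≱ (s≤s (s≤s z≤n)) (∣⇒≤ d)
  ; split = from-yes (split? 1) }

residue-5 : Residue 5
residue-5 = record { small = s≤s z≤n , ℕₚ.≤-refl ; 2∤ = from-no (2 ∣? 5) ; 3∤ = from-no (3 ∣? 5)
  ; split = from-yes (split? 5) }

module Comparison {ε} (res : Residue ε) (n : ℕ) where
  open Residue res

  A B : ℕ
  A = Π< n (progression ε)
  B = Π< n oddProgression

  W : ℕ
  W = 6 * n

  value<W : ∀ {k} → k < n → progression ε k < W
  value<W {k} k<n = ℕₚ.<-≤-trans (subst (progression ε k <_)
      (trans (ℕₚ.+-comm (6 * k) 6) (sym (ℕₚ.*-suc 6 k))) (ℕₚ.+-monoʳ-< (6 * k) (s≤s ε≤5)))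
      (ℕₚ.*-monoʳ-≤ 6 k<n)

  hits-W : ∀ d → (∀ x → d ∣ 6 * x → d ∣ x) → hits (progression ε) d n ≡ 0 ⊎
      (∃[ N ] hits (progression ε) d n ≡ suc N × d * (6 * N + 1) < W)
  hits-W d cancel6 with progression-hits ε≥1 cancel6 n
  ... | inj₁ e = inj₁ e
  ... | inj₂ (k , N , k<n , _ , e , le) = inj₂ (N , e , ℕₚ.≤-<-trans le (value<W k<n))

  module _ {p} (pp : Prime p) (p≢2 : p ≢ 2) (p≢3 : p ≢ 3) where

    -- With d = p^j, N + 1 multiples of d among the 6k + ε force d(6N + 1) < 6n, which leaves room
    -- for N odd multiples of d below 2n. So the surplus is at most one, and occurs only for d ≤ W.
    hits-excess : ∀ j → hits (progression ε) (p ^ j) n ≤ hits oddProgression (p ^ j) n + ⟦ p ^ j ≤? W ⟧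
    hits-excess j with hits-W (p ^ j) (PrimePower.cancel6 pp p≢2 p≢3 j)
    ... | inj₁ e = subst (_≤ _) (sym e) z≤n
    ... | inj₂ (N , e , lt) = subst₂ _≤_ (sym e)
        (cong (hits oddProgression d n +_) (sym (⟦⟧-true (d ≤? W) d≤W)))
            (ℕₚ.≤-trans (≤+1 N lt) (ℕₚ.≤-reflexive (ℕₚ.+-comm 1 _)))
      where
      d = p ^ j
      d≤W : d ≤ W
      d≤W = ℕₚ.≤-trans (ℕₚ.≤-trans (ℕₚ.≤-reflexive (sym (ℕₚ.*-identityʳ d)))
          (ℕₚ.*-monoʳ-≤ d (ℕₚ.m≤n+m 1 (6 * N)))) (ℕₚ.<⇒≤ lt)
      ≤+1 : ∀ N → d * (6 * N + 1) < W → suc N ≤ suc (hits oddProgression d n)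
      ≤+1 zero    _  = s≤s z≤n
      ≤+1 (suc N) lt with PrimePower.odd pp p≢2 p≢3 j
      ... | m , d≡ = s≤s (odd-hits-lower d≡ N {n} (ℕₚ.*-cancelˡ-< 6 _ _ (ℕₚ.≤-<-trans bound lt)))
        where
        bound : 6 * (m + d * N) ≤ d * (6 * suc N + 1)
        bound = begin
          6 * (m + d * N)                          ≤⟨ ℕₚ.m≤m+n _ (8 * m + 7) ⟩
          6 * (m + d * N) + (8 * m + 7)            ≡⟨ regroup₁ m d N ⟩
          (m + suc m) * 7 + d * (6 * N)            ≡⟨ cong (λ z → z * 7 + d * (6 * N)) d≡ ⟨
          d * 7 + d * (6 * N)                      ≡⟨ regroup₂ d N ⟩
          d * (6 * suc N + 1)                      ∎
          where
          open ℕₚ.≤-Reasoning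
          regroup₁ : ∀ m d N → 6 * (m + d * N) + (8 * m + 7) ≡ (m + suc m) * 7 + d * (6 * N)
          regroup₁ = ℕ-Solver.solve-∀
          regroup₂ : ∀ d N → d * 7 + d * (6 * N) ≡ d * (6 * suc N + 1)
          regroup₂ = ℕ-Solver.solve-∀

    hits-higher : ∀ j → W < p * p → hits (progression ε) (p ^ suc (suc j)) n ≡ 0
    hits-higher j W<p² with hits-W (p ^ suc (suc j)) (PrimePower.cancel6 pp p≢2 p≢3 (suc (suc j)))
    ... | inj₁ e = e
    ... | inj₂ (N , e , lt) = ⊥-elim (ℕₚ.<-asym lt (ℕₚ.<-≤-trans W<p² (begin
      p * p                              ≤⟨ ℕₚ.m≤m*n (p * p)
          (p ^ j) ⦃ ℕₚ.m^n≢0 p j ⦃ prime⇒nonZero pp ⦄ ⦄ ⟩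
      p * p * p ^ j                      ≡⟨ ℕₚ.*-assoc p p (p ^ j) ⟩
      p ^ suc (suc j)                    ≡⟨ ℕₚ.*-identityʳ _ ⟨
      p ^ suc (suc j) * 1                ≤⟨ ℕₚ.*-monoʳ-≤ (p ^ suc (suc j)) (ℕₚ.m≤n+m 1 (6 * N)) ⟩
      p ^ suc (suc j) * (6 * N + 1)      ∎)))
      where open ℕₚ.≤-Reasoning

  no-hits : ∀ p → ¬ p ∣ ε → (∀ k → p ∣ 6 * k) → ∀ j → hits (progression ε) (p ^ suc j) n ≡ 0
  no-hits p p∤ε p∣6 j = Σ<-zero n λ k _ → ⟦⟧-false (p ^ suc j ∣? progression ε k)
    λ d → p∤ε (∣m+n∣m⇒∣n (∣-trans (m∣m*n (p ^ j)) d) (p∣6 k))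

  residue-split : ∀ x y k → x * y ≡ progression ε k → x % 6 ≡ ε ⊎ 5 ≤ y
  residue-split x y k e with split (fromℕ< (m%n<n x 6)) (fromℕ< (m%n<n y 6)) product%6
    where
    ε%6 : ∀ e → e ≤ 5 → e % 6 ≡ e
    ε%6 0 _ = refl
    ε%6 1 _ = refl
    ε%6 2 _ = refl
    ε%6 3 _ = refl
    ε%6 4 _ = refl
    ε%6 5 _ = refl
    ε%6 (suc (suc (suc (suc (suc (suc _)))))) (s≤s (s≤s (s≤s (s≤s (s≤s ())))))
    product%6 : (toℕ (fromℕ< (m%n<n x 6)) * toℕ (fromℕ< (m%n<n y 6))) % 6 ≡ ε
    product%6 = begin
      (toℕ (fromℕ< (m%n<n x 6)) * toℕ (fromℕ< (m%n<n y 6))) % 6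
        ≡⟨ cong₂ (λ a b → (a * b) % 6) (Finₚ.toℕ-fromℕ< (m%n<n x 6)) (Finₚ.toℕ-fromℕ< (m%n<n y 6)) ⟩
      ((x % 6) * (y % 6)) % 6   ≡⟨ %-distribˡ-* x y 6 ⟨
      (x * y) % 6               ≡⟨ cong (_% 6)
          (trans e (trans (ℕₚ.+-comm (6 * k) ε) (cong (ε +_) (ℕₚ.*-comm 6 k)))) ⟩
      (ε + k * 6) % 6           ≡⟨ [m+kn]%n≡m%n ε k 6 ⟩
      ε % 6                     ≡⟨ ε%6 ε ε≤5 ⟩
      ε                         ∎
      where open ≡-Reasoning
  ... | inj₁ x%6≡ε = inj₁ (trans (sym (Finₚ.toℕ-fromℕ< (m%n<n x 6))) x%6≡ε)
  ... | inj₂ y%6≡5 = inj₂ (subst (_≤ y) (trans (sym (Finₚ.toℕ-fromℕ< (m%n<n y 6))) y%6≡5) (m%n≤m y 6))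

  -- Primes above `s`, a bound for √(6n), divide terms only to the first power; primes above `Y`,
  -- about 6n/7, divide at most one term; `t` counts multiples of 3 guaranteed among the numbers 2k
  -- + 1.
  module _ {q s t Y : ℕ} (qp : Prime q) (s² : W < suc s * suc s) (3t≤ : 3 * t ≤ n + 1)
      (Y-large : W < 7 * suc Y)
           (isolated : ∀ p → Prime p → 2 * n ≤ p → p < W → p % 6 ≡ ε → p ≡ q) where
    private
      -- One generous bound for all primes and terms involved; it also serves as cutoff for
      -- exponents, since M < 2^M.
      M = suc (W + n + q + s + Y + 3)
      J = M
      w : ℕ → ℕ
      w p = Σ< J λ j → ⟦ p ^ suc j ≤? W ⟧
      EA EB bound : ℕ → ℕ
      EA p = Σ< J λ j → hits (progression ε) (p ^ suc j) n
      EB p = Σ< J λ j → hits oddProgression (p ^ suc j) n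
      -- The surplus allowed to A over B: one for each power of p up to `W` if p ≤ s, one if p ≤ Y,
      -- and one for p = q.
      bound p = EB p + (⟦ p <? suc s ⟧ * w p + (⟦ p <? suc Y ⟧ * 1 + ⟦ p ≟ q ⟧ * 1))

    -- The last counted power p^(j+1) is at most `W`, and the count up to there is at most j + 1, so
    -- p to the count is no larger.
    w-bound : 1 ≤ W → ∀ p → p ^ w p ≤ W
    w-bound 1≤W p = proj₁ (go J)
      where
      go : ∀ J → p ^ Σ< J (λ j → ⟦ p ^ suc j ≤? W ⟧) ≤ W × Σ< J (λ j → ⟦ p ^ suc j ≤? W ⟧) ≤ J
      go zero    = 1≤W , z≤n
      go (suc J) with p ^ suc J ≤? W | go J
      ... | no _   | ih , ih′ = subst (λ z → p ^ z ≤ W)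
          (sym (ℕₚ.+-identityʳ (Σ< J λ j → ⟦ p ^ suc j ≤? W ⟧))) ih , subst (_≤ suc J)
          (sym (ℕₚ.+-identityʳ _)) (ℕₚ.m≤n⇒m≤1+n ih′)
      ... | yes le | ih , ih′ = power-≤ p (Σ< J _ + 1) le
          (subst (_≤ suc J) (ℕₚ.+-comm 1 _) (s≤s ih′)) , subst (_≤ suc J) (ℕₚ.+-comm 1 _) (s≤s ih′)
        where
        power-≤ : ∀ p i → p ^ suc J ≤ W → i ≤ suc J → p ^ i ≤ W
        power-≤ zero    zero    _  _ = 1≤W
        power-≤ zero    (suc i) _  _ = z≤n
        power-≤ (suc p) i       le i≤ = ℕₚ.≤-trans (ℕₚ.^-monoʳ-≤ (suc p) i≤) le

    -- For p ≤ Y a surplus of one is allowed. For p > Y two divisible terms would need 7p < 6n. A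
    -- single one is matched by p itself among the numbers 2k + 1 if p < 2n; if p ≥ 2n, its cofactor
    -- is less than 5, so p ≡ ε (mod 6) and isolation gives p = q.
    large-prime : ∀ {p} → Prime p → p ≢ 2 → p ≢ 3 → hits (progression ε) (p ^ 1) n
        ≤ hits oddProgression (p ^ 1) n + (⟦ p <? suc Y ⟧ * 1 + ⟦ p ≟ q ⟧ * 1)
    large-prime {p} pp p≢2 p≢3 with p <? suc Y
    ... | yes _ = ℕₚ.≤-trans (hits-excess pp p≢2 p≢3 1)
        (ℕₚ.+-monoʳ-≤ (hits oddProgression (p ^ 1) n) (ℕₚ.≤-trans (⟦⟧≤1 (p ^ 1 ≤? W)) (ℕₚ.m≤m+n 1 _)))
      where
      ⟦⟧≤1 : ∀ {a} {A : Set a} (d : Dec A) → ⟦ d ⟧ ≤ 1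
      ⟦⟧≤1 (yes _) = ℕₚ.≤-refl
      ⟦⟧≤1 (no _)  = z≤n
    ... | no p≮ with progression-hits ε≥1 (PrimePower.cancel6 pp p≢2 p≢3 1) n
    ...   | inj₁ e = subst (_≤ _) (sym e) z≤n
    ...   | inj₂ (k , suc N , k<n , _ , _ , le) = ⊥-elim (ℕₚ.<-irrefl refl (ℕₚ.<-≤-trans Y-large (begin
        7 * suc Y                   ≤⟨ ℕₚ.*-monoʳ-≤ 7 (ℕₚ.≮⇒≥ p≮) ⟩
        7 * p                       ≡⟨ trans (ℕₚ.*-comm 7 p) (cong (_* 7) (sym (ℕₚ.*-identityʳ p))) ⟩
        p ^ 1 * 7                   ≤⟨ ℕₚ.*-monoʳ-≤ (p ^ 1)
            (ℕₚ.≤-trans (ℕₚ.m≤m+n 7 (6 * N)) (ℕₚ.≤-reflexive (regroup N))) ⟩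
        p ^ 1 * (6 * suc N + 1)     ≤⟨ ℕₚ.≤-trans le (ℕₚ.<⇒≤ (value<W k<n)) ⟩
        W ∎)))
        where
        open ℕₚ.≤-Reasoning
        regroup : ∀ N → 7 + 6 * N ≡ 6 * suc N + 1
        regroup = ℕ-Solver.solve-∀
    ...   | inj₂ (k , zero , k<n , hit , e , le) with ℕₚ.<-≤-connex p (2 * n)
    ...     | inj₁ p<2n with PrimePower.odd pp p≢2 p≢3 1
    ...       | m , p≡ = subst (_≤ _) (sym e) (ℕₚ.≤-trans (odd-hits-lower p≡ 0 {n} m<n) (ℕₚ.m≤m+n _ _))
      where
      m<n : m + p ^ 1 * 0 < n
      m<n = subst (_< n) (sym (trans (cong (m +_) (ℕₚ.*-zeroʳ (p ^ 1))) (ℕₚ.+-identityʳ m)))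
        (ℕₚ.*-cancelˡ-< 2 m n (ℕₚ.<-trans (subst (2 * m <_)
            (sym (trans (sym (ℕₚ.*-identityʳ p)) (trans p≡ (regroup m)))) ℕₚ.≤-refl) p<2n))
        where
        regroup : ∀ m → m + suc m ≡ suc (2 * m)
        regroup = ℕ-Solver.solve-∀
    large-prime {p} pp p≢2 p≢3 | no p≮ | inj₂ (k , zero , k<n , divides c f , e , le) | inj₂ 2n≤p
      with residue-split p c k (trans (ℕₚ.*-comm p c)
          (trans (cong (c *_) (sym (ℕₚ.*-identityʳ p))) (sym f)))
    ...       | inj₁ p%6 = subst₂ _≤_ (sym e) refl
        (ℕₚ.≤-trans (ℕₚ.≤-reflexive (sym (⟦⟧-true (p ≟ q) p≡q)))
        (ℕₚ.≤-trans (ℕₚ.≤-reflexive (sym (ℕₚ.*-identityʳ _))) (ℕₚ.m≤n+m _ _)))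
      where
      p<W : p < W
      p<W = ℕₚ.≤-<-trans (subst (_≤ progression ε k)
          (trans (ℕₚ.*-identityʳ (p ^ 1)) (ℕₚ.*-identityʳ p)) le) (value<W k<n)
      p≡q : p ≡ q
      p≡q = isolated p pp 2n≤p p<W p%6
    ...       | inj₂ 5≤c = ⊥-elim (ℕₚ.<-irrefl refl (ℕₚ.<-≤-trans (value<W k<n) (begin
        6 * n                   ≤⟨ ℕₚ.*-monoˡ-≤ n (ℕₚ.m≤m+n 6 4) ⟩
        10 * n                  ≡⟨ ℕₚ.*-assoc 5 2 n ⟩
        5 * (2 * n)             ≤⟨ ℕₚ.*-mono-≤ 5≤c 2n≤p ⟩
        c * p                   ≡⟨ cong (c *_) (ℕₚ.*-identityʳ p) ⟨
        c * p ^ 1               ≡⟨ f ⟨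
        progression ε k         ∎)))
      where open ℕₚ.≤-Reasoning

    -- The extra factor 3^t is absorbed at p = 3: no 6k + ε is divisible by 3, while at least t of
    -- the numbers 2k + 1 are. For p = 2 the left side is 0.
    exponents : ∀ p → Prime p → EA p + ⟦ p ≟ 3 ⟧ * t ≤ bound p
    exponents p pp with p ≟ 2 | p ≟ 3
    ... | yes refl | yes ()
    ... | yes refl | no _ = subst (_≤ bound 2)
        (sym (trans (ℕₚ.+-identityʳ _) (Σ<-zero J λ j _ → no-hits 2 2∤
        (λ k → divides (3 * k) (regroup k)) j))) z≤n
      where
      regroup : ∀ k → 6 * k ≡ 3 * k * 2
      regroup = ℕ-Solver.solve-∀
    ... | no _ | yes refl = begin
      EA 3 + 1 * t            ≡⟨ cong₂ _+_ (Σ<-zero J λ j _ → no-hits 3 3∤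
          (λ k → divides (2 * k) (regroup k)) j) (ℕₚ.+-identityʳ t) ⟩
      t                       ≤⟨ t≤ t 3t≤ ⟩
      hits oddProgression 3 n ≤⟨ ℕₚ.m≤m+n _ _ ⟩
      hits oddProgression 3 n + Σ< (W + n + q + s + Y + 3)
          (λ j → hits oddProgression (3 ^ suc (suc j)) n)
                              ≡⟨ Σ<-head (W + n + q + s + Y + 3)
                                  (λ j → hits oddProgression (3 ^ suc j) n) ⟨
      EB 3                    ≤⟨ ℕₚ.m≤m+n _ _ ⟩
      bound 3                 ∎
      where
      open ℕₚ.≤-Reasoning
      regroup : ∀ k → 6 * k ≡ 2 * k * 3
      regroup = ℕ-Solver.solve-∀
      t≤ : ∀ t → 3 * t ≤ n + 1 → t ≤ hits oddProgression 3 n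
      t≤ zero    _  = z≤n
      t≤ (suc N) le = odd-hits-lower {3} {1} refl N {n}
          (ℕₚ.+-cancelʳ-≤ 1 _ _ (ℕₚ.≤-trans (ℕₚ.≤-reflexive (regroup′ N)) le))
        where
        regroup′ : ∀ N → suc (1 + 3 * N) + 1 ≡ 3 * suc N
        regroup′ = ℕ-Solver.solve-∀
    ... | no p≢2 | no p≢3 with p <? suc s
    ...   | yes _ = begin
      EA p + 0                        ≡⟨ ℕₚ.+-identityʳ _ ⟩
      EA p                            ≤⟨ Σ<-mono J (λ j _ → hits-excess pp p≢2 p≢3 (suc j)) ⟩
      Σ< J (λ j → hits oddProgression (p ^ suc j) n + ⟦ p ^ suc j ≤? W ⟧) ≡⟨ Σ<-+ J _ _ ⟩
      EB p + w p                      ≤⟨ ℕₚ.+-monoʳ-≤ (EB p)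
          (ℕₚ.≤-trans (ℕₚ.≤-reflexive (sym (ℕₚ.+-identityʳ (w p)))) (ℕₚ.m≤m+n _ _)) ⟩
      EB p + (1 * w p + (⟦ p <? suc Y ⟧ * 1 + ⟦ p ≟ q ⟧ * 1)) ∎
      where open ℕₚ.≤-Reasoning
    ...   | no p≮ = begin
      EA p + 0                        ≡⟨ trans (ℕₚ.+-identityʳ _) (Σ<-head (W + n + q + s + Y + 3) _) ⟩
      hits (progression ε) (p ^ 1) n + Σ< (W + n + q + s + Y + 3)
          (λ j → hits (progression ε) (p ^ suc (suc j)) n)
        ≡⟨ cong (hits (progression ε) (p ^ 1) n +_)
            (Σ<-zero (W + n + q + s + Y + 3) λ j _ → hits-higher pp p≢2 p≢3 j W<p²) ⟩
      hits (progression ε) (p ^ 1) n + 0 ≡⟨ ℕₚ.+-identityʳ _ ⟩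
      hits (progression ε) (p ^ 1) n  ≤⟨ large-prime pp p≢2 p≢3 ⟩
      hits oddProgression (p ^ 1) n + (⟦ p <? suc Y ⟧ * 1 + ⟦ p ≟ q ⟧ * 1)
        ≤⟨ ℕₚ.+-monoˡ-≤ _ (ℕₚ.≤-trans (ℕₚ.m≤m+n (hits oddProgression (p ^ 1) n) _)
            (ℕₚ.≤-reflexive (sym (Σ<-head (W + n + q + s + Y + 3)
            (λ j → hits oddProgression (p ^ suc j) n))))) ⟩
      EB p + (⟦ p <? suc Y ⟧ * 1 + ⟦ p ≟ q ⟧ * 1) ∎
      where
      open ℕₚ.≤-Reasoning
      W<p² : W < p * p
      W<p² = ℕₚ.<-≤-trans s² (ℕₚ.*-mono-≤ (ℕₚ.≮⇒≥ p≮) (ℕₚ.≮⇒≥ p≮))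

    module _ (n≥1 : 1 ≤ n) where
      private
        1≤W : 1 ≤ W
        1≤W = ℕₚ.≤-trans n≥1 (ℕₚ.m≤n*m n 6)
        n<2^n : ∀ n → n < 2 ^ n
        n<2^n zero    = s≤s z≤n
        n<2^n (suc n) = ℕₚ.≤-trans (s≤s (n<2^n n))
            (ℕₚ.≤-trans (ℕₚ.+-monoˡ-≤ (2 ^ n) (ℕₚ.m^n>0 2 n))
            (ℕₚ.≤-reflexive (cong (2 ^ n +_) (sym (ℕₚ.+-identityʳ (2 ^ n))))))
        <M : ∀ {x} → x ≤ W → x < M × x < 2 ^ J
        <M {x} x≤W = x<M , ℕₚ.<-trans x<M (n<2^n M)
          where
          x<M : x < M
          x<M = s≤s (ℕₚ.≤-trans x≤W (ℕₚ.≤-trans (ℕₚ.m≤m+n W (n + q + s + Y + 3))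
              (ℕₚ.≤-reflexive (regroup W n q s Y))))
            where
            regroup : ∀ w n q s y → w + (n + q + s + y + 3) ≡ w + n + q + s + y + 3
            regroup = ℕ-Solver.solve-∀
        A≡ : A ≡ primePowers M EA
        A≡ = Π<-primePowers J M (progression ε) n λ k k<n →
          ℕₚ.≤-trans ε≥1 (ℕₚ.m≤n+m ε (6 * k)) , <M (ℕₚ.<⇒≤ (value<W k<n))
        B≡ : B ≡ primePowers M EB
        B≡ = Π<-primePowers J M oddProgression n λ k k<n →
          ℕₚ.m≤n+m 1 (2 * k) , <M (ℕₚ.≤-trans (ℕₚ.+-mono-≤
              (ℕₚ.*-monoˡ-≤ k {2} {6} (s≤s (s≤s z≤n))) ε≥1) (ℕₚ.<⇒≤ (value<W k<n)))
        ≤M : ∀ a b c → a + (b + c) ≡ W + n + q + s + Y + 3 → b < M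
        ≤M a b c e = s≤s (ℕₚ.≤-trans (ℕₚ.≤-trans (ℕₚ.m≤m+n b c) (ℕₚ.m≤n+m (b + c) a))
            (ℕₚ.≤-reflexive e))
        3<M : 3 < M
        3<M = ≤M (W + n + q + s + Y) 3 0 (regroup W n q s Y)
          where
          regroup : ∀ w n q s y → w + n + q + s + y + (3 + 0) ≡ w + n + q + s + y + 3
          regroup = ℕ-Solver.solve-∀
        q<M : q < M
        q<M = ≤M (W + n) q (s + Y + 3) (regroup W n q s Y)
          where
          regroup : ∀ w n q s y → w + n + (q + (s + y + 3)) ≡ w + n + q + s + y + 3
          regroup = ℕ-Solver.solve-∀
        s<M : s < M
        s<M = ≤M (W + n + q) s (Y + 3) (regroup W n q s Y)
          where
          regroup : ∀ w n q s y → w + n + q + (s + (y + 3)) ≡ w + n + q + s + y + 3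
          regroup = ℕ-Solver.solve-∀
        Y<M : Y < M
        Y<M = ≤M (W + n + q + s) Y 3 (regroup W n q s Y)
          where
          regroup : ∀ w n q s y → w + n + q + s + (y + 3) ≡ w + n + q + s + y + 3
          regroup = ℕ-Solver.solve-∀

      comparison : A * 3 ^ t ≤ B * (W ^ suc s * (4 ^ Y * q))
      comparison = begin
        A * 3 ^ t
          ≡⟨ cong₂ _*_ A≡ (sym (primePowers-single M 3 t prime[3] 3<M)) ⟩
        primePowers M EA * primePowers M (λ p → ⟦ p ≟ 3 ⟧ * t)
          ≡⟨ primePowers-+ M _ _ ⟨
        primePowers M (λ p → EA p + ⟦ p ≟ 3 ⟧ * t)
          ≤⟨ primePowers-mono M (λ p _ pp → exponents p pp) ⟩
        primePowers M bound
          ≡⟨ trans (primePowers-+ M _ _) (cong (primePowers M EB *_)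
              (trans (primePowers-+ M _ _) (cong (primePowers M (λ p → ⟦ p <? suc s ⟧ * w p) *_)
              (primePowers-+ M _ _)))) ⟩
        primePowers M EB * (primePowers M (λ p → ⟦ p <? suc s ⟧ * w p) *
            (primePowers M (λ p → ⟦ p <? suc Y ⟧ * 1) * primePowers M (λ p → ⟦ p ≟ q ⟧ * 1)))
          ≤⟨ ℕₚ.*-mono-≤ (ℕₚ.≤-reflexive (sym B≡)) (ℕₚ.*-mono-≤
               (ℕₚ.≤-trans (primePowers-restrict M (suc s) w s<M)
                   (primePowers-bound (suc s) w W 1≤W λ p _ → w-bound 1≤W p))
               (ℕₚ.*-mono-≤ (ℕₚ.≤-trans (primePowers-restrict M (suc Y) (λ _ → 1) Y<M)
                   (primorial-bound Y))
                            (ℕₚ.≤-reflexive (trans (primePowers-single M q 1 qp q<M)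
                                (ℕₚ.*-identityʳ q))))) ⟩
        B * (W ^ suc s * (4 ^ Y * q)) ∎
        where open ℕₚ.≤-Reasoning

  -- 3^n B is the product of the 6k + 3. In the inductive step 6n + 3 is bounded by the next
  -- correction factor 6n + 7, and the old one, 6n + 1, by the new term 6n + ε.
  growth : 3 ^ n * B ≤ A * (6 * n + 1)
  growth = go n
    where
    go : ∀ n → 3 ^ n * Π< n oddProgression ≤ Π< n (progression ε) * (6 * n + 1)
    go zero    = ℕₚ.≤-refl
    go (suc n) = begin
      3 ^ suc n * (Π< n oddProgression * (2 * n + 1))
        ≡⟨ regroup₁ (3 ^ n) (Π< n oddProgression) n ⟩
      3 ^ n * Π< n oddProgression * (6 * n + 3)
        ≤⟨ ℕₚ.*-monoˡ-≤ (6 * n + 3) (go n) ⟩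
      Π< n (progression ε) * (6 * n + 1) * (6 * n + 3)
        ≤⟨ ℕₚ.*-mono-≤ (ℕₚ.*-monoʳ-≤ (Π< n (progression ε)) (ℕₚ.+-monoʳ-≤ (6 * n) ε≥1))
            (ℕₚ.≤-trans (ℕₚ.+-monoʳ-≤ (6 * n) (ℕₚ.m≤m+n 3 4)) (ℕₚ.≤-reflexive (regroup₂ n))) ⟩
      Π< n (progression ε) * progression ε n * (6 * suc n + 1) ∎
      where
      open ℕₚ.≤-Reasoning
      regroup₁ : ∀ a b n → (3 * a) * (b * (2 * n + 1)) ≡ a * b * (6 * n + 3)
      regroup₁ = ℕ-Solver.solve-∀
      regroup₂ : ∀ n → 6 * n + 7 ≡ 6 * suc n + 1
      regroup₂ = ℕ-Solver.solve-∀

  B>0 : NonZero B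
  B>0 = go n
    where
    go : ∀ n → NonZero (Π< n oddProgression)
    go zero    = _
    go (suc n) = ℕₚ.m*n≢0 _ _ ⦃ go n ⦄ ⦃ >-nonZero (ℕₚ.m≤n+m 1 (2 * n)) ⦄

-- The numerical contradiction for large n

log₄ : ∀ N → 1 ≤ N → ∃[ k ] 4 ^ k ≤ N × N < 4 ^ suc k
log₄ (suc zero)    _ = 0 , ℕₚ.≤-refl , s≤s (s≤s z≤n)
log₄ (suc (suc N)) _ with log₄ (suc N) (s≤s z≤n)
... | k , 4^k≤ , <4^1+k with suc (suc N) <? 4 ^ suc k
...   | yes lt = k , ℕₚ.m≤n⇒m≤1+n 4^k≤ , lt
...   | no ≮   = suc k , ℕₚ.≮⇒≥ ≮ , ℕₚ.≤-<-trans <4^1+k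
    (ℕₚ.^-monoʳ-< 4 (s≤s (s≤s z≤n)) (ℕₚ.n<1+n (suc k)))

^-cancelʳ-≤ : ∀ b {m n} → 1 < b → b ^ m ≤ b ^ n → m ≤ n
^-cancelʳ-≤ b 1<b le = ℕₚ.≮⇒≥ λ n<m → ℕₚ.<⇒≱ (ℕₚ.^-monoʳ-< b 1<b n<m) le

-- 3^28 exceeds 2^44 while the primorial costs only 4^(6n/7), that is 2^(36n) after raising to the power 21.
exponent-bound : ∀ {n t s L Y} → n ≤ 3 * t + 1 → 7 * Y ≤ 6 * n →
                 3 ^ (n + t) ≤ 2 ^ (L * (s + 3) + 2 * Y) → 8 * n ≤ 21 * (L * (s + 3)) + 12
exponent-bound {n} {t} {s} {L} {Y} n≤ 7Y≤ le = ℕₚ.+-cancelʳ-≤ (36 * n) _ _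
    (ℕₚ.≤-trans (ℕₚ.≤-reflexive (regroup₁ n))
  (ℕₚ.≤-trans (^-cancelʳ-≤ 2 ℕₚ.≤-refl powers) (ℕₚ.≤-trans (ℕₚ.≤-reflexive (regroup₂ (L * (s + 3)) Y))
    (ℕₚ.+-monoʳ-≤ (21 * (L * (s + 3)) + 12) (ℕₚ.≤-trans (ℕₚ.*-monoʳ-≤ 6 7Y≤)
        (ℕₚ.≤-reflexive (regroup₃ n)))))))
  where
  regroup₁ : ∀ n → 8 * n + 36 * n ≡ 44 * n
  regroup₁ = ℕ-Solver.solve-∀
  regroup₂ : ∀ x y → (x + 2 * y) * 21 + 12 ≡ 21 * x + 12 + 6 * (7 * y)
  regroup₂ = ℕ-Solver.solve-∀
  regroup₃ : ∀ n → 6 * (6 * n) ≡ 36 * n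
  regroup₃ = ℕ-Solver.solve-∀
  28n≤ : 28 * n ≤ (n + t) * 21 + 7
  28n≤ = ℕₚ.≤-trans (ℕₚ.≤-reflexive (split n))
      (ℕₚ.≤-trans (ℕₚ.+-monoʳ-≤ (21 * n) (ℕₚ.*-monoʳ-≤ 7 n≤)) (ℕₚ.≤-reflexive (merge n t)))
    where
    split : ∀ n → 28 * n ≡ 21 * n + 7 * n
    split = ℕ-Solver.solve-∀
    merge : ∀ n t → 21 * n + 7 * (3 * t + 1) ≡ (n + t) * 21 + 7
    merge = ℕ-Solver.solve-∀
  open ℕₚ.≤-Reasoning
  powers : 2 ^ (44 * n) ≤ 2 ^ ((L * (s + 3) + 2 * Y) * 21 + 12)
  powers = begin
    2 ^ (44 * n)                               ≡⟨ ℕₚ.^-*-assoc 2 44 n ⟨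
    (2 ^ 44) ^ n                               ≤⟨ ℕₚ.^-monoˡ-≤ n (from-yes (2 ^ 44 ≤? 3 ^ 28)) ⟩
    (3 ^ 28) ^ n                               ≡⟨ ℕₚ.^-*-assoc 3 28 n ⟩
    3 ^ (28 * n)                               ≤⟨ ℕₚ.^-monoʳ-≤ 3 28n≤ ⟩
    3 ^ ((n + t) * 21 + 7)                     ≡⟨ ℕₚ.^-distribˡ-+-* 3 ((n + t) * 21) 7 ⟩
    3 ^ ((n + t) * 21) * 3 ^ 7                 ≡⟨ cong (_* 3 ^ 7) (ℕₚ.^-*-assoc 3 (n + t) 21) ⟨
    (3 ^ (n + t)) ^ 21 * 3 ^ 7                 ≤⟨ ℕₚ.*-mono-≤ (ℕₚ.^-monoˡ-≤ 21 le)
        (from-yes (3 ^ 7 ≤? 2 ^ 12)) ⟩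
    (2 ^ (L * (s + 3) + 2 * Y)) ^ 21 * 2 ^ 12  ≡⟨ cong (_* 2 ^ 12)
        (ℕₚ.^-*-assoc 2 (L * (s + 3) + 2 * Y) 21) ⟩
    2 ^ ((L * (s + 3) + 2 * Y) * 21) * 2 ^ 12  ≡⟨ ℕₚ.^-distribˡ-+-* 2 ((L * (s + 3) + 2 * Y) * 21) 12 ⟨
    2 ^ ((L * (s + 3) + 2 * Y) * 21 + 12) ∎

-- The least k with 128(k + 1) ≤ 2^k is 11; this fixes 4^11 as the threshold for 6n between the
-- estimate and the chains of primes.
128[1+k]≤2^k : ∀ j → suc (11 + j) * 128 ≤ 2 ^ (11 + j)
128[1+k]≤2^k zero    = from-yes (12 * 128 ≤? 2 ^ 11)
128[1+k]≤2^k (suc j) = double 128 (11 + j) (128[1+k]≤2^k j)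
  where
  double : ∀ b i {y} → suc i * b ≤ y → suc (suc i) * b ≤ 2 * y
  double b i {y} le = ℕₚ.≤-trans (ℕₚ.+-mono-≤ (ℕₚ.≤-trans (ℕₚ.m≤m+n b (i * b)) le) le)
      (ℕₚ.≤-reflexive (cong (y +_) (sym (ℕₚ.+-identityʳ y))))

-- Applied with x = 2^k of order √(6n) and u = k + 1 of order log n. The right side is at most
-- 757ux, while 128u ≤ x makes the left at least 1024ux.
quadratic-beats-linear : ∀ u x → 1 ≤ u → u * 128 ≤ x → ¬ 8 * (x * x) ≤ 6 *
    (21 * (2 * u * (2 * x + 3)) + 12)
quadratic-beats-linear u x 1≤u 128u≤x le = ℕₚ.<-irrefl refl (begin-strict
  8 * (x * x)                                 ≤⟨ le ⟩
  6 * (21 * (2 * u * (2 * x + 3)) + 12)       ≡⟨ regroup₁ u x ⟩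
  (u * (2 * x + 3)) * 252 + 72                ≤⟨ ℕₚ.+-mono-≤
      (ℕₚ.*-monoˡ-≤ 252 (ℕₚ.*-monoʳ-≤ u (ℕₚ.+-monoʳ-≤ (2 * x) 3≤x))) 72≤ux ⟩
  (u * (2 * x + x)) * 252 + u * x             ≡⟨ cong (λ z → z * 252 + u * x) (regroup₂ u x) ⟩
  (u * x * 3) * 252 + u * x                   ≡⟨ regroup₃ (u * x) ⟩
  u * x * 757                                 <⟨ ℕₚ.*-monoʳ-< (u * x) ⦃ >-nonZero
      (ℕₚ.≤-trans (s≤s z≤n) 72≤ux) ⦄ (from-yes (757 <? 128 * 8)) ⟩
  u * x * (128 * 8)                           ≡⟨ regroup₄ u x 128 ⟩
  8 * ((u * 128) * x)                         ≤⟨ ℕₚ.*-monoʳ-≤ 8 (ℕₚ.*-monoˡ-≤ x 128u≤x) ⟩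
  8 * (x * x) ∎)
  where
  open ℕₚ.≤-Reasoning
  128≤x : 128 ≤ x
  128≤x = ℕₚ.≤-trans (ℕₚ.*-monoˡ-≤ 128 1≤u) 128u≤x
  3≤x : 3 ≤ x
  3≤x = ℕₚ.≤-trans (from-yes (3 ≤? 128)) 128≤x
  72≤ux : 72 ≤ u * x
  72≤ux = ℕₚ.≤-trans (from-yes (72 ≤? 1 * 128)) (ℕₚ.*-mono-≤ 1≤u 128≤x)
  regroup₁ : ∀ u x → 6 * (21 * (2 * u * (2 * x + 3)) + 12) ≡ (u * (2 * x + 3)) * 252 + 72
  regroup₁ = ℕ-Solver.solve-∀
  regroup₂ : ∀ u x → u * (2 * x + x) ≡ u * x * 3
  regroup₂ = ℕ-Solver.solve-∀
  regroup₃ : ∀ z → (z * 3) * 252 + z ≡ z * 757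
  regroup₃ = ℕ-Solver.solve-∀
  regroup₄ : ∀ u x c → u * x * (c * 8) ≡ 8 * ((u * c) * x)
  regroup₄ = ℕ-Solver.solve-∀

module _ {ε} (res : Residue ε) {n q} (qp : Prime q) (q≤ : q ≤ 3 * n + 2)
         (isolated : ∀ p → Prime p → 2 * n ≤ p → p < 6 * n → p % 6 ≡ ε → p ≡ q) where
  open Comparison res n

  -- `growth` bounds A from below and `comparison` bounds it from above; B cancels. The leftover
  -- q(6n + 1) is at most W^2, which turns the exponent s + 1 into s + 3.
  isolated-bound : ∀ {s t Y} → 1 ≤ n → W < suc s * suc s → 3 * t ≤ n + 1 → W < 7 * suc Y →
                   3 ^ (n + t) ≤ W ^ (s + 3) * 4 ^ Y
  isolated-bound {s} {t} {Y} 1≤n s² 3t≤ Y-large = ℕₚ.*-cancelˡ-≤ B ⦃ B>0 ⦄ (begin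
    B * 3 ^ (n + t)                               ≡⟨ cong (B *_) (ℕₚ.^-distribˡ-+-* 3 n t) ⟩
    B * (3 ^ n * 3 ^ t)                           ≡⟨ regroup₁ B (3 ^ n) (3 ^ t) ⟩
    3 ^ n * B * 3 ^ t                             ≤⟨ ℕₚ.*-monoˡ-≤ (3 ^ t) growth ⟩
    A * (6 * n + 1) * 3 ^ t                       ≡⟨ regroup₂ A (6 * n + 1) (3 ^ t) ⟩
    A * 3 ^ t * (6 * n + 1)                       ≤⟨ ℕₚ.*-monoˡ-≤ (6 * n + 1)
        (comparison {q} {s} {t} {Y} qp s² 3t≤ Y-large isolated 1≤n) ⟩
    B * (W ^ suc s * (4 ^ Y * q)) * (6 * n + 1)   ≡⟨ regroup₃ B (W ^ suc s) (4 ^ Y) q (6 * n + 1) ⟩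
    B * (W ^ suc s * (q * (6 * n + 1)) * 4 ^ Y)   ≤⟨ ℕₚ.*-monoʳ-≤ B
        (ℕₚ.*-monoˡ-≤ (4 ^ Y) (ℕₚ.*-monoʳ-≤ (W ^ suc s) (q-factor n 1≤n q≤))) ⟩
    B * (W ^ suc s * (W * W) * 4 ^ Y)             ≡⟨ cong (λ z → B * (z * 4 ^ Y))
        (trans (cong (W ^ suc s *_) (cong (W *_) (sym (ℕₚ.*-identityʳ W))))
        (sym (ℕₚ.^-distribˡ-+-* W (suc s) 2))) ⟩
    B * (W ^ (suc s + 2) * 4 ^ Y)                 ≡⟨ cong (λ z → B * (W ^ z * 4 ^ Y))
        (sym (ℕₚ.+-suc s 2)) ⟩
    B * (W ^ (s + 3) * 4 ^ Y) ∎)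
    where
    open ℕₚ.≤-Reasoning
    regroup₁ : ∀ b x y → b * (x * y) ≡ x * b * y
    regroup₁ = ℕ-Solver.solve-∀
    regroup₂ : ∀ a x y → a * x * y ≡ a * y * x
    regroup₂ = ℕ-Solver.solve-∀
    regroup₃ : ∀ b w y q x → b * (w * (y * q)) * x ≡ b * (w * (q * x) * y)
    regroup₃ = ℕ-Solver.solve-∀
    q-factor : ∀ n → 1 ≤ n → q ≤ 3 * n + 2 → q * (6 * n + 1) ≤ 6 * n * (6 * n)
    q-factor (suc m) _ le = ℕₚ.≤-trans (ℕₚ.*-monoˡ-≤ (6 * suc m + 1) le)
        (ℕₚ.≤-trans (ℕₚ.m≤m+n _ (18 * (m * m) + 21 * m + 1)) (ℕₚ.≤-reflexive (expand m)))
      where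
      expand : ∀ m → (3 * suc m + 2) * (6 * suc m + 1) + (18 * (m * m) + 21 * m + 1) ≡ 6 * suc m *
          (6 * suc m)
      expand = ℕ-Solver.solve-∀

  -- For 4^k ≤ 6n < 4^(k+1) the choice s = 2^(k+1) satisfies 6n < s^2, and every factor `W` costs at
  -- most 2(k + 1) bits. What remains is 8n against a term of order √n log n.
  not-isolated : ¬ 4 ^ 11 ≤ W
  not-isolated large with log₄ W (ℕₚ.≤-trans (from-yes (1 ≤? 4 ^ 11)) large)
  ... | k , 4^k≤W , W<4^1+k with ℕₚ.m≤n⇒∃[o]m+o≡n (ℕₚ.≤-pred (^-exponent (ℕₚ.≤-<-trans large W<4^1+k)))
    where
    ^-exponent : 4 ^ 11 < 4 ^ suc k → 11 < suc k
    ^-exponent lt = ℕₚ.≰⇒> λ 1+k≤11 → ℕₚ.<⇒≱ lt (ℕₚ.^-monoʳ-≤ 4 1+k≤11)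
  ...   | j , refl = quadratic-beats-linear (suc k) x (s≤s z≤n) (128[1+k]≤2^k j) (begin
      8 * (x * x)                                     ≡⟨ cong (8 *_) x*x≡4^k ⟩
      8 * 4 ^ k                                       ≤⟨ ℕₚ.*-monoʳ-≤ 8 4^k≤W ⟩
      8 * (6 * n)                                     ≡⟨ regroup n ⟩
      6 * (8 * n)                                     ≤⟨ ℕₚ.*-monoʳ-≤ 6
          (exponent-bound {n} {t} {2 * x} {2 * suc k} {Y} n≤ 7Y≤ (ℕₚ.≤-trans
                                                           (isolated-bound {2 * x} {t} {Y} 1≤n s² 3t≤ Y-large) powers)) ⟩
      6 * (21 * (2 * suc k * (2 * x + 3)) + 12) ∎)
    where
    open ℕₚ.≤-Reasoning
    regroup : ∀ n → 8 * (6 * n) ≡ 6 * (8 * n)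
    regroup = ℕ-Solver.solve-∀
    x = 2 ^ k
    t = (n + 1) / 3
    Y = 6 * n / 7
    x*x≡4^k : x * x ≡ 4 ^ k
    x*x≡4^k = trans (sym (ℕₚ.^-distribˡ-+-* 2 k k))
        (trans (cong (2 ^_) (trans (cong (k +_) (sym (ℕₚ.+-identityʳ k))) refl))
        (sym (ℕₚ.^-*-assoc 2 2 k)))
    1≤n : 1 ≤ n
    1≤n = ℕₚ.n≢0⇒n>0 λ { refl → ℕₚ.<⇒≱ (from-yes (0 <? 4 ^ 11)) large }
    s² : W < suc (2 * x) * suc (2 * x)
    s² = ℕₚ.<-≤-trans W<4^1+k (ℕₚ.≤-trans (ℕₚ.≤-reflexive
        (trans (cong (4 *_) (sym x*x≡4^k)) (square x)))
        (ℕₚ.*-mono-≤ (ℕₚ.n≤1+n (2 * x)) (ℕₚ.n≤1+n (2 * x))))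
      where
      square : ∀ x → 4 * (x * x) ≡ 2 * x * (2 * x)
      square = ℕ-Solver.solve-∀
    3t≤ : 3 * t ≤ n + 1
    3t≤ = ℕₚ.≤-trans (ℕₚ.≤-reflexive (ℕₚ.*-comm 3 t)) (m/n*n≤m (n + 1) 3)
    n≤ : n ≤ 3 * t + 1
    n≤ = ℕₚ.≤-pred (ℕₚ.≤-trans (ℕₚ.≤-reflexive (ℕₚ.+-comm 1 n))
        (ℕₚ.≤-trans (ℕₚ.≤-reflexive (m≡m%n+[m/n]*n (n + 1) 3))
      (ℕₚ.≤-trans (ℕₚ.+-monoˡ-≤ (t * 3) (ℕₚ.≤-pred (m%n<n (n + 1) 3))) (ℕₚ.≤-reflexive (regroup′ t)))))
      where
      regroup′ : ∀ t → 2 + t * 3 ≡ suc (3 * t + 1)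
      regroup′ = ℕ-Solver.solve-∀
    7Y≤ : 7 * Y ≤ 6 * n
    7Y≤ = ℕₚ.≤-trans (ℕₚ.≤-reflexive (ℕₚ.*-comm 7 Y)) (m/n*n≤m (6 * n) 7)
    Y-large : W < 7 * suc Y
    Y-large = ℕₚ.≤-trans (ℕₚ.≤-reflexive (cong suc (m≡m%n+[m/n]*n (6 * n) 7)))
      (ℕₚ.≤-trans (ℕₚ.+-monoˡ-≤ (Y * 7) (m%n<n (6 * n) 7)) (ℕₚ.≤-reflexive (ℕₚ.*-comm (suc Y) 7)))
    powers : W ^ (2 * x + 3) * 4 ^ Y ≤ 2 ^ (2 * suc k * (2 * x + 3) + 2 * Y)
    powers = ℕₚ.≤-trans (ℕₚ.*-mono-≤ (ℕₚ.^-monoˡ-≤ (2 * x + 3)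
        (ℕₚ.≤-trans (ℕₚ.<⇒≤ W<4^1+k) (ℕₚ.≤-reflexive (ℕₚ.^-*-assoc 2 2 (suc k)))))
        (ℕₚ.≤-reflexive (ℕₚ.^-*-assoc 2 2 Y)))
      (ℕₚ.≤-reflexive (trans (cong (_* 2 ^ (2 * Y)) (ℕₚ.^-*-assoc 2 (2 * suc k) (2 * x + 3)))
          (sym (ℕₚ.^-distribˡ-+-* 2 (2 * suc k * (2 * x + 3)) (2 * Y)))))

-- Primes in the residue classes modulo 3

record Companion (q : ℕ) : Set where
  field
    r       : ℕ
    r-prime : Prime r
    near    : (∃[ m ] r ≡ q + suc m * 3 × r + 3 ≤ q + q) ⊎ (∃[ m ] q ≡ r + suc m * 3 × q + 3 ≤ r + r)

%3-gap : ∀ {a b} → a < b → a % 3 ≡ b % 3 → ∃[ m ] b ≡ a + suc m * 3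
%3-gap {a} {b} a<b e with ℕₚ.m≤n⇒∃[o]m+o≡n a/3<b/3
  where
  a/3<b/3 : a / 3 < b / 3
  a/3<b/3 = ℕₚ.*-cancelʳ-< 3 _ _ (ℕₚ.+-cancelˡ-< (a % 3) _ _ (subst₂ _<_ (m≡m%n+[m/n]*n a 3)
    (trans (m≡m%n+[m/n]*n b 3) (cong (_+ b / 3 * 3) (sym e))) a<b))
... | m , e′ = m , (begin
  b                                ≡⟨ m≡m%n+[m/n]*n b 3 ⟩
  b % 3 + b / 3 * 3                ≡⟨ cong₂ (λ x y → x + y * 3) (sym e) (sym e′) ⟩
  a % 3 + (suc (a / 3) + m) * 3    ≡⟨ regroup (a % 3) (a / 3) m ⟩
  a % 3 + a / 3 * 3 + suc m * 3    ≡⟨ cong (_+ suc m * 3) (m≡m%n+[m/n]*n a 3) ⟨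
  a + suc m * 3                    ∎)
  where
  open ≡-Reasoning
  regroup : ∀ x y m → x + (suc y + m) * 3 ≡ x + y * 3 + suc m * 3
  regroup = ℕ-Solver.solve-∀

Undivided : ℕ → ℕ → Set
Undivided n m = ∀ {d} → d < m → ¬ (2 ≤ d × d ∣ n)

-- The entry (r , m) of the list carries a bound m above the square root of r.
Steps : ℕ → ℕ → List (ℕ × ℕ) → Set
Steps ε a []             = ⊤
Steps ε a ((r , m) ∷ rs) = (r % 3 ≡ ε × r + 3 ≤ a + a × 2
    ≤ r × r < m * m × Undivided r m) × Steps ε r rs

steps? : ∀ ε a rs → Dec (Steps ε a rs)
steps? ε a []             = yes tt
steps? ε a ((r , m) ∷ rs) = ((r % 3 ≟ ε) ×-dec (r + 3 ≤? a + a) ×-dec (2 ≤? r) ×-dec (r <? m * m) ×-dec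
  ℕₚ.allUpTo? (λ d → ¬? ((2 ≤? d) ×-dec (d ∣? r))) m) ×-dec steps? ε r rs

end : ℕ → List (ℕ × ℕ) → ℕ
end a []             = a
end a ((r , _) ∷ rs) = end r rs

-- For a ≤ q < r the next entry r serves, since r + 3 ≤ 2a ≤ 2q; otherwise the search moves on to r.
steps⇒companion : ∀ ε a rs → Steps ε a rs → ∀ {q} → q % 3 ≡ ε → a ≤ q → q < end a rs → Companion q
steps⇒companion ε a [] _ _ a≤q q<a = ⊥-elim (ℕₚ.<⇒≱ q<a a≤q)
steps⇒companion ε a ((r , m) ∷ rs)
    ((r%3 , r+3≤2a , 2≤r , r<m² , undivided) , steps) {q} q%3 a≤q q< with q <? r
... | no q≮r  = steps⇒companion ε r rs steps q%3 (ℕₚ.≮⇒≥ q≮r) q<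
... | yes q<r = record
  { r = r
  ; r-prime = rough∧square>⇒prime ⦃ n>1⇒nonTrivial 2≤r ⦄
      (λ { (hasNonTrivialDivisor {d} d<m d∣r) → undivided d<m (nonTrivial⇒n>1 d , d∣r) }) r<m²
  ; near = inj₁ (let k , e = %3-gap q<r (trans q%3 (sym r%3)) in k , e , ℕₚ.≤-trans r+3≤2a (ℕₚ.+-mono-≤ a≤q a≤q))
  }

-- Primes ≡ 1 and ≡ 2 (mod 3), each close to twice its predecessor so that the chains stay short.
-- Both run past (4^11 + 4)/2, which exceeds every q not covered by the estimate.
primes₁ primes₂ : List (ℕ × ℕ)
primes₁ = (19 , 5) ∷ (31 , 6) ∷ (43 , 7) ∷ (79 , 9) ∷ (151 , 13) ∷ (283 , 17) ∷ (547 , 24) ∷ (1087 , 33) ∷ (2161 , 47) ∷ (4297 , 66) ∷ (8581 , 93) ∷ (17137 , 131) ∷ (34267 , 186) ∷ (68521 , 262) ∷ (137029 , 371) ∷ (274033 , 524) ∷ (548059 , 741) ∷ (1096099 , 1047) ∷ (2192161 , 1481) ∷ []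
primes₂ = (17 , 5) ∷ (29 , 6) ∷ (53 , 8) ∷ (101 , 11) ∷ (197 , 15) ∷ (389 , 20) ∷ (773 , 28) ∷ (1523 , 40) ∷ (3041 , 56) ∷ (6053 , 78) ∷ (12101 , 111) ∷ (24197 , 156) ∷ (48383 , 220) ∷ (96749 , 312) ∷ (193493 , 440) ∷ (386963 , 623) ∷ (773909 , 880) ∷ (1547807 , 1245) ∷ (3095597 , 1760) ∷ []

module _ {q} (qp : Prime q) where

  -- The bounds relating n to q hold for n the integer part of (q - 1) / 3.
  companion-large : ∀ {ε n} → Residue ε → q % 6 ≡ ε → q ≤ 3 * n + 2 → ε + 6 * n ≤ q + q + 3 → q + 3
      ≤ 4 * n →
                    4 ^ 11 ≤ 6 * n → Companion q
  companion-large {ε} {n} res q%6 q≤ 6n≤ q+3≤ large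
    with ℕₚ.anyUpTo? (λ p → prime? p ×-dec (2 * n ≤? p) ×-dec (p % 6 ≟ ε) ×-dec ¬? (p ≟ q)) (6 * n)
  ... | no ¬any = ⊥-elim (not-isolated res {n} qp q≤ isolated large)
    where
    isolated : ∀ p → Prime p → 2 * n ≤ p → p < 6 * n → p % 6 ≡ ε → p ≡ q
    isolated p pp 2n≤p p<6n p%6 with p ≟ q
    ... | yes p≡q = p≡q
    ... | no p≢q  = ⊥-elim (¬any (p , p<6n , pp , 2n≤p , p%6 , p≢q))
  ... | yes (p , p<6n , pp , 2n≤p , p%6 , p≢q) = record { r = p ; r-prime = pp ; near = near }
    where
    mod3 : ∀ x → x % 6 % 3 ≡ x % 3
    mod3 x = m∣n⇒o%n%m≡o%m 3 6 x (divides 2 refl)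
    same : p % 3 ≡ q % 3
    same = trans (sym (mod3 p)) (trans (cong (_% 3) (trans p%6 (sym q%6))) (mod3 q))
    p/6<n : p / 6 < n
    p/6<n = ℕₚ.*-cancelʳ-< 6 _ _ (ℕₚ.≤-<-trans (m/n*n≤m p 6) (subst (p <_) (ℕₚ.*-comm 6 n) p<6n))
    -- p < 6n and p ≡ ε (mod 6) give p ≤ 6(n - 1) + ε, which fits the bound assumed on ε + 6n.
    p+6≤ : p + 6 ≤ ε + 6 * n
    p+6≤ = begin
      p + 6                      ≡⟨ cong (_+ 6) (m≡m%n+[m/n]*n p 6) ⟩
      p % 6 + p / 6 * 6 + 6      ≡⟨ cong (λ z → z + p / 6 * 6 + 6) p%6 ⟩
      ε + p / 6 * 6 + 6          ≡⟨ regroup ε (p / 6) ⟩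
      ε + 6 * suc (p / 6)        ≤⟨ ℕₚ.+-monoʳ-≤ ε (ℕₚ.*-monoʳ-≤ 6 p/6<n) ⟩
      ε + 6 * n ∎
      where
      open ℕₚ.≤-Reasoning
      regroup : ∀ e x → e + x * 6 + 6 ≡ e + 6 * suc x
      regroup = ℕ-Solver.solve-∀
    near : (∃[ m ] p ≡ q + suc m * 3 × p + 3 ≤ q + q) ⊎ (∃[ m ] q ≡ p + suc m * 3 × q + 3 ≤ p + p)
    near with ℕₚ.<-≤-connex q p
    ... | inj₁ q<p = inj₁ (let m , e = %3-gap q<p (sym same) in m , e ,
            ℕₚ.+-cancelʳ-≤ 3 _ _ (ℕₚ.≤-trans (ℕₚ.≤-reflexive (ℕₚ.+-assoc p 3 3)) (ℕₚ.≤-trans p+6≤ 6n≤)))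
    ... | inj₂ p≤q = inj₂ (let m , e = %3-gap (ℕₚ.≤∧≢⇒< p≤q p≢q) same in m , e ,
            ℕₚ.≤-trans q+3≤ (ℕₚ.≤-trans (ℕₚ.≤-reflexive (regroup n)) (ℕₚ.+-mono-≤ 2n≤p 2n≤p)))
      where
      regroup : ∀ n → 4 * n ≡ 2 * n + 2 * n
      regroup = ℕ-Solver.solve-∀

  q-small : ∀ {n} → q ≤ 3 * n + 2 → 6 * n < 4 ^ 11 → q < 2192161
  q-small {n} q≤ small = ℕₚ.*-cancelˡ-< 2 _ _ (ℕₚ.≤-<-trans (ℕₚ.*-monoʳ-≤ 2 q≤)
    (ℕₚ.<-trans (subst (_< 4 ^ 11 + 4) (regroup n) (ℕₚ.+-monoˡ-< 4 small))
        (from-yes (4 ^ 11 + 4 <? 2 * 2192161))))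
    where
    regroup : ∀ n → 6 * n + 4 ≡ 2 * (3 * n + 2)
    regroup = ℕ-Solver.solve-∀

  companion : 11 ≤ q → Companion q
  companion 11≤q = by-residue (q % 6) (q / 6) (m%n<n q 6) (m≡m%n+[m/n]*n q 6) refl
    where
    m≥2 : ∀ {m} → 11 ≤ 1 + m * 6 ⊎ 11 ≤ 5 + m * 6 → 2 ≤ m ⊎ m ≡ 1
    m≥2 {suc (suc m)} _ = inj₁ (s≤s (s≤s z≤n))
    m≥2 {1} _ = inj₂ refl
    m≥2 {0} (inj₁ (s≤s ()))
    m≥2 {0} (inj₂ (s≤s (s≤s (s≤s (s≤s (s≤s ()))))))
    not-multiple : ∀ p → Prime p → p ∣ q → p < 11 → ⊥
    not-multiple p pp p∣q p<11 = ℕₚ.<⇒≢ (ℕₚ.<-≤-trans p<11 11≤q) (prime∣prime pp qp p∣q)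
    q%3 : ∀ {i m} → q ≡ i + m * 6 → q % 3 ≡ i % 3
    q%3 {i} {m} e = trans (cong (_% 3) (trans e (cong (i +_) (regroup m)))) ([m+kn]%n≡m%n i (2 * m) 3)
      where
      regroup : ∀ m → m * 6 ≡ 2 * m * 3
      regroup = ℕ-Solver.solve-∀
    even : ∀ i m → q ≡ 2 * i + m * 6 → Companion q
    even i m e = ⊥-elim (not-multiple 2 prime[2] (divides (i + m * 3) (trans e (regroup i m)))
        (s≤s (s≤s (s≤s z≤n))))
      where
      regroup : ∀ i m → 2 * i + m * 6 ≡ (i + m * 3) * 2
      regroup = ℕ-Solver.solve-∀
    by-residue : ∀ i m → i < 6 → q ≡ i + m * 6 → q % 6 ≡ i → Companion q
    by-residue 0 m _ e _ = even 0 m e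
    by-residue 2 m _ e _ = even 1 m e
    by-residue 4 m _ e _ = even 2 m e
    by-residue 3 m _ e _ = ⊥-elim (not-multiple 3 prime[3]
        (divides (1 + m * 2) (trans e (regroup m))) (s≤s (s≤s (s≤s (s≤s z≤n)))))
      where
      regroup : ∀ m → 3 + m * 6 ≡ (1 + m * 2) * 3
      regroup = ℕ-Solver.solve-∀
    by-residue 1 m _ e q%6 with 4 ^ 11 ≤? 6 * (2 * m)
    ... | yes large = companion-large {n = 2 * m} residue-1 q%6
        (ℕₚ.≤-trans (ℕₚ.≤-reflexive e) (bound₁ m))
        (ℕₚ.≤-trans (bound₂ m) (ℕₚ.≤-reflexive (cong (λ z → z + z + 3) (sym e))))
                        (ℕₚ.≤-trans (ℕₚ.≤-reflexive (cong (_+ 3) e)) (bound₃ m 2≤m)) large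
      where
      2≤m : 2 ≤ m
      2≤m with m≥2 {m} (inj₁ (subst (11 ≤_) e 11≤q))
      ... | inj₁ p = p
      ... | inj₂ refl = ⊥-elim (ℕₚ.<⇒≱ (s≤s (s≤s (s≤s (s≤s (s≤s (s≤s (s≤s (s≤s z≤n))))))))
          (subst (11 ≤_) e 11≤q))
      bound₁ : ∀ m → 1 + m * 6 ≤ 3 * (2 * m) + 2
      bound₁ m = ℕₚ.≤-trans (ℕₚ.n≤1+n _) (ℕₚ.≤-reflexive (regroup m))
        where
        regroup : ∀ m → suc (1 + m * 6) ≡ 3 * (2 * m) + 2
        regroup = ℕ-Solver.solve-∀
      bound₂ : ∀ m → 1 + 6 * (2 * m) ≤ (1 + m * 6) + (1 + m * 6) + 3
      bound₂ m = ℕₚ.≤-trans (ℕₚ.m≤m+n _ 4) (ℕₚ.≤-reflexive (regroup m))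
        where
        regroup : ∀ m → 1 + 6 * (2 * m) + 4 ≡ (1 + m * 6) + (1 + m * 6) + 3
        regroup = ℕ-Solver.solve-∀
      bound₃ : ∀ m → 2 ≤ m → 1 + m * 6 + 3 ≤ 4 * (2 * m)
      bound₃ m 2≤m = ℕₚ.≤-trans (ℕₚ.≤-reflexive (regroup₁ m))
          (ℕₚ.≤-trans (ℕₚ.+-monoʳ-≤ (6 * m) (ℕₚ.*-monoʳ-≤ 2 2≤m)) (ℕₚ.≤-reflexive (regroup₂ m)))
        where
        regroup₁ : ∀ m → 1 + m * 6 + 3 ≡ 6 * m + 2 * 2
        regroup₁ = ℕ-Solver.solve-∀
        regroup₂ : ∀ m → 6 * m + 2 * m ≡ 4 * (2 * m)
        regroup₂ = ℕ-Solver.solve-∀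
    ... | no small  = steps⇒companion 1 13 primes₁ (from-yes (steps? 1 13 primes₁)) (q%3 {1} {m} e) 13≤q
                        (q-small {2 * m} (ℕₚ.≤-trans (ℕₚ.≤-reflexive e)
                            (ℕₚ.≤-trans (ℕₚ.n≤1+n _) (ℕₚ.≤-reflexive (regroup m)))) (ℕₚ.≰⇒> small))
      where
      regroup : ∀ m → suc (1 + m * 6) ≡ 3 * (2 * m) + 2
      regroup = ℕ-Solver.solve-∀
      13≤q : 13 ≤ q
      13≤q with m≥2 {m} (inj₁ (subst (11 ≤_) e 11≤q))
      ... | inj₁ 2≤m = subst (13 ≤_) (sym e) (s≤s (ℕₚ.*-monoˡ-≤ 6 2≤m))
      ... | inj₂ refl = ⊥-elim (ℕₚ.<⇒≱ (s≤s (s≤s (s≤s (s≤s (s≤s (s≤s (s≤s (s≤s z≤n))))))))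
          (subst (11 ≤_) e 11≤q))
    by-residue 5 m _ e q%6 with 4 ^ 11 ≤? 6 * (2 * m + 1)
    ... | yes large = companion-large {n = 2 * m + 1} residue-5 q%6
        (ℕₚ.≤-reflexive (trans e (eq₁ m))) (ℕₚ.≤-trans (bound₂ m)
        (ℕₚ.≤-reflexive (cong (λ z → z + z + 3) (sym e))))
                        (ℕₚ.≤-trans (ℕₚ.≤-reflexive (cong (_+ 3) e))
                            (bound₃ m (2≤m (m≥2 {m} (inj₂ (subst (11 ≤_) e 11≤q)))))) large
      where
      eq₁ : ∀ m → 5 + m * 6 ≡ 3 * (2 * m + 1) + 2
      eq₁ = ℕ-Solver.solve-∀
      2≤m : 2 ≤ m ⊎ m ≡ 1 → 2 ≤ m
      2≤m (inj₁ p)    = p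
      2≤m (inj₂ refl) = ⊥-elim (ℕₚ.<⇒≱ (from-yes (18 <? 4 ^ 11)) large)
      bound₂ : ∀ m → 5 + 6 * (2 * m + 1) ≤ (5 + m * 6) + (5 + m * 6) + 3
      bound₂ m = ℕₚ.≤-trans (ℕₚ.m≤m+n _ 2) (ℕₚ.≤-reflexive (regroup m))
        where
        regroup : ∀ m → 5 + 6 * (2 * m + 1) + 2 ≡ (5 + m * 6) + (5 + m * 6) + 3
        regroup = ℕ-Solver.solve-∀
      bound₃ : ∀ m → 2 ≤ m → 5 + m * 6 + 3 ≤ 4 * (2 * m + 1)
      bound₃ m 2≤m = ℕₚ.≤-trans (ℕₚ.≤-reflexive (regroup₁ m))
          (ℕₚ.≤-trans (ℕₚ.+-monoʳ-≤ (6 * m + 4) (ℕₚ.*-monoʳ-≤ 2 2≤m)) (ℕₚ.≤-reflexive (regroup₂ m)))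
        where
        regroup₁ : ∀ m → 5 + m * 6 + 3 ≡ 6 * m + 4 + 2 * 2
        regroup₁ = ℕ-Solver.solve-∀
        regroup₂ : ∀ m → 6 * m + 4 + 2 * m ≡ 4 * (2 * m + 1)
        regroup₂ = ℕ-Solver.solve-∀
    ... | no small  = steps⇒companion 2 11 primes₂ (from-yes (steps? 2 11 primes₂)) (q%3 {5} {m} e) 11≤q
                        (ℕₚ.<-trans (q-small {2 * m + 1} (ℕₚ.≤-reflexive (trans e (regroup m)))
                            (ℕₚ.≰⇒> small)) (from-yes (2192161 <? 3095597)))
      where
      regroup : ∀ m → 5 + m * 6 ≡ 3 * (2 * m + 1) + 2
      regroup = ℕ-Solver.solve-∀
    by-residue (suc (suc (suc (suc (suc (suc _)))))) m (s≤s (s≤s (s≤s (s≤s (s≤s (s≤s ())))))) _ _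

-- Small cases

All⇒coeff : ∀ {p} → All (λ a → ∣ a ∣ ≤ 1) p → ∀ k → ∣ coeff p k ∣ ≤ 1
All⇒coeff []       k       = z≤n
All⇒coeff (a ∷ as) zero    = a
All⇒coeff (a ∷ as) (suc k) = All⇒coeff as k

take-bound : ∀ n p → All (λ a → ∣ a ∣ ≤ 1) (take n p) → ∀ {k} → k < n → ∣ coeff p k ∣ ≤ 1
take-bound (suc n) []      _        _         = z≤n
take-bound (suc n) (a ∷ p) (b ∷ bs) {zero}  _ = b
take-bound (suc n) (a ∷ p) (b ∷ bs) {suc k} (s≤s k<n) = take-bound n p bs k<n

Bounded : Poly → Set
Bounded p = All (λ a → ∣ a ∣ ≤ 1) p × ∣ coeff p 0 ∣ ≡ 1

bounded? : ∀ p → Dec (Bounded p)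
bounded? p = All.all? (λ a → ∣ a ∣ ≤? 1) p ×-dec (∣ coeff p 0 ∣ ≟ 1)

bounded⇒flat : ∀ {p} → Bounded p → Flat p
bounded⇒flat (as , unit) = All⇒coeff as , 0 , unit

-- For q = 5 the condition (q - 4)(r - 4) ≥ 12 begins to hold at r = 17. The smaller primes include
-- 3 and 5, for which 15r is not squarefree.
small-15r : ∀ {r} → r < 17 → Prime r → Bounded (Ψ (15 * r))
small-15r = from-yes (ℕₚ.allUpTo? (λ r → prime? r →-dec bounded? (Ψ (15 * r))) 17)

-- For q = 7 the bound r ≥ 2q - 1 = 13 is the binding one, so r = 11 must be computed although it
-- already satisfies (q - 4)(r - 4) ≥ 12.
small-21r : ∀ {r} → r < 13 → Prime r → Bounded (Ψ (21 * r))
small-21r = from-yes (ℕₚ.allUpTo? (λ r → prime? r →-dec bounded? (Ψ (21 * r))) 13)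

-- 429 = 3 * 11 * 13: for r = 13 the general bound on low coefficients stops at k = 12, short of 16.
small-429 : All (λ a → ∣ a ∣ ≤ 1) (take 17 (Ψ 429))
small-429 = from-yes (All.all? (λ a → ∣ a ∣ ≤? 1) (take 17 (Ψ 429)))

-- Stated for a variable n because conversion checking of terms containing Ψ 429 is too slow.
low-429 : ∀ n → n ≡ 429 → ∀ {k} → k < 17 → ∣ c n k ∣ ≤ 1
low-429 n n≡429 = take-bound 17 (Ψ n) (subst (λ n → All (λ a → ∣ a ∣ ≤ 1) (take 17 (Ψ n)))
    (sym n≡429) small-429)

largePair : ∀ a b {q r} → 3 < a → 3 < b → 12 ≤ (a ∸ 4) * (b ∸ 4) → Prime q → Prime r → q ≢ r → a ≤ q
    → b ≤ r → LargePair q r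
largePair a b 3<a 3<b 12≤ qp rp q≢r a≤q b≤r = record
  { q-prime = qp ; r-prime = rp ; 3<q = ℕₚ.<-≤-trans 3<a a≤q ; 3<r = ℕₚ.<-≤-trans 3<b b≤r ; q≢r = q≢r
  ; large = ℕₚ.≤-trans 12≤ (ℕₚ.*-mono-≤ (ℕₚ.∸-monoˡ-≤ 4 a≤q) (ℕₚ.∸-monoˡ-≤ 4 b≤r)) }

4≤ : ∀ {m} → 3 < suc (suc (suc (suc m)))
4≤ = s≤s (s≤s (s≤s (s≤s z≤n)))

flat-15r : ∀ {r} → Prime r → Flat (Ψ (15 * r))
flat-15r {r} rp with r <? 17
... | yes r<17 = bounded⇒flat (small-15r r<17 rp)
... | no r≮17  = Ψ-flat (largePair 5 17 4≤ 4≤ (from-yes (12 ≤? 13)) (from-yes (prime? 5)) rp (λ { refl → r≮17 (from-yes (5 <? 17)) }) ℕₚ.≤-refl 17≤r)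
                   (ℕₚ.≤-trans (from-yes (10 ≤? 17)) (ℕₚ.m≤n⇒m≤1+n 17≤r))
  where 17≤r = ℕₚ.≮⇒≥ r≮17

flat-21r : ∀ {r} → Prime r → Flat (Ψ (21 * r))
flat-21r {r} rp with r <? 13
... | yes r<13 = bounded⇒flat (small-21r r<13 rp)
... | no r≮13  = Ψ-flat (largePair 7 13 4≤ 4≤ (from-yes (12 ≤? 27)) (from-yes (prime? 7)) rp (λ { refl → r≮13 (from-yes (7 <? 13)) }) ℕₚ.≤-refl 13≤r)
                   (s≤s 13≤r)
  where 13≤r = ℕₚ.≮⇒≥ r≮13

flat-3qr : ∀ {q r} → Prime q → 11 ≤ q → Prime r → 2 * q ∸ 1 ≤ r → Flat (Ψ (3 * q * r))
flat-3qr {q} {r} qp 11≤q rp le = Ψ-flat (largePair 11 11 4≤ 4≤ (from-yes (12 ≤? 49)) qp rp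
    (ℕₚ.<⇒≢ q<r) 11≤q (ℕₚ.≤-trans 11≤q (ℕₚ.<⇒≤ q<r))) 2q≤1+r
  where
  2q≤1+r : q + q ≤ suc r
  2q≤1+r = ℕₚ.≤-trans (ℕₚ.≤-reflexive (cong (q +_) (sym (ℕₚ.+-identityʳ q))))
      (ℕₚ.≤-trans (ℕₚ.m≤n+m∸n (2 * q) 1) (s≤s le))
  q<r : q < r
  q<r = ℕₚ.≤-pred (ℕₚ.<-≤-trans (ℕₚ.+-monoˡ-< q {1} {q}
      (ℕₚ.<-≤-trans (from-yes (1 <? 11)) 11≤q)) 2q≤1+r)

not-flat-3qr : ∀ {q} → Prime q → 11 ≤ q → ∃[ r ] (Prime r × ¬ Flat (Ψ (3 * q * r)))
not-flat-3qr {q} qp 11≤q = r , r-prime , by-order near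
  where
  open Companion (companion qp 11≤q)
  +-<  : ∀ {a b m} → a ≡ b + suc m * 3 → b < a
  +-< {b = b} {m} refl = ℕₚ.m<m+n b (s≤s z≤n)
  -- A companion below q may be smaller than 11, but not below 7, and (7 - 4)(11 - 4) = 21 ≥ 12
  -- still holds.
  7≤ : ∀ {x} → q + 3 ≤ x + x → 7 ≤ x
  7≤ le = ℕₚ.≮⇒≥ λ x<7 → ℕₚ.<⇒≱ (ℕₚ.<-≤-trans (s≤s (ℕₚ.+-mono-≤ (ℕₚ.≤-pred x<7) (ℕₚ.≤-pred x<7)))
      (ℕₚ.≤-trans (from-yes (13 ≤? 11 + 3)) (ℕₚ.+-monoˡ-≤ 3 11≤q))) le
  by-order : (∃[ m ] r ≡ q + suc m * 3 × r + 3 ≤ q + q) ⊎ (∃[ m ] q ≡ r + suc m * 3 × q + 3 ≤ r + r)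
      → ¬ Flat (Ψ (3 * q * r))
  by-order (inj₁ (m , e , le)) = Ψ-not-flat (largePair 11 11 4≤ 4≤ (from-yes (12 ≤? 49)) qp r-prime
      (ℕₚ.<⇒≢ (+-< {m = m} e)) 11≤q (ℕₚ.≤-trans 11≤q (ℕₚ.<⇒≤ (+-< {m = m} e)))) m e le
  -- The companion is the smaller prime here, so the two exchange roles and 3rq = 3qr.
  by-order (inj₂ (m , e , le)) = subst (λ n → ¬ Flat (Ψ n)) (commute r q)
    (Ψ-not-flat (largePair 7 11 4≤ 4≤ (from-yes (12 ≤? 21)) r-prime qp (ℕₚ.<⇒≢ (+-< {m = m} e))
        (7≤ le) 11≤q) m e le)
    where
    commute : ∀ r q → 3 * r * q ≡ 3 * q * r
    commute = ℕ-Solver.solve-∀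

data Above3 : ℕ → Set where
  five      : Above3 5
  seven     : Above3 7
  eleven    : Above3 11
  from-13   : ∀ {q} → 13 ≤ q → Above3 q

above3 : ∀ {q} → Prime q → 3 < q → Above3 q
above3 {q} qp 3<q with q <? 13
... | no q≮13 = from-13 (ℕₚ.≮⇒≥ q≮13)
... | yes q<13 with small q<13 qp 3<q
  where
  small : ∀ {q} → q < 13 → Prime q → 3 < q → q ≡ 5 ⊎ q ≡ 7 ⊎ q ≡ 11
  small = from-yes (ℕₚ.allUpTo? (λ q → prime? q →-dec
      ((3 <? q) →-dec ((q ≟ 5) ⊎-dec (q ≟ 7) ⊎-dec (q ≟ 11)))) 13)
...   | inj₁ refl        = five
...   | inj₂ (inj₁ refl) = seven
...   | inj₂ (inj₂ refl) = eleven

-- For q = 5 and q = 7 flatness is already known. From q = 11 on, r ≥ 17 gives k ≤ 16 < r, and the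
-- only remaining pair is (11, 13).
low-3qr : ∀ {q r} → Prime q → Prime r → 3 < q → q < r → ∀ k → k ≤ 16 → ∣ c (3 * q * r) k ∣ ≤ 1
low-3qr {q} {r} qp rp 3<q q<r k k≤16 = by-size (above3 qp 3<q) (r <? 17)
  where
  from-17 : 11 ≤ q → 17 ≤ r → ∣ c (3 * q * r) k ∣ ≤ 1
  from-17 11≤q 17≤r = Ψ-low-coefficients (largePair 11 17 4≤ 4≤ (from-yes (12 ≤? 91)) qp rp
      (ℕₚ.<⇒≢ q<r) 11≤q 17≤r) k (ℕₚ.<-≤-trans (s≤s k≤16) 17≤r)
  r≡13 : ∀ {r} → r < 17 → Prime r → 11 < r → r ≡ 13
  r≡13 = from-yes (ℕₚ.allUpTo? (λ r → prime? r →-dec ((11 <? r) →-dec (r ≟ 13))) 17)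
  by-size : Above3 q → Dec (r < 17) → ∣ c (3 * q * r) k ∣ ≤ 1
  by-size five         _          = proj₁ (flat-15r rp) k
  by-size seven        _          = proj₁ (flat-21r rp) k
  by-size eleven       (no r≮17)  = from-17 ℕₚ.≤-refl (ℕₚ.≮⇒≥ r≮17)
  by-size eleven       (yes r<17) = low-429 (3 * 11 * r) (cong (3 * 11 *_) (r≡13 r<17 rp q<r))
      (s≤s k≤16)
  by-size (from-13 13≤q) (no r≮17)  = from-17 (ℕₚ.≤-trans (from-yes (11 ≤? 13)) 13≤q) (ℕₚ.≮⇒≥ r≮17)
  by-size (from-13 13≤q) (yes r<17) = ⊥-elim (ℕₚ.<⇒≱ q<r
      (subst (_≤ q) (sym (r≡13 r<17 rp (ℕₚ.<-trans (from-yes (11 <? 13))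
      (ℕₚ.≤-<-trans 13≤q q<r)))) 13≤q))

theorem6 : ((r : ℕ) → Prime r → Flat (Ψ (15 * r)) × Flat (Ψ (21 * r)))
    × ((q : ℕ) → Prime q → 11 ≤ q →
    ((r : ℕ) → Prime r → 2 * q ∸ 1 ≤ r → Flat (Ψ (3 * q * r)))
    × (∃[ r ] (Prime r × ¬ Flat (Ψ (3 * q * r)))))
    × ((q r : ℕ) → Prime q → Prime r → 3 < q → q < r →
    (k : ℕ) → k ≤ 16 → ∣ c (3 * q * r) k ∣ ≤ 1)

theorem6 =
  (λ r rp → flat-15r rp , flat-21r rp) ,
  (λ q qp 11≤q → (λ r rp → flat-3qr qp 11≤q rp) , not-flat-3qr qp 11≤q) ,
  (λ q r → low-3qr)
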